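{- For each prime $p>3$, let $\alpha=\alpha(p)$ be the unique integer with $0<\alpha<p^2$ and $\alpha\equiv -24^{ -1}\pmod{p^2}$. Then for a positive proportion of primes $p$ it holds that $$\sum_{n=0}^{\infty} b_3\bigl(2(pn+\alpha)\bigr)q^n\equiv \sum_{n=0}^{\infty} b_3(2n)\,q^{pn}\pmod 2.$$
   Context: For a positive integer $t$, $b_t(n)$ denotes the number of $t$-regular partitions of $n$, i.e. partitions of $n$ none of whose parts is divisible by $t$ (with $b_t(0)=1$); equivalently $\sum_{n\ge0}b_t(n)q^n=\prod_{j\ge1}\frac{1-q^{tj}}{1-q^j}$. A congruence between formal power series modulo $2$ means coefficientwise congruence. "A positive proportion of primes" means a set of primes having positive (lower) density within the set of all primes. -}

module Defs where

open import Data.Nat using (ℕ; zero; suc; _+_; _*_; _∸_; _≤_; _<_; _≤ᵇ_; _%_)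
open import Data.Nat.Divisibility using (_∣_; _∣?_; divides)
open import Data.Nat.Primality using (Prime; prime?)
open import Data.List using (List; map; upTo; filter; length)
open import Data.Nat.ListAction using (sum)
open import Data.Bool using (if_then_else_)
open import Data.Product using (_×_)
open import Relation.Nullary using (yes; no)
open import Relation.Binary.PropositionalEquality using (_≡_)

-- regParts t m n = number of partitions of n all of whose parts lie in
-- {1,…,m} and none of whose parts is divisible by t.
-- Recursion on the largest allowed part m: the part m is either forbidden
-- (t ∣ m) or it is used exactly k times, 0 ≤ k, k*m ≤ n.
regParts : ℕ → ℕ → ℕ → ℕ
regParts t zero zero = 1
regParts t zero (suc n) = 0
regParts t (suc m) n with t ∣? suc m
... | yes _ = regParts t m n
... | no  _ = sum (map (λ k → if k * suc m ≤ᵇ n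
                               then regParts t m (n ∸ k * suc m)
                               else 0)
                       (upTo (suc n)))

-- b t n : the number of t-regular partitions of n (parts are ≤ n).
b : ℕ → ℕ → ℕ
b t n = regParts t n n

rhsCoeff : ℕ → ℕ → ℕ
rhsCoeff p m with p ∣? m
... | yes (divides k _) = b 3 (2 * k)
... | no  _ = 0

primeCount : ℕ → ℕ
primeCount x = length (filter prime? (upTo (suc x)))

-- The property of the prime p asserted in the theorem:
-- for the α with 0 < α < p², α ≡ -24⁻¹ (mod p²) (i.e. p² ∣ 24α+1),
-- Σ b_3(2(pn+α)) qⁿ ≡ Σ b_3(2n) q^{pn} (mod 2), coefficientwise.
GoodPrime : ℕ → Set
GoodPrime p =
  Prime p × 3 < p ×
  ((α : ℕ) → 0 < α → α < p * p → p * p ∣ 24 * α + 1 →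
    (n : ℕ) → b 3 (2 * (p * n + α)) % 2 ≡ rhsCoeff p n % 2)

{-# OPTIONS --safe #-}

-- Put η = ∏ (1 - q^j), which modulo 2 is Σ_{s ∈ ℤ} q^{s (3 s + 1) / 2}, and
-- θ = 1 + Σ_{m ≥ 1, 3 ∤ m} q^{m²}. Multiplication by 1 + √-2 in ℤ[√-2] gives
-- η³ ≡ η(q³) θ. The series B of b₃ satisfies B η = η(q³), so B θ ≡ η² and
-- B θ² ≡ η² θ; as squares are series in q², comparing even parts shows that
-- Σ b₃(2n) q^n ≡ η θ. Hence b₃(2n) has the parity of the number of x, m ≥ 0 with
-- 24 n + 1 = x² + 24 m² and m = 0 or 3 ∤ m. If (-6/p) = -1, i.e. if p is 13, 17, 19
-- or 23 modulo 24, then p ∣ x² + 24 m² forces p ∣ x and p ∣ m (Thue), and the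
-- congruence for p follows with 24 α + 1 = p².
--
-- That these p have positive proportion is a Chebyshev argument. Put X = 24 K and
-- compare ∏_{m ≤ X} m^{w⁺ m} with ∏_{m ≤ X} m^{w⁻ m}, where w⁺ is 1 on 3 mod 6 and 2
-- on the inert classes, and w⁻ is 2 on 2 mod 4. The first product is odd and at least
-- as large as the second, which contains 2^{12 K}. A prime with (-6/p) = 1 occurs at
-- most as often in the first as in the second, so the inert primes (and 3) have to
-- account for 2^{12 K}.

module Submission where

open import Defs
open import Algebra.Bundles using (CommutativeMonoid; CommutativeRing)
import Algebra.Properties.CommutativeSemigroup as CommutativeSemigroupProperties
open import Data.Bool.Base using (Bool; true; false; if_then_else_; not; _∧_; _xor_; T)
open import Data.Bool.ListAction using (any)
import Data.Bool.Properties as Bool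
open import Data.Empty using (⊥; ⊥-elim)
import Data.Fin.Base as Fin
import Data.Fin.Properties as Fin
open import Data.Integer.Base as ℤ using (ℤ; -[1+_]) renaming (+_ to infix 8 ⁺_; ∣_∣ to abs)
import Data.Integer.DivMod as ℤ
import Data.Integer.Divisibility.Signed as Signed
import Data.Integer.Properties as ℤ
import Data.Integer.Tactic.RingSolver as ℤ
open import Data.List.Base using (List; []; _∷_; _++_; cartesianProduct; applyUpTo; downFrom; filter; length; map; upTo)
open import Data.List.Membership.Propositional using (_∈_)
open import Data.List.Membership.Propositional.Properties using (∈-filter⁺; ∈-filter⁻; ∈-map⁺; ∈-map⁻; ∈-upTo⁻; ∈-cartesianProduct⁺; ∈-downFrom⁺; ∈-downFrom⁻)
open import Data.List.Membership.Propositional.Properties.WithK using (unique∧set⇒bag)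
open import Data.List.Properties using (filter-++; length-++; length-map; upTo-∷ʳ)
open import Data.List.Relation.Binary.BagAndSetEquality using (∼bag⇒↭)
open import Data.List.Relation.Binary.Permutation.Propositional.Properties using (↭-length)
open import Data.List.Relation.Unary.All as All using (All; []; _∷_)
open import Data.List.Relation.Unary.AllPairs using ([]; _∷_)
open import Data.List.Relation.Unary.Any using (here; there)
open import Data.List.Relation.Unary.Unique.Propositional using (Unique)
import Data.List.Relation.Unary.Unique.Propositional.Properties as Unique
open import Data.Nat.Base hiding (∣_-_∣)
open import Data.Nat.Combinatorics hiding (_P_)
open import Data.Nat.DivMod
open import Data.Nat.Divisibility
open import Data.Nat.ListAction using (product; sum)
open import Data.Nat.Primality
open import Data.Nat.Primality.Factorisation
open import Data.Nat.Properties
open import Data.Nat.Tactic.RingSolver using (solve-∀)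
open import Data.Product.Base using (∃-syntax; _×_; _,_; proj₁; proj₂)
open import Data.Sum.Base using (_⊎_; inj₁; inj₂; [_,_]′)
open import Function.Base using (_∘_; _|>_)
open import Function.Bundles using (_⇔_; mk⇔)
open import Level using (0ℓ)
open import Relation.Binary.PropositionalEquality hiding ([_])
open import Relation.Nullary
open import Relation.Nullary.Decidable using (dec-false; dec-true; does-⇔; from-yes; T?)

-- The lower bound for the inert primes has order x / log x. It becomes a positive proportion only
-- against an upper bound of the same order for all primes, which comes from central binomial
-- coefficients. Half the binary logarithm, rounded down, stands for log x in the final comparison,
-- where it cancels. The two products come from the coefficients of (1 - 2^(-s)) (1 - 2^(1-s)) ζ(s)
-- - L(s, χ) with χ = (-6/·). The factor 1 - 2^(1-s) removes the pole of ζ, so the partial sums are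
-- bounded. Multiplying the argument by an odd prime p fixes the coefficients of the first series
-- and multiplies those of the second by χ(p); hence a split prime sees the original partial sums
-- and an inert prime sees them with the sign of χ reversed. On the modular side every series is a
-- list of coefficients, and η and θ at n are sums over lists cut off in terms of n; infinite
-- products occur only truncated. A coefficient is then the parity of a number of solutions, and
-- identities between theta series become bijections of finite solution lists.

∑ ∏ : ℕ → (ℕ → ℕ) → ℕ
∑ zero    f = 0
∑ (suc n) f = ∑ n f + f (suc n)
∏ zero    f = 1
∏ (suc n) f = ∏ n f * f (suc n)

∑-cong : ∀ n {f g} → (∀ k → 1 ≤ k → k ≤ n → f k ≡ g k) → ∑ n f ≡ ∑ n g
∑-cong zero    h = refl
∑-cong (suc n) h = cong₂ _+_ (∑-cong n λ k a b → h k a (m≤n⇒m≤1+n b)) (h (suc n) (s≤s z≤n) ≤-refl)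

∑-mono : ∀ n {f g} → (∀ k → 1 ≤ k → k ≤ n → f k ≤ g k) → ∑ n f ≤ ∑ n g
∑-mono zero    h = z≤n
∑-mono (suc n) h = +-mono-≤ (∑-mono n λ k a b → h k a (m≤n⇒m≤1+n b)) (h (suc n) (s≤s z≤n) ≤-refl)

∑-zero : ∀ n → ∑ n (λ _ → 0) ≡ 0
∑-zero zero    = refl
∑-zero (suc n) = trans (+-identityʳ _) (∑-zero n)

∑-+ : ∀ n f g → ∑ n (λ k → f k + g k) ≡ ∑ n f + ∑ n g
∑-+ zero    f g = refl
∑-+ (suc n) f g = trans (cong (_+ (f (suc n) + g (suc n))) (∑-+ n f g))
                        (interchange (∑ n f) (∑ n g) (f (suc n)) (g (suc n)))
  where
  interchange : ∀ a b c d → (a + b) + (c + d) ≡ (a + c) + (b + d)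
  interchange = solve-∀

∑-*ʳ : ∀ n c f → ∑ n (λ k → f k * c) ≡ ∑ n f * c
∑-*ʳ zero    c f = refl
∑-*ʳ (suc n) c f = trans (cong (_+ f (suc n) * c) (∑-*ʳ n c f)) (sym (*-distribʳ-+ c (∑ n f) _))

∑-swap : ∀ m n (f : ℕ → ℕ → ℕ) → ∑ m (λ i → ∑ n (f i)) ≡ ∑ n (λ j → ∑ m (λ i → f i j))
∑-swap zero    n f = sym (∑-zero n)
∑-swap (suc m) n f = trans (cong (_+ ∑ n (f (suc m))) (∑-swap m n f)) (sym (∑-+ n _ _))

∑-split : ∀ m n f → ∑ (m + n) f ≡ ∑ m f + ∑ n (λ k → f (m + k))
∑-split m zero    f rewrite +-identityʳ m | +-identityʳ (∑ m f) = refl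
∑-split m (suc n) f rewrite +-suc m n | ∑-split m n f = +-assoc (∑ m f) _ _

∏-cong : ∀ n {f g} → (∀ k → 1 ≤ k → k ≤ n → f k ≡ g k) → ∏ n f ≡ ∏ n g
∏-cong zero    h = refl
∏-cong (suc n) h = cong₂ _*_ (∏-cong n λ k a b → h k a (m≤n⇒m≤1+n b)) (h (suc n) (s≤s z≤n) ≤-refl)

∏-mono : ∀ n {f g} → (∀ k → 1 ≤ k → k ≤ n → f k ≤ g k) → ∏ n f ≤ ∏ n g
∏-mono zero    h = ≤-refl
∏-mono (suc n) h = *-mono-≤ (∏-mono n λ k a b → h k a (m≤n⇒m≤1+n b)) (h (suc n) (s≤s z≤n) ≤-refl)

∏-one : ∀ n → ∏ n (λ _ → 1) ≡ 1
∏-one zero    = refl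
∏-one (suc n) = trans (*-identityʳ _) (∏-one n)

*-interchange : ∀ a b c d → (a * b) * (c * d) ≡ (a * c) * (b * d)
*-interchange = solve-∀

∏-* : ∀ n f g → ∏ n (λ k → f k * g k) ≡ ∏ n f * ∏ n g
∏-* zero    f g = refl
∏-* (suc n) f g = trans (cong (_* (f (suc n) * g (suc n))) (∏-* n f g))
                        (*-interchange (∏ n f) (∏ n g) (f (suc n)) (g (suc n)))

∏-swap : ∀ m n (f : ℕ → ℕ → ℕ) → ∏ m (λ i → ∏ n (f i)) ≡ ∏ n (λ j → ∏ m (λ i → f i j))
∏-swap zero    n f = sym (∏-one n)
∏-swap (suc m) n f = trans (cong (_* ∏ n (f (suc m))) (∏-swap m n f)) (sym (∏-* n _ _))

^-distribʳ-* : ∀ c a b → (a * b) ^ c ≡ a ^ c * b ^ c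
^-distribʳ-* zero    a b = refl
^-distribʳ-* (suc c) a b = trans (cong (a * b *_) (^-distribʳ-* c a b)) (*-interchange a b (a ^ c) (b ^ c))

∏-^ : ∀ n f c → ∏ n f ^ c ≡ ∏ n (λ k → f k ^ c)
∏-^ zero    f c = ^-zeroˡ c
∏-^ (suc n) f c = trans (^-distribʳ-* c (∏ n f) (f (suc n))) (cong (_* f (suc n) ^ c) (∏-^ n f c))

^-∑ : ∀ b n f → ∏ n (λ k → b ^ f k) ≡ b ^ ∑ n f
^-∑ b zero    f = refl
^-∑ b (suc n) f = trans (cong (_* b ^ f (suc n)) (^-∑ b n f)) (sym (^-distribˡ-+-* b (∑ n f) _))

∏≢0 : ∀ n {f} → (∀ k → 1 ≤ k → k ≤ n → 1 ≤ f k) → 1 ≤ ∏ n f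
∏≢0 n {f} h = subst (_≤ ∏ n f) (∏-one n) (∏-mono n h)

[_] : ∀ {P : Set} → Dec P → ℕ
[ yes _ ] = 1
[ no  _ ] = 0

[]-true : ∀ {P : Set} (P? : Dec P) → P → [ P? ] ≡ 1
[]-true (yes _) p = refl
[]-true (no ¬p) p = ⊥-elim (¬p p)

[]-false : ∀ {P : Set} (P? : Dec P) → ¬ P → [ P? ] ≡ 0
[]-false (yes p) ¬p = ⊥-elim (¬p p)
[]-false (no _)  ¬p = refl

[]-⇔ : ∀ {P Q : Set} (P? : Dec P) (Q? : Dec Q) → (P → Q) → (Q → P) → [ P? ] ≡ [ Q? ]
[]-⇔ P? (yes q) f g = []-true P? (g q)
[]-⇔ P? (no ¬q) f g = []-false P? (¬q ∘ f)

[]≤1 : ∀ {P : Set} (P? : Dec P) → [ P? ] ≤ 1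
[]≤1 (yes _) = ≤-refl
[]≤1 (no _)  = z≤n

∑-point : ∀ n a → 1 ≤ a → a ≤ n → ∑ n (λ k → [ k ≟ a ]) ≡ 1
∑-point zero    (suc a) 1≤a ()
∑-point (suc n) a 1≤a a≤n with suc n ≟ a
... | yes refl = trans (cong (_+ 1) (trans (∑-cong n λ k _ k≤n → []-false (k ≟ suc n) (<⇒≢ (s≤s k≤n))) (∑-zero n))) refl
... | no ≢a = trans (+-identityʳ _) (∑-point n a 1≤a (s≤s⁻¹ (≤∧≢⇒< a≤n (≢a ∘ sym))))

∏-point : ∀ n a → 1 ≤ a → a ≤ n → ∏ n (λ k → k ^ [ k ≟ a ]) ≡ a
∏-point n a 1≤a a≤n = trans (∏-cong n point) (trans (^-∑ a n _) (trans (cong (a ^_) (∑-point n a 1≤a a≤n)) (*-identityʳ a)))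
  where
  point : ∀ k → 1 ≤ k → k ≤ n → k ^ [ k ≟ a ] ≡ a ^ [ k ≟ a ]
  point k _ _ with k ≟ a
  ... | yes refl = refl
  ... | no _     = refl

-- Every block of `d` consecutive numbers contributes its last element only, and the incomplete
-- block of length `n % d` at the end contributes nothing.
∑-multiples : ∀ n d .{{_ : NonZero d}} (h : ℕ → ℕ) → ∑ n (λ m → [ d ∣? m ] * h m) ≡ ∑ (n / d) (λ k → h (k * d))
∑-multiples n d h = trans (cong (λ z → ∑ z F) (m≡m%n+[m/n]*n n d))
                   (trans (cong (λ z → ∑ z F) (+-comm (n % d) _))
                   (trans (below (n / d) (n % d) (m%n<n n d)) (blocks (n / d))))
  where
  F = λ m → [ d ∣? m ] * h m
  below : ∀ q r → r < d → ∑ (q * d + r) F ≡ ∑ (q * d) F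
  below q zero    r<d = cong (λ z → ∑ z F) (+-identityʳ (q * d))
  below q (suc r) r<d rewrite +-suc (q * d) r =
    trans (cong₂ _+_ (below q r (≤-trans (n≤1+n _) r<d)) (cong (_* h (suc (q * d + r))) ([]-false (d ∣? suc (q * d + r)) λ d∣ →
      <⇒≱ r<d (∣⇒≤ (∣m+n∣m⇒∣n (subst (d ∣_) (sym (+-suc (q * d) r)) d∣) (n∣m*n q))))))
      (+-identityʳ _)
  blocks : ∀ q → ∑ (q * d) F ≡ ∑ q (λ k → h (k * d))
  blocks zero    = refl
  blocks (suc q) = begin
    ∑ (d + q * d) F                       ≡⟨ cong (λ z → ∑ z F) (trans (+-comm d (q * d)) (trans (cong (q * d +_) (sym (suc-pred d))) (+-suc (q * d) (pred d)))) ⟩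
    ∑ (q * d + pred d) F + F (suc (q * d + pred d)) ≡⟨ cong₂ _+_ (trans (below q (pred d) (≤-reflexive (suc-pred d))) (blocks q)) last ⟩
    ∑ q (λ k → h (k * d)) + h (suc q * d) ∎
    where
    open ≡-Reasoning
    idx : suc (q * d + pred d) ≡ suc q * d
    idx = trans (sym (+-suc (q * d) (pred d))) (trans (cong (q * d +_) (suc-pred d)) (+-comm (q * d) d))
    last : F (suc (q * d + pred d)) ≡ h (suc q * d)
    last rewrite idx = trans (cong (_* h (suc q * d)) ([]-true (d ∣? (suc q * d)) (n∣m*n (suc q)))) (*-identityˡ _)

-- Prime factorisations and valuations

count : ℕ → List ℕ → ℕ
count p []       = 0
count p (a ∷ as) = [ p ≟ a ] + count p as

-- The `p`-adic valuation for prime `p`, with a default value at 0. It vanishes for every other `p`,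
-- so products over all `p ≤ n` can stand for products over the primes.
ν : ℕ → ℕ → ℕ
ν p zero    = 0
ν p (suc n) = count p (factors (factorise (suc n)))

count-notPrime : ∀ {p as} → All Prime as → ¬ Prime p → count p as ≡ 0
count-notPrime []         ¬p = refl
count-notPrime {p} {a ∷ as} (pa ∷ pas) ¬p = cong₂ _+_ ([]-false (p ≟ a) λ { refl → ¬p pa }) (count-notPrime pas ¬p)

ν-notPrime : ∀ {p} n → ¬ Prime p → ν p n ≡ 0
ν-notPrime zero    ¬p = refl
ν-notPrime (suc n) ¬p = count-notPrime (PrimeFactorisation.factorsPrime (factorise (suc n))) ¬p

product≡∏ : ∀ n {as} → All (λ a → 1 ≤ a × a ≤ n) as → product as ≡ ∏ n (λ p → p ^ count p as)
product≡∏ n [] = sym (∏-one n)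
product≡∏ n {a ∷ as} ((1≤a , a≤n) ∷ h) = sym (begin
  ∏ n (λ p → p ^ ([ p ≟ a ] + count p as))      ≡⟨ ∏-cong n (λ p _ _ → ^-distribˡ-+-* p [ p ≟ a ] (count p as)) ⟩
  ∏ n (λ p → p ^ [ p ≟ a ] * p ^ count p as)     ≡⟨ ∏-* n _ _ ⟩
  ∏ n (λ p → p ^ [ p ≟ a ]) * ∏ n (λ p → p ^ count p as) ≡⟨ cong₂ _*_ (∏-point n a 1≤a a≤n) (sym (product≡∏ n h)) ⟩
  a * product as ∎)
  where open ≡-Reasoning

1≤prime : ∀ {p} → Prime p → 1 ≤ p
1≤prime pr = >-nonZero⁻¹ _ ⦃ prime⇒nonZero pr ⦄

primes≤product : ∀ {as n} → All Prime as → product as ≤ n → 1 ≤ n → All (λ a → 1 ≤ a × a ≤ n) as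
primes≤product [] _ _ = []
primes≤product {a ∷ as} (pa ∷ pas) le 1≤n =
  (1≤prime pa , ≤-trans (m≤m*n a (product as) ⦃ nz ⦄) le)
  ∷ primes≤product pas (≤-trans (m≤n*m (product as) a ⦃ prime⇒nonZero pa ⦄) le) 1≤n
  where
  nz : NonZero (product as)
  nz = >-nonZero (productOfPrimes≥1 pas)

factorisation-∏ : ∀ {n} m → 1 ≤ m → m ≤ n → m ≡ ∏ n (λ p → p ^ ν p m)
factorisation-∏ {n} (suc m) 1≤m m≤n =
  trans isFactorisation (product≡∏ n (primes≤product factorsPrime (subst (_≤ n) isFactorisation m≤n) (≤-trans 1≤m m≤n)))
  where open PrimeFactorisation (factorise (suc m)) using (isFactorisation; factorsPrime)

^count∣product : ∀ p as → p ^ count p as ∣ product as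
^count∣product p [] = ∣-refl
^count∣product p (a ∷ as) with p ≟ a
... | yes refl = *-monoʳ-∣ p (^count∣product p as)
... | no _     = ∣n⇒∣m*n a (^count∣product p as)

^∣*⇒^∣ : ∀ {p} j a n → Prime p → ¬ p ∣ a → p ^ j ∣ a * n → p ^ j ∣ n
^∣*⇒^∣ zero    a n pr p∤a _ = 1∣ n
^∣*⇒^∣ {p} (suc j) a n pr p∤a h with euclidsLemma a n pr (∣-trans (m∣m*n (p ^ j)) h)
... | inj₁ p∣a = ⊥-elim (p∤a p∣a)
... | inj₂ (divides q refl) = subst (p ^ suc j ∣_) (*-comm p q)
    (*-monoʳ-∣ p (^∣*⇒^∣ j a q pr p∤a (*-cancelˡ-∣ p ⦃ prime⇒nonZero pr ⦄ (subst (p ^ suc j ∣_) (shuffle a q p) h))))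
  where
  shuffle : ∀ a q p → a * (q * p) ≡ p * (a * q)
  shuffle = solve-∀

^∣product⇒≤count : ∀ {p as} j → Prime p → All Prime as → p ^ j ∣ product as → j ≤ count p as
^∣product⇒≤count zero    pr _ _ = z≤n
^∣product⇒≤count {p} {[]} (suc j) pr [] h = ⊥-elim (¬prime[1] (subst Prime (m*n≡1⇒m≡1 p (p ^ j) (∣1⇒≡1 h)) pr))
^∣product⇒≤count {p} {a ∷ as} (suc j) pr (pa ∷ pas) h with p ≟ a
... | yes refl = s≤s (^∣product⇒≤count j pr pas (*-cancelˡ-∣ p ⦃ prime⇒nonZero pr ⦄ h))
... | no p≢a = ^∣product⇒≤count (suc j) pr pas (^∣*⇒^∣ (suc j) a (product as) pr p∤a h)
  where
  p∤a : ¬ p ∣ a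
  p∤a p∣a with prime⇒irreducible pa p∣a
  ... | inj₁ refl = ¬prime[1] pr
  ... | inj₂ eq   = p≢a eq

∑-[≤] : ∀ J c → c ≤ J → ∑ J (λ j → [ j ≤? c ]) ≡ c
∑-[≤] zero    .0 z≤n = refl
∑-[≤] (suc J) c c≤J with c ≤? J
... | yes c≤J′ = trans (cong₂ _+_ (∑-[≤] J c c≤J′) ([]-false (suc J ≤? c) (<⇒≱ (s≤s c≤J′)))) (+-identityʳ c)
... | no c≰J with ≤-antisym c≤J (≰⇒> c≰J)
... | refl = trans (cong₂ _+_ (trans (∑-cong J λ k _ k≤J → trans ([]-true (k ≤? suc J) (m≤n⇒m≤1+n k≤J)) (sym ([]-true (k ≤? J) k≤J))) (∑-[≤] J J ≤-refl))
                               ([]-true (suc J ≤? suc J) ≤-refl)) (+-comm J 1)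

n<2^n : ∀ n → n < 2 ^ n
n<2^n zero    = s≤s z≤n
n<2^n (suc n) = ≤-trans (+-mono-≤ (≤-trans (s≤s z≤n) (n<2^n n)) (n<2^n n)) (≤-reflexive (cong (2 ^ n +_) (sym (+-identityʳ _))))

2≤prime : ∀ {p} → Prime p → 2 ≤ p
2≤prime pr = nonTrivial⇒n>1 _ ⦃ prime⇒nonTrivial pr ⦄

-- `p ^ j` divides `m` exactly for `j ≤ ν p m`. The range up to `J ≥ m` is long enough because a
-- number `c` with `p ^ c ∣ m` satisfies `c < 2 ^ c ≤ p ^ c ≤ m`.
ν≡∑ : ∀ {p} m J → Prime p → 1 ≤ m → m ≤ J → ν p m ≡ ∑ J (λ j → [ p ^ j ∣? m ])
ν≡∑ {p} (suc m) J pr _ m≤J =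
  trans (sym (∑-[≤] J c c≤J)) (∑-cong J λ j _ _ →
    []-⇔ (j ≤? c) (p ^ j ∣? suc m)
      (λ j≤c → subst (p ^ j ∣_) (sym isFactorisation)
                 (∣-trans (m≤n⇒^m∣^n j≤c) (^count∣product p factors₁)))
      (λ d → ^∣product⇒≤count j pr factorsPrime (subst (p ^ j ∣_) isFactorisation d)))
  where
  open PrimeFactorisation (factorise (suc m)) using (isFactorisation; factorsPrime)
  factors₁ = factors (factorise (suc m))
  c = count p factors₁
  m≤n⇒^m∣^n : ∀ {j k} → j ≤ k → p ^ j ∣ p ^ k
  m≤n⇒^m∣^n {j} {k} j≤k = divides (p ^ (k ∸ j)) (trans (cong (p ^_) (sym (m∸n+n≡m j≤k))) (^-distribˡ-+-* p (k ∸ j) j))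
  c≤J : c ≤ J
  c≤J = begin
    c          ≤⟨ <⇒≤ (n<2^n c) ⟩
    2 ^ c      ≤⟨ ^-monoˡ-≤ c (2≤prime pr) ⟩
    p ^ c      ≤⟨ ∣⇒≤ (subst (p ^ c ∣_) (sym isFactorisation) (^count∣product p factors₁)) ⟩
    suc m      ≤⟨ m≤J ⟩
    J          ∎
    where open ≤-Reasoning

∏-factorisation : ∀ n (h : ℕ → ℕ) → ∏ n (λ m → m ^ h m) ≡ ∏ n (λ p → p ^ ∑ n (λ m → ν p m * h m))
∏-factorisation n h = begin
  ∏ n (λ m → m ^ h m)                              ≡⟨ ∏-cong n (λ m 1≤m m≤n → cong (_^ h m) (factorisation-∏ m 1≤m m≤n)) ⟩
  ∏ n (λ m → ∏ n (λ p → p ^ ν p m) ^ h m)          ≡⟨ ∏-cong n (λ m _ _ → ∏-^ n _ (h m)) ⟩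
  ∏ n (λ m → ∏ n (λ p → (p ^ ν p m) ^ h m))        ≡⟨ ∏-cong n (λ m _ _ → ∏-cong n λ p _ _ → ^-*-assoc p (ν p m) (h m)) ⟩
  ∏ n (λ m → ∏ n (λ p → p ^ (ν p m * h m)))        ≡⟨ ∏-swap n n _ ⟩
  ∏ n (λ p → ∏ n (λ m → p ^ (ν p m * h m)))        ≡⟨ ∏-cong n (λ p _ _ → ^-∑ p n _) ⟩
  ∏ n (λ p → p ^ ∑ n (λ m → ν p m * h m))          ∎
  where open ≡-Reasoning

-- A weighted form of Legendre's formula for the exponent of `p` in `n !`.
∑-ν : ∀ {p} n (h : ℕ → ℕ) .{{_ : NonZero p}} → Prime p →
      ∑ n (λ m → ν p m * h m) ≡ ∑ n (λ j → ∑ ((n / p ^ j) {{m^n≢0 p j}}) (λ k → h (k * p ^ j)))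
∑-ν {p} n h pr = begin
  ∑ n (λ m → ν p m * h m)                           ≡⟨ ∑-cong n (λ m 1≤m m≤n → cong (_* h m) (ν≡∑ m n pr 1≤m m≤n)) ⟩
  ∑ n (λ m → ∑ n (λ j → [ p ^ j ∣? m ]) * h m)      ≡⟨ ∑-cong n (λ m _ _ → sym (∑-*ʳ n (h m) _)) ⟩
  ∑ n (λ m → ∑ n (λ j → [ p ^ j ∣? m ] * h m))      ≡⟨ ∑-swap n n _ ⟩
  ∑ n (λ j → ∑ n (λ m → [ p ^ j ∣? m ] * h m))      ≡⟨ ∑-cong n (λ j _ _ → ∑-multiples n (p ^ j) {{m^n≢0 p j}} h) ⟩
  ∑ n (λ j → ∑ ((n / p ^ j) {{m^n≢0 p j}}) (λ k → h (k * p ^ j))) ∎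
  where open ≡-Reasoning

-- A Chebyshev lower bound for the inert primes

-- The residues r mod 24 with (-6/r) = 1 and (-6/r) = -1, respectively.
χ⁺ χ⁻ : ℕ → Bool
χ⁺ r = any (r ≡ᵇ_) (1 ∷ 5 ∷ 7 ∷ 11 ∷ [])
χ⁻ r = any (r ≡ᵇ_) (13 ∷ 17 ∷ 19 ∷ 23 ∷ [])

-- w⁺ - w⁻ = g - χ, where χ = (-6/·) and g takes the values 1, -2, 1, 0 at 1, 2, 3, 4 mod 4.
-- The partial sums of g - χ are ≤ 0, while those of g + χ, which occur at the
-- multiples of an inert prime, are only ≤ 5.
w⁺ w⁻ : ℕ → ℕ
w⁺ r = if any (r ≡ᵇ_) (3 ∷ 9 ∷ 15 ∷ 21 ∷ []) then 1 else if χ⁻ r then 2 else 0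
w⁻ r = if does (r % 4 ≟ 2) then 2 else 0

-- The weights along the multiples of `d`. They have period 24 in `k` and depend on `d` modulo 24
-- only, so finite tables cover all prime powers `d`.
W : (ℕ → ℕ) → ℕ → ℕ → ℕ
W w d k = w ((k * d) % 24)

W-periodic : ∀ w d k → W w d (24 + k) ≡ W w d k
W-periodic w d k = cong w (trans (cong (_% 24) (shift k d)) ([m+kn]%n≡m%n (k * d) d 24))
  where
  shift : ∀ k d → (24 + k) * d ≡ k * d + d * 24
  shift = solve-∀

W-residue : ∀ w d k → W w d k ≡ W w (d % 24) k
W-residue w d k = cong w (trans (%-distribˡ-* k d 24) (trans (cong (λ z → (k % 24 * z) % 24) (sym (m%n%n≡m%n d 24))) (sym (%-distribˡ-* k (d % 24) 24))))

∑-periodic : ∀ (a : ℕ → ℕ) → (∀ k → a (24 + k) ≡ a k) → ∀ q s → ∑ (q * 24 + s) a ≡ q * ∑ 24 a + ∑ s a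
∑-periodic a per zero    s = refl
∑-periodic a per (suc q) s =
  trans (∑-split 24 (q * 24 + s) a)
  (trans (cong (∑ 24 a +_) (trans (∑-cong (q * 24 + s) λ k _ _ → per k) (∑-periodic a per q s)))
         (sym (+-assoc (∑ 24 a) (q * ∑ 24 a) (∑ s a))))

-- A full period does not increase the difference of the two sums, so the worst case occurs within
-- the first period.
∑-periodic-≤ : ∀ (a b : ℕ → ℕ) E → (∀ k → a (24 + k) ≡ a k) → (∀ k → b (24 + k) ≡ b k) →
               ∑ 24 a ≤ ∑ 24 b → (∀ {s} → s < 24 → ∑ s a ≤ ∑ s b + E) → ∀ y → ∑ y a ≤ ∑ y b + E
∑-periodic-≤ a b E pa pb total prefix y = subst (λ y → ∑ y a ≤ ∑ y b + E) (sym y≡) (begin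
  ∑ (q * 24 + s) a         ≡⟨ ∑-periodic a pa q s ⟩
  q * ∑ 24 a + ∑ s a       ≤⟨ +-mono-≤ (*-monoʳ-≤ q total) (prefix (m%n<n y 24)) ⟩
  q * ∑ 24 b + (∑ s b + E) ≡⟨ sym (+-assoc (q * ∑ 24 b) (∑ s b) E) ⟩
  q * ∑ 24 b + ∑ s b + E   ≡⟨ cong (_+ E) (sym (∑-periodic b pb q s)) ⟩
  ∑ (q * 24 + s) b + E     ∎)
  where
  open ≤-Reasoning
  q = y / 24
  s = y % 24
  y≡ : y ≡ q * 24 + s
  y≡ = trans (m≡m%n+[m/n]*n y 24) (+-comm s (q * 24))

W-total : ∀ {r} → r < 24 → ∑ 24 (W w⁺ r) ≤ ∑ 24 (W w⁻ r)
W-total = from-yes (allUpTo? (λ r → ∑ 24 (W w⁺ r) ≤? ∑ 24 (W w⁻ r)) 24)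

W-prefix : ∀ {r} → r < 24 → ∀ {s} → s < 24 → ∑ s (W w⁺ r) ≤ ∑ s (W w⁻ r) + (if χ⁺ r then 0 else 5)
W-prefix = from-yes (allUpTo? (λ r → allUpTo? (λ s → ∑ s (W w⁺ r) ≤? ∑ s (W w⁻ r) + (if χ⁺ r then 0 else 5)) 24) 24)

∑-W : ∀ d y → ∑ y (W w⁺ d) ≤ ∑ y (W w⁻ d) + (if χ⁺ (d % 24) then 0 else 5)
∑-W d y = subst₂ _≤_ (∑-cong y λ k _ _ → sym (W-residue w⁺ d k)) (cong (_+ E) (∑-cong y λ k _ _ → sym (W-residue w⁻ d k)))
  (∑-periodic-≤ (W w⁺ r) (W w⁻ r) E (W-periodic w⁺ r) (W-periodic w⁻ r) (W-total (m%n<n d 24)) (W-prefix (m%n<n d 24)) y)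
  where
  r = d % 24
  E = if χ⁺ r then 0 else 5

h⁺ h⁻ : ℕ → ℕ
h⁺ = W w⁺ 1
h⁻ = W w⁻ 1

h≡W : ∀ w d k → W w 1 (k * d) ≡ W w d k
h≡W w d k = cong (λ z → w (z % 24)) (*-identityʳ (k * d))

∑-h⁻ : ∀ K → ∑ (K * 24) h⁻ ≡ K * 12
∑-h⁻ K = trans (cong (λ z → ∑ z h⁻) (sym (+-identityʳ (K * 24)))) (trans (∑-periodic h⁻ (W-periodic w⁻ 1) K 0) (+-identityʳ (K * 12)))

∑-h⁺ : ∀ K → ∑ (K * 24) h⁺ ≡ K * 12
∑-h⁺ K = trans (cong (λ z → ∑ z h⁺) (sym (+-identityʳ (K * 24)))) (trans (∑-periodic h⁺ (W-periodic w⁺ 1) K 0) (+-identityʳ (K * 12)))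

∑h⁺≤∑h⁻ : ∀ y → ∑ y h⁺ ≤ ∑ y h⁻
∑h⁺≤∑h⁻ y = ≤-trans (∑-W 1 y) (≤-reflexive (+-identityʳ _))

-- By Abel summation, as a ≤ b holds for all partial sums.
∏-abel : ∀ (a b : ℕ → ℕ) → (∀ y → ∑ y a ≤ ∑ y b) →
         ∀ y w → ∑ y b ≡ ∑ y a + w → ∏ y (λ m → m ^ b m) ≤ ∏ y (λ m → m ^ a m) * y ^ w
∏-abel a b a≤b zero    zero    eq = ≤-refl
∏-abel a b a≤b (suc y) w eq with m≤n⇒∃[o]m+o≡n (a≤b y)
... | w′ , eq′ = begin
  N * z ^ b z                   ≤⟨ *-monoˡ-≤ (z ^ b z) (∏-abel a b a≤b y w′ (sym eq′)) ⟩
  D * y ^ w′ * z ^ b z          ≤⟨ *-monoˡ-≤ (z ^ b z) (*-monoʳ-≤ D (^-monoˡ-≤ w′ (n≤1+n y))) ⟩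
  D * z ^ w′ * z ^ b z          ≡⟨ *-assoc D (z ^ w′) (z ^ b z) ⟩
  D * (z ^ w′ * z ^ b z)        ≡⟨ cong (D *_) (sym (^-distribˡ-+-* z w′ (b z))) ⟩
  D * z ^ (w′ + b z)            ≡⟨ cong (λ e → D * z ^ e) exps ⟩
  D * z ^ (a z + w)             ≡⟨ cong (D *_) (^-distribˡ-+-* z (a z) w) ⟩
  D * (z ^ a z * z ^ w)         ≡⟨ sym (*-assoc D (z ^ a z) (z ^ w)) ⟩
  D * z ^ a z * z ^ w           ∎
  where
  open ≤-Reasoning
  z = suc y
  N = ∏ y (λ m → m ^ b m)
  D = ∏ y (λ m → m ^ a m)
  exps : w′ + b z ≡ a z + w
  exps = +-cancelˡ-≡ (∑ y a) _ _ (trans (sym (+-assoc (∑ y a) w′ (b z)))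
    (trans (cong (_+ b z) eq′) (trans eq (+-assoc (∑ y a) (a z) w))))

∏h⁻≤∏h⁺ : ∀ K → ∏ (K * 24) (λ m → m ^ h⁻ m) ≤ ∏ (K * 24) (λ m → m ^ h⁺ m)
∏h⁻≤∏h⁺ K = ≤-trans (∏-abel h⁺ h⁻ ∑h⁺≤∑h⁻ (K * 24) 0 (trans (∑-h⁻ K) (sym (trans (+-identityʳ _) (∑-h⁺ K))))) (≤-reflexive (*-identityʳ _))

Inert : ℕ → Set
Inert p = Prime p × χ⁻ (p % 24) ≡ true

inert? : ∀ p → Dec (Inert p)
inert? p = prime? p ×-dec (χ⁻ (p % 24) Bool.≟ true)

Exceptional : ℕ → Set
Exceptional p = Prime p × p ≢ 2 × χ⁺ (p % 24) ≡ false

exceptional? : ∀ p → Dec (Exceptional p)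
exceptional? p = prime? p ×-dec (¬? (p ≟ 2) ×-dec (χ⁺ (p % 24) Bool.≟ false))

residues₂₄ : ∀ {r} → r < 24 → χ⁺ r ≡ false → 2 ∣ r ⊎ 3 ∣ r ⊎ χ⁻ r ≡ true
residues₂₄ = from-yes (allUpTo? (λ r → (χ⁺ r Bool.≟ false) →-dec (2 ∣? r ⊎-dec (3 ∣? r ⊎-dec (χ⁻ r Bool.≟ true)))) 24)

prime∣prime⇒≡ : ∀ {q p} → Prime q → Prime p → q ∣ p → q ≡ p
prime∣prime⇒≡ pq pp q∣p with prime⇒irreducible pp q∣p
... | inj₁ refl = ⊥-elim (¬prime[1] pq)
... | inj₂ eq   = eq

prime[3] : Prime 3
prime[3] = from-yes (prime? 3)

∣%24⇒∣ : ∀ {d} n → d ∣ 24 → d ∣ n % 24 → d ∣ n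
∣%24⇒∣ n d∣24 d∣ = subst (_ ∣_) (sym (m≡m%n+[m/n]*n n 24)) (∣m∣n⇒∣m+n d∣ (∣n⇒∣m*n (n / 24) d∣24))

exceptional⇒ : ∀ {p} → Exceptional p → p ≡ 3 ⊎ Inert p
exceptional⇒ {p} (pr , p≢2 , eq) with residues₂₄ (m%n<n p 24) eq
... | inj₁ 2∣        = ⊥-elim (p≢2 (sym (prime∣prime⇒≡ prime[2] pr (∣%24⇒∣ p (divides 12 refl) 2∣))))
... | inj₂ (inj₁ 3∣) = inj₁ (sym (prime∣prime⇒≡ prime[3] pr (∣%24⇒∣ p (divides 8 refl) 3∣)))
... | inj₂ (inj₂ e)  = inj₂ (pr , e)

χ⁺-* : ∀ {r} → r < 24 → χ⁺ r ≡ true → ∀ {s} → s < 24 → χ⁺ s ≡ true → χ⁺ ((r * s) % 24) ≡ true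
χ⁺-* = from-yes (allUpTo? (λ r → (χ⁺ r Bool.≟ true) →-dec allUpTo? (λ s → (χ⁺ s Bool.≟ true) →-dec (χ⁺ ((r * s) % 24) Bool.≟ true)) 24) 24)

χ⁺-^ : ∀ p j → χ⁺ (p % 24) ≡ true → χ⁺ ((p ^ j) % 24) ≡ true
χ⁺-^ p zero    h = refl
χ⁺-^ p (suc j) h = trans (cong χ⁺ (%-distribˡ-* p (p ^ j) 24)) (χ⁺-* (m%n<n p 24) h (m%n<n (p ^ j) 24) (χ⁺-^ p j h))

-- For `p ≥ 2` and `X ≥ 1` this is the integer part of the logarithm of `X` to base `p`; `p` to this
-- power is at most `X`, as in Chebyshev's estimates.
powers≤ : ℕ → ℕ → ℕ
powers≤ X p = ∑ X (λ j → [ p ^ j ≤? X ])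

^powers≤ : ∀ {X p} → 1 ≤ X → 1 ≤ p → p ^ powers≤ X p ≤ X
^powers≤ {X} {p} 1≤X 1≤p = go X
  where
  ∑≤ : ∀ n → ∑ n (λ j → [ p ^ j ≤? X ]) ≤ n
  ∑≤ zero    = z≤n
  ∑≤ (suc n) = ≤-trans (+-mono-≤ (∑≤ n) ([]≤1 (p ^ suc n ≤? X))) (≤-reflexive (+-comm n 1))
  go : ∀ n → p ^ ∑ n (λ j → [ p ^ j ≤? X ]) ≤ X
  go zero    = 1≤X
  go (suc n) with p ^ suc n ≤? X
  ... | yes le = ≤-trans (^-monoʳ-≤ p ⦃ >-nonZero 1≤p ⦄ (≤-trans (+-monoˡ-≤ 1 (∑≤ n)) (≤-reflexive (+-comm n 1)))) le
  ... | no _   = ≤-trans (≤-reflexive (cong (p ^_) (+-identityʳ (∑ n (λ j → [ p ^ j ≤? X ]))))) (go n)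

two-weights : ∀ {r} → r < 24 → (w⁺ r ≡ 0 ⊎ ¬ 2 ∣ r × w⁻ r ≡ 0) × (w⁻ r ≡ 0 ⊎ 2 ∣ r × w⁺ r ≡ 0)
two-weights = from-yes (allUpTo? (λ r → ((w⁺ r ≟ 0) ⊎-dec (¬? (2 ∣? r) ×-dec (w⁻ r ≟ 0))) ×-dec ((w⁻ r ≟ 0) ⊎-dec ((2 ∣? r) ×-dec (w⁺ r ≟ 0)))) 24)

∤⇒ν≡0 : ∀ {p} m → Prime p → 1 ≤ m → ¬ p ∣ m → ν p m ≡ 0
∤⇒ν≡0 {p} m pr 1≤m p∤m = trans (ν≡∑ m m pr 1≤m ≤-refl)
  (trans (∑-cong m λ { (suc j) _ _ → []-false (p ^ suc j ∣? m) (λ h → p∤m (∣-trans (m∣m*n (p ^ j)) h)) }) (∑-zero m))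

∣⇒1≤ν : ∀ {p} m → Prime p → 1 ≤ m → p ∣ m → 1 ≤ ν p m
∣⇒1≤ν {p} (suc m) pr 1≤m p∣m = subst (1 ≤_) (sym (ν≡∑ (suc m) (suc m) pr 1≤m ≤-refl)) (subst (1 ≤_) (sym (∑-split 1 m _))
  (≤-trans (≤-reflexive (sym ([]-true (p ^ 1 ∣? suc m) (subst (_∣ suc m) (sym (*-identityʳ p)) p∣m)))) (m≤m+n _ _)))

-- All of w⁻ sits on even numbers and all of w⁺ on odd ones: the prime 2 yields the gain 2 ^ ∑ h⁻.
ν₂-weights : ∀ m → 1 ≤ m → h⁻ m + ν 2 m * h⁺ m ≤ ν 2 m * h⁻ m
ν₂-weights m 1≤m = go (two-weights (m%n<n (m * 1) 24))
  where
  lift : ¬ 2 ∣ (m * 1) % 24 → ¬ 2 ∣ m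
  lift ¬2 2∣m = ¬2 (%-presˡ-∣ (∣m⇒∣m*n 1 2∣m) (divides 12 refl))
  go : (h⁺ m ≡ 0 ⊎ ¬ 2 ∣ (m * 1) % 24 × h⁻ m ≡ 0) × (h⁻ m ≡ 0 ⊎ 2 ∣ (m * 1) % 24 × h⁺ m ≡ 0) → h⁻ m + ν 2 m * h⁺ m ≤ ν 2 m * h⁻ m
  go (inj₂ (¬2 , e⁻) , _) rewrite e⁻ | ∤⇒ν≡0 m prime[2] 1≤m (lift ¬2) = z≤n
  go (inj₁ e⁺ , inj₁ e⁻) rewrite e⁺ | e⁻ = ≤-refl
  go (inj₁ e⁺ , inj₂ (2∣ , _)) rewrite e⁺ | *-zeroʳ (ν 2 m) | +-identityʳ (h⁻ m) =
    ≤-trans (≤-reflexive (sym (*-identityˡ (h⁻ m)))) (*-monoˡ-≤ (h⁻ m) (∣⇒1≤ν m prime[2] 1≤m (subst (2 ∣_) (*-identityʳ m) (∣%24⇒∣ (m * 1) (divides 12 refl) 2∣))))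

excess : ℕ → ℕ → ℕ
excess X p = [ exceptional? p ] * (powers≤ X p * 5)

excess-≥ : ∀ X p → Prime p → p ≢ 2 → powers≤ X p * (if χ⁺ (p % 24) then 0 else 5) ≤ excess X p
excess-≥ X p pr p≢2 = go (χ⁺ (p % 24)) refl
  where
  go : ∀ b → χ⁺ (p % 24) ≡ b → powers≤ X p * (if b then 0 else 5) ≤ excess X p
  go true  _  = ≤-trans (≤-reflexive (*-zeroʳ (powers≤ X p))) z≤n
  go false eq = ≤-reflexive (sym (trans (cong (_* (powers≤ X p * 5)) ([]-true (exceptional? p) (pr , p≢2 , eq))) (*-identityˡ _)))

-- By Legendre's formula the exponents split over the powers `p ^ j`, and `∑-W` applies to each with
-- `d = p ^ j`. A split prime has split powers and no excess; powers beyond `X` give empty sums.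
exponents-odd : ∀ X p → Prime p → p ≢ 2 → ∑ X (λ m → ν p m * h⁺ m) ≤ ∑ X (λ m → ν p m * h⁻ m) + excess X p
exponents-odd X p pr p≢2 = begin
  ∑ X (λ m → ν p m * h⁺ m)          ≡⟨ ∑-ν X h⁺ pr ⟩
  ∑ X (λ j → S h⁺ j)                ≤⟨ ∑-mono X (λ j _ _ → perPower j) ⟩
  ∑ X (λ j → S h⁻ j + [ p ^ j ≤? X ] * E)  ≡⟨ ∑-+ X (S h⁻) _ ⟩
  ∑ X (S h⁻) + ∑ X (λ j → [ p ^ j ≤? X ] * E)  ≡⟨ cong₂ _+_ (sym (∑-ν X h⁻ pr)) (∑-*ʳ X E _) ⟩
  ∑ X (λ m → ν p m * h⁻ m) + powers≤ X p * E   ≤⟨ +-monoʳ-≤ (∑ X (λ m → ν p m * h⁻ m)) (excess-≥ X p pr p≢2) ⟩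
  ∑ X (λ m → ν p m * h⁻ m) + excess X p      ∎
  where
  open ≤-Reasoning
  instance
    nz : NonZero p
    nz = prime⇒nonZero pr
  E = if χ⁺ (p % 24) then 0 else 5
  S : (ℕ → ℕ) → ℕ → ℕ
  S h j = ∑ ((X / p ^ j) {{m^n≢0 p j}}) (λ k → h (k * p ^ j))
  -- Even powers of an inert prime fall into a split class and have no excess at all; they are
  -- charged like the odd powers.
  E-^ : ∀ j → (if χ⁺ ((p ^ j) % 24) then 0 else 5) ≤ E
  E-^ j with χ⁺ (p % 24) in eq
  ... | true rewrite χ⁺-^ p j eq = z≤n
  ... | false with χ⁺ ((p ^ j) % 24)
  ... | true  = z≤n
  ... | false = ≤-refl
  perPower : ∀ j → S h⁺ j ≤ S h⁻ j + [ p ^ j ≤? X ] * E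
  perPower j with p ^ j ≤? X
  ... | yes _ = begin
    S h⁺ j                     ≡⟨ ∑-cong y (λ k _ _ → h≡W w⁺ (p ^ j) k) ⟩
    ∑ y (W w⁺ (p ^ j))         ≤⟨ ∑-W (p ^ j) y ⟩
    ∑ y (W w⁻ (p ^ j)) + _     ≤⟨ +-monoʳ-≤ (∑ y (W w⁻ (p ^ j))) (E-^ j) ⟩
    ∑ y (W w⁻ (p ^ j)) + E     ≡⟨ cong₂ _+_ (∑-cong y (λ k _ _ → sym (h≡W w⁻ (p ^ j) k))) (sym (*-identityˡ E)) ⟩
    S h⁻ j + 1 * E             ∎
    where y = (X / p ^ j) {{m^n≢0 p j}}
  ... | no ≰ = ≤-trans (≤-reflexive (cong (λ y → ∑ y (λ k → h⁺ (k * p ^ j))) (m<n⇒m/n≡0 {{m^n≢0 p j}} (≰⇒> ≰)))) z≤n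

exponents : ∀ X p → [ p ≟ 2 ] * ∑ X h⁻ + ∑ X (λ m → ν p m * h⁺ m) ≤ ∑ X (λ m → ν p m * h⁻ m) + excess X p
exponents X p = go (prime? p) (p ≟ 2)
  where
  go : Dec (Prime p) → Dec (p ≡ 2) → [ p ≟ 2 ] * ∑ X h⁻ + ∑ X (λ m → ν p m * h⁺ m) ≤ ∑ X (λ m → ν p m * h⁻ m) + excess X p
  go _        (yes refl) = ≤-trans (≤-reflexive (trans (cong (_+ ∑ X (λ m → ν 2 m * h⁺ m)) (*-identityˡ (∑ X h⁻))) (sym (∑-+ X h⁻ _))))
                             (≤-trans (∑-mono X λ m 1≤m _ → ν₂-weights m 1≤m) (m≤m+n _ _))
  go (yes pr) (no p≢2)   = ≤-trans (≤-reflexive (cong (λ z → z * ∑ X h⁻ + ∑ X (λ m → ν p m * h⁺ m)) ([]-false (p ≟ 2) p≢2))) (exponents-odd X p pr p≢2)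
  go (no ¬pr) (no p≢2)   = ≤-trans (≤-reflexive (cong₂ _+_ (cong (_* ∑ X h⁻) ([]-false (p ≟ 2) p≢2))
                             (trans (∑-cong X λ m _ _ → cong (_* h⁺ m) (ν-notPrime m ¬pr)) (∑-zero X)))) z≤n

inertCount : ℕ → ℕ
inertCount X = ∑ X (λ p → [ inert? p ])

-- Each exceptional prime costs at most `X ^ 5`, whatever its size, since its powers up to `X`
-- amount to a factor of at most `X`. So only the number of these primes matters; the extra 1 is for
-- the prime 3.
∏-excess : ∀ X → 3 ≤ X → ∏ X (λ p → p ^ excess X p) ≤ X ^ (5 * (inertCount X + 1))
∏-excess X 3≤X = begin
  ∏ X (λ p → p ^ excess X p)                          ≤⟨ ∏-mono X (λ p 1≤p _ → pointwise p 1≤p) ⟩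
  ∏ X (λ p → (X ^ 5) ^ ([ inert? p ] + [ p ≟ 3 ]))    ≡⟨ ^-∑ (X ^ 5) X _ ⟩
  (X ^ 5) ^ ∑ X (λ p → [ inert? p ] + [ p ≟ 3 ])      ≡⟨ cong ((X ^ 5) ^_) (trans (∑-+ X _ _) (cong (inertCount X +_) (∑-point X 3 (s≤s z≤n) 3≤X))) ⟩
  (X ^ 5) ^ (inertCount X + 1)                        ≡⟨ ^-*-assoc X 5 (inertCount X + 1) ⟩
  X ^ (5 * (inertCount X + 1))                        ∎
  where
  open ≤-Reasoning
  1≤X : 1 ≤ X
  1≤X = ≤-trans (s≤s z≤n) 3≤X
  1≤X⁵ : 1 ≤ X ^ 5
  1≤X⁵ = ≤-trans (≤-reflexive (sym (^-zeroˡ 5))) (^-monoˡ-≤ 5 1≤X)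
  1≤ind : ∀ {p} → Exceptional p → 1 ≤ [ inert? p ] + [ p ≟ 3 ]
  1≤ind {p} ex with exceptional⇒ ex
  ... | inj₁ p≡3 = ≤-trans (≤-reflexive (sym ([]-true (p ≟ 3) p≡3))) (m≤n+m _ _)
  ... | inj₂ i   = ≤-trans (≤-reflexive (sym ([]-true (inert? p) i))) (m≤m+n _ _)
  pointwise : ∀ p → 1 ≤ p → p ^ excess X p ≤ (X ^ 5) ^ ([ inert? p ] + [ p ≟ 3 ])
  pointwise p 1≤p with exceptional? p
  ... | no _   = ≤-trans (≤-reflexive (sym (^-zeroˡ ([ inert? p ] + [ p ≟ 3 ])))) (^-monoˡ-≤ ([ inert? p ] + [ p ≟ 3 ]) 1≤X⁵)
  ... | yes ex = begin
    p ^ (1 * (powers≤ X p * 5))   ≡⟨ cong (p ^_) (*-identityˡ (powers≤ X p * 5)) ⟩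
    p ^ (powers≤ X p * 5)         ≡⟨ sym (^-*-assoc p (powers≤ X p) 5) ⟩
    (p ^ powers≤ X p) ^ 5         ≤⟨ ^-monoˡ-≤ 5 (^powers≤ 1≤X 1≤p) ⟩
    X ^ 5                         ≡⟨ sym (*-identityʳ (X ^ 5)) ⟩
    (X ^ 5) ^ 1                   ≤⟨ ^-monoʳ-≤ (X ^ 5) ⦃ >-nonZero 1≤X⁵ ⦄ (1≤ind ex) ⟩
    (X ^ 5) ^ ([ inert? p ] + [ p ≟ 3 ]) ∎

-- Both products are factored over the primes. The gain `2 ^ (K * 12)` is carried as an extra
-- exponent of the prime 2, so that the comparison can be made prime by prime before `Π⁻` is
-- cancelled.
inertCount-lower : ∀ K → 1 ≤ K → 2 ^ (K * 12) ≤ (K * 24) ^ (5 * (inertCount (K * 24) + 1))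
inertCount-lower K 1≤K = ≤-trans (*-cancelʳ-≤ _ _ Π⁻ ⦃ >-nonZero 1≤Π⁻ ⦄ (begin
  2 ^ (K * 12) * Π⁻                               ≤⟨ *-monoʳ-≤ (2 ^ (K * 12)) (∏h⁻≤∏h⁺ K) ⟩
  2 ^ (K * 12) * Π⁺                               ≡⟨ cong₂ _*_ 2^≡ (∏-factorisation X h⁺) ⟩
  ∏ X (λ p → p ^ ([ p ≟ 2 ] * ∑ X h⁻)) * ∏ X (λ p → p ^ ∑ X (λ m → ν p m * h⁺ m)) ≡⟨ sym (∏-* X _ _) ⟩
  ∏ X (λ p → p ^ ([ p ≟ 2 ] * ∑ X h⁻) * p ^ ∑ X (λ m → ν p m * h⁺ m))             ≤⟨ ∏-mono X (λ p 1≤p _ → pointwise p 1≤p) ⟩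
  ∏ X (λ p → p ^ ∑ X (λ m → ν p m * h⁻ m) * p ^ excess X p)                       ≡⟨ ∏-* X _ _ ⟩
  ∏ X (λ p → p ^ ∑ X (λ m → ν p m * h⁻ m)) * ∏ X (λ p → p ^ excess X p)           ≡⟨ cong (_* ∏ X (λ p → p ^ excess X p)) (sym (∏-factorisation X h⁻)) ⟩
  Π⁻ * ∏ X (λ p → p ^ excess X p)                 ≡⟨ *-comm Π⁻ _ ⟩
  ∏ X (λ p → p ^ excess X p) * Π⁻                 ∎)) (∏-excess X (≤-trans (s≤s (s≤s (s≤s z≤n))) 24≤X))
  where
  open ≤-Reasoning
  X  = K * 24
  Π⁺ = ∏ X (λ m → m ^ h⁺ m)
  Π⁻ = ∏ X (λ m → m ^ h⁻ m)
  24≤X : 24 ≤ X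
  24≤X = *-monoˡ-≤ 24 1≤K
  1≤Π⁻ : 1 ≤ Π⁻
  1≤Π⁻ = ∏≢0 X λ m 1≤m _ → ≤-trans (≤-reflexive (sym (^-zeroˡ (h⁻ m)))) (^-monoˡ-≤ (h⁻ m) 1≤m)
  2^≡ : 2 ^ (K * 12) ≡ ∏ X (λ p → p ^ ([ p ≟ 2 ] * ∑ X h⁻))
  2^≡ = sym (trans (∏-cong X λ p _ _ → sym (^-*-assoc p [ p ≟ 2 ] (∑ X h⁻)))
            (trans (sym (∏-^ X _ (∑ X h⁻)))
                   (cong₂ _^_ (∏-point X 2 (s≤s z≤n) (≤-trans (s≤s (s≤s z≤n)) 24≤X)) (∑-h⁻ K))))
  pointwise : ∀ p → 1 ≤ p → p ^ ([ p ≟ 2 ] * ∑ X h⁻) * p ^ ∑ X (λ m → ν p m * h⁺ m)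
                           ≤ p ^ ∑ X (λ m → ν p m * h⁻ m) * p ^ excess X p
  pointwise p 1≤p = begin
    p ^ ([ p ≟ 2 ] * ∑ X h⁻) * p ^ ∑ X (λ m → ν p m * h⁺ m)  ≡⟨ sym (^-distribˡ-+-* p ([ p ≟ 2 ] * ∑ X h⁻) _) ⟩
    p ^ ([ p ≟ 2 ] * ∑ X h⁻ + ∑ X (λ m → ν p m * h⁺ m))      ≤⟨ ^-monoʳ-≤ p ⦃ >-nonZero 1≤p ⦄ (exponents X p) ⟩
    p ^ (∑ X (λ m → ν p m * h⁻ m) + excess X p)              ≡⟨ ^-distribˡ-+-* p (∑ X (λ m → ν p m * h⁻ m)) (excess X p) ⟩
    p ^ ∑ X (λ m → ν p m * h⁻ m) * p ^ excess X p            ∎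

log₂ : ∀ n → 1 ≤ n → ∃[ k ] (2 ^ k ≤ n × n < 2 ^ suc k)
log₂ (suc zero)    _ = 0 , ≤-refl , ≤-refl
log₂ (suc (suc n)) _ with log₂ (suc n) (s≤s z≤n)
... | k , lo , hi with suc (suc n) <? 2 ^ suc k
... | yes lt = k , m≤n⇒m≤1+n lo , lt
... | no ≮   = suc k , ≮⇒≥ ≮ , ≤-<-trans hi (^-monoʳ-< 2 ≤-refl {suc k} ≤-refl)

-- A Chebyshev upper bound for all primes

C≤2^ : ∀ n k → n C k ≤ 2 ^ n
C≤2^ n       zero    = ≤-trans (≤-reflexive (trans (nCk≡nC[n∸k] {0} {n} z≤n) (nCn≡1 n))) (^-monoʳ-≤ 2 {0} {n} z≤n)
C≤2^ zero    (suc k) = ≤-trans (≤-reflexive (k>n⇒nCk≡0 {0} {suc k} (s≤s z≤n))) z≤n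
C≤2^ (suc n) (suc k) = begin
  suc n C suc k       ≡⟨ sym (nCk+nC[k+1]≡[n+1]C[k+1] n k) ⟩
  n C k + n C suc k   ≤⟨ +-mono-≤ (C≤2^ n k) (C≤2^ n (suc k)) ⟩
  2 ^ n + 2 ^ n       ≡⟨ cong (2 ^ n +_) (sym (+-identityʳ (2 ^ n))) ⟩
  2 ^ suc n           ∎
  where open ≤-Reasoning

prime∣!⇒≤ : ∀ {p} n → Prime p → p ∣ n ! → p ≤ n
prime∣!⇒≤ zero    pr d = ⊥-elim (¬prime[1] (subst Prime (∣1⇒≡1 d) pr))
prime∣!⇒≤ (suc n) pr d with euclidsLemma (suc n) (n !) pr d
... | inj₁ d′ = ∣⇒≤ d′
... | inj₂ d′ = m≤n⇒m≤1+n (prime∣!⇒≤ n pr d′)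

≤⇒∣! : ∀ {p} n → 1 ≤ p → p ≤ n → p ∣ n !
≤⇒∣! zero    1≤p p≤n = ⊥-elim (<⇒≱ 1≤p p≤n)
≤⇒∣! {p} (suc n) 1≤p p≤n with p ≟ suc n
... | yes refl = m∣m*n (n !)
... | no ≢     = ∣n⇒∣m*n (suc n) (≤⇒∣! n 1≤p (s≤s⁻¹ (≤∧≢⇒< p≤n ≢)))

central*!² : ∀ n → ((n + n) C n) * (n ! * (n + n ∸ n) !) ≡ (n + n) !
central*!² n = trans (cong (_* (n ! * (n + n ∸ n) !)) (nCk≡n!/k![n-k]! (m≤m+n n n)))
                     (m/n*n≡m ⦃ _ ⦄ (k![n∸k]!∣n! (m≤m+n n n)))

prime∣C : ∀ {p n} → Prime p → n < p → p ≤ n + n → p ∣ (n + n) C n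
prime∣C {p} {n} pr n<p p≤2n with euclidsLemma _ (n ! * (n + n ∸ n) !) pr (subst (p ∣_) (sym (central*!² n)) (≤⇒∣! (n + n) (1≤prime pr) p≤2n))
... | inj₁ d = d
... | inj₂ d with euclidsLemma (n !) ((n + n ∸ n) !) pr d
... | inj₁ d′ = ⊥-elim (<⇒≱ n<p (prime∣!⇒≤ n pr d′))
... | inj₂ d′ = ⊥-elim (<⇒≱ n<p (prime∣!⇒≤ n pr (subst (λ z → p ∣ z !) (m+n∸n≡m n n) d′)))

primePart : ℕ → ℕ
primePart p = if does (prime? p) then p else 1

1≤primePart : ∀ p → 1 ≤ p → 1 ≤ primePart p
1≤primePart p 1≤p with does (prime? p)
... | true  = 1≤p
... | false = ≤-refl

-- The prime added last differs from all earlier ones, hence does not divide their product and has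
-- to divide the cofactor.
∏-primes∣ : ∀ n m c → (∀ p → n < p → p ≤ n + m → Prime p → p ∣ c) → ∏ m (λ k → primePart (n + k)) ∣ c
∏-primes∣ n zero    c h = 1∣ c
∏-primes∣ n (suc m) c h with prime? (n + suc m) | ∏-primes∣ n m c (λ p a b → h p a (≤-trans b (+-monoʳ-≤ n (n≤1+n m))))
... | no _   | d = subst (_∣ c) (sym (*-identityʳ _)) d
... | yes pr | d with d
... | divides q refl = subst (Π * p ∣_) (*-comm Π q) (*-monoʳ-∣ Π p∣q)
  where
  Π = ∏ m (λ k → primePart (n + k))
  p = n + suc m
  p∤Π : ∀ j → j ≤ m → ¬ p ∣ ∏ j (λ k → primePart (n + k))
  p∤Π zero    _ d = ¬prime[1] (subst Prime (∣1⇒≡1 d) pr)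
  p∤Π (suc j) j<m d with euclidsLemma (∏ j _) (primePart (n + suc j)) pr d
  ... | inj₁ d′ = p∤Π j (≤-trans (n≤1+n j) j<m) d′
  ... | inj₂ d′ with prime? (n + suc j)
  ... | yes pr′ = <⇒≢ (+-monoʳ-< n (s≤s j<m)) (sym (prime∣prime⇒≡ pr pr′ d′))
  ... | no _    = ¬prime[1] (subst Prime (∣1⇒≡1 d′) pr)
  p∣q : p ∣ q
  p∣q with euclidsLemma q Π pr (h p (≤-trans (≤-reflexive (+-comm 1 n)) (+-monoʳ-≤ n (s≤s z≤n))) ≤-refl pr)
  ... | inj₁ d = d
  ... | inj₂ d = ⊥-elim (p∤Π m ≤-refl d)

∏-split : ∀ m n f → ∏ (m + n) f ≡ ∏ m f * ∏ n (λ k → f (m + k))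
∏-split m zero    f rewrite +-identityʳ m | *-identityʳ (∏ m f) = refl
∏-split m (suc n) f rewrite +-suc m n | ∏-split m n f = *-assoc (∏ m f) _ _

-- Passing from `n` to `2 n` brings in the primes between them. Their product divides the central
-- binomial coefficient, which is at most `2 ^ (n + n)`.
primorial-2^ : ∀ k → ∏ (2 ^ k) primePart ≤ 2 ^ (2 ^ suc k)
primorial-2^ zero    = s≤s z≤n
primorial-2^ (suc k) = begin
  ∏ (n + (n + 0)) primePart                          ≡⟨ cong (λ z → ∏ z primePart) (cong (n +_) (+-identityʳ n)) ⟩
  ∏ (n + n) primePart                                ≡⟨ ∏-split n n primePart ⟩
  ∏ n primePart * ∏ n (λ i → primePart (n + i))      ≤⟨ *-mono-≤ (primorial-2^ k) (≤-trans (∣⇒≤ ⦃ C≢0 ⦄ (∏-primes∣ n n _ λ p a b pr → prime∣C pr a b)) (C≤2^ (n + n) n)) ⟩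
  2 ^ (2 ^ suc k) * 2 ^ (n + n)                      ≡⟨ sym (^-distribˡ-+-* 2 (2 ^ suc k) (n + n)) ⟩
  2 ^ (2 ^ suc k + (n + n))                          ≡⟨ cong (λ z → 2 ^ (2 ^ suc k + z)) (doubling n) ⟩
  2 ^ (2 ^ suc (suc k))                              ∎
  where
  open ≤-Reasoning
  n = 2 ^ k
  doubling : ∀ n → n + n ≡ n + (n + 0) + 0
  doubling = solve-∀
  C≢0 : NonZero ((n + n) C n)
  C≢0 = ≢-nonZero λ e → ≢-nonZero⁻¹ ((n + n) !) ⦃ (n + n) !≢0 ⦄
          (trans (sym (central*!² n)) (cong (_* (n ! * (n + n ∸ n) !)) e))

2^-cancel-≤ : ∀ a b → 2 ^ a ≤ 2 ^ b → a ≤ b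
2^-cancel-≤ a b le with a ≤? b
... | yes a≤b = a≤b
... | no a≰b  = ⊥-elim (<⇒≱ (^-monoʳ-< 2 ≤-refl (≰⇒> a≰b)) le)

length-filter-upTo : ∀ {P : ℕ → Set} (P? : ∀ n → Dec (P n)) → ¬ P 0 → ∀ n →
                     length (filter P? (upTo (suc n))) ≡ ∑ n (λ k → [ P? k ])
length-filter-upTo P? ¬P0 zero with P? 0
... | yes p = ⊥-elim (¬P0 p)
... | no _  = refl
length-filter-upTo P? ¬P0 (suc n) = begin
  length (filter P? (upTo (suc (suc n))))                  ≡⟨ cong (length ∘ filter P?) (sym (upTo-∷ʳ (suc n))) ⟩
  length (filter P? (upTo (suc n) ++ suc n ∷ []))          ≡⟨ cong length (filter-++ P? (upTo (suc n)) (suc n ∷ [])) ⟩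
  length (filter P? (upTo (suc n)) ++ filter P? (suc n ∷ [])) ≡⟨ length-++ (filter P? (upTo (suc n))) ⟩
  length (filter P? (upTo (suc n))) + length (filter P? (suc n ∷ [])) ≡⟨ cong₂ _+_ (length-filter-upTo P? ¬P0 n) single ⟩
  ∑ n (λ k → [ P? k ]) + [ P? (suc n) ]                    ∎
  where
  open ≡-Reasoning
  single : length (filter P? (suc n ∷ [])) ≡ [ P? (suc n) ]
  single with P? (suc n)
  ... | yes _ = refl
  ... | no _  = refl

∑-prefix-≤ : ∀ {m n} (f : ℕ → ℕ) → m ≤ n → ∑ m f ≤ ∑ n f
∑-prefix-≤ {m} {n} f m≤n = subst (λ z → ∑ m f ≤ ∑ z f) (m+[n∸m]≡n m≤n)
  (≤-trans (m≤m+n _ _) (≤-reflexive (sym (∑-split m (n ∸ m) f))))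

-- With `L = 2 ^ l`, every prime above `L` contributes a factor of at least `L` to the primorial,
-- which is at most `2 ^ (4 * x)`. The primes up to `L` are paid for by `L ^ L = 2 ^ (l * L)`, and
-- `l * L ≤ L * L ≤ x` as `L` is at most the square root of `x`.
primeCount-upper : ∀ {x k} l → 2 ^ k ≤ x → x < 2 ^ suc k → l + l ≤ k → l * primeCount x ≤ 5 * x
primeCount-upper {x} {k} l lo hi 2l≤k = ≤-trans (2^-cancel-≤ (l * π) (4 * x + l * L) (begin
  2 ^ (l * π)                                          ≡⟨ sym (^-*-assoc 2 l π) ⟩
  L ^ π                                                ≡⟨ cong (L ^_) (length-filter-upTo prime? ¬prime[0] x) ⟩
  L ^ ∑ x (λ p → [ prime? p ])                         ≡⟨ sym (^-∑ L x _) ⟩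
  ∏ x (λ p → L ^ [ prime? p ])                         ≤⟨ ∏-mono x (λ p 1≤p _ → pointwise p 1≤p) ⟩
  ∏ x (λ p → primePart p * L ^ [ p ≤? L ])             ≡⟨ ∏-* x primePart _ ⟩
  ∏ x primePart * ∏ x (λ p → L ^ [ p ≤? L ])           ≡⟨ cong (∏ x primePart *_) (trans (^-∑ L x _) (cong (L ^_) (∑-[≤] x L L≤x))) ⟩
  ∏ x primePart * L ^ L                                ≤⟨ *-mono-≤ primorial (≤-reflexive (^-*-assoc 2 l L)) ⟩
  2 ^ (4 * x) * 2 ^ (l * L)                            ≡⟨ sym (^-distribˡ-+-* 2 (4 * x) (l * L)) ⟩
  2 ^ (4 * x + l * L)                                  ∎))
  (≤-trans (+-monoʳ-≤ (4 * x) (≤-trans (*-monoˡ-≤ L (<⇒≤ (n<2^n l))) L²≤x)) (≤-reflexive (+-comm (4 * x) x)))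
  where
  open ≤-Reasoning
  π = primeCount x
  L = 2 ^ l
  L²≤x : L * L ≤ x
  L²≤x = ≤-trans (≤-trans (≤-reflexive (sym (^-distribˡ-+-* 2 l l))) (^-monoʳ-≤ 2 2l≤k)) lo
  L≤x : L ≤ x
  L≤x = ≤-trans (m≤m*n L L ⦃ m^n≢0 2 l ⦄) L²≤x
  1≤∏ : ∀ n m → 1 ≤ ∏ m (λ i → primePart (n + i))
  1≤∏ n m = ∏≢0 m λ i 1≤i _ → 1≤primePart (n + i) (≤-trans 1≤i (m≤n+m i n))
  primorial : ∏ x primePart ≤ 2 ^ (4 * x)
  primorial = begin
    ∏ x primePart                                                     ≤⟨ m≤m*n _ _ ⦃ >-nonZero (1≤∏ x (2 ^ suc k ∸ x)) ⦄ ⟩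
    ∏ x primePart * ∏ (2 ^ suc k ∸ x) (λ i → primePart (x + i))       ≡⟨ sym (∏-split x (2 ^ suc k ∸ x) primePart) ⟩
    ∏ (x + (2 ^ suc k ∸ x)) primePart                                 ≡⟨ cong (λ z → ∏ z primePart) (m+[n∸m]≡n (<⇒≤ hi)) ⟩
    ∏ (2 ^ suc k) primePart                                           ≤⟨ primorial-2^ (suc k) ⟩
    2 ^ (2 ^ suc (suc k))                                             ≤⟨ ^-monoʳ-≤ 2 (≤-trans (≤-reflexive (sym (*-assoc 2 2 (2 ^ k)))) (*-monoʳ-≤ 4 lo)) ⟩
    2 ^ (4 * x)                                                       ∎
  pointwise : ∀ p → 1 ≤ p → L ^ [ prime? p ] ≤ primePart p * L ^ [ p ≤? L ]
  pointwise p 1≤p with prime? p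
  ... | no _ = ≤-trans (m^n>0 L ⦃ m^n≢0 2 l ⦄ [ p ≤? L ]) (≤-reflexive (sym (*-identityˡ _)))
  ... | yes _ with p ≤? L
  ... | yes _ = m≤n*m (L * 1) p ⦃ >-nonZero 1≤p ⦄
  ... | no ≰  = *-monoˡ-≤ 1 (<⇒≤ (≰⇒> ≰))

-- The inert primes have positive proportion

halve : ∀ k → ∃[ l ] (l + l ≤ k × suc k ≤ suc l + suc l)
halve zero          = 0 , z≤n , s≤s z≤n
halve (suc zero)    = 0 , z≤n , ≤-refl
halve (suc (suc k)) with halve k
... | l , lo , hi = suc l , ≤-trans (≤-reflexive (cong suc (+-suc l l))) (s≤s (s≤s lo))
                          , ≤-trans (s≤s (s≤s hi)) (≤-reflexive (cong suc (cong suc (sym (+-suc l (suc l))))))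

inertCount-mono : ∀ {m n} → m ≤ n → inertCount m ≤ inertCount n
inertCount-mono = ∑-prefix-≤ _

1≤inertCount : ∀ {x} → 24 ≤ x → 1 ≤ inertCount x
1≤inertCount {x} 24≤x = ≤-trans (≤-trans (≤-reflexive (sym ([]-true (inert? 13) (from-yes (prime? 13) , refl)))) (m≤n+m [ inert? 13 ] (inertCount 12)))
  (inertCount-mono {13} (≤-trans (from-yes (13 ≤? 24)) 24≤x))

-- Here `l` is half of the binary logarithm `k` of `x`, rounded down. The upper bound is
-- `l * primeCount x ≤ 5 * x` and the lower bound is `x ≤ 160 * (l * inertCount x)`, so `l` cancels
-- and 5 * 160 = 800 remains.
inertCount-density : ∀ x → 24 ≤ x → primeCount x ≤ 800 * inertCount x
inertCount-density x 24≤x with log₂ x (≤-trans (s≤s z≤n) 24≤x)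
... | k , lo , hi with halve k
... | zero , _ , 1+k≤2 = ⊥-elim (<⇒≱ hi (≤-trans (^-monoʳ-≤ 2 1+k≤2) (≤-trans (from-yes (4 ≤? 24)) 24≤x)))
... | l@(suc l′) , 2l≤k , 1+k≤2+2l = *-cancelˡ-≤ l (begin
  l * primeCount x           ≤⟨ primeCount-upper l lo hi 2l≤k ⟩
  5 * x                      ≤⟨ *-monoʳ-≤ 5 x≤ ⟩
  5 * (160 * (l * I))        ≡⟨ rearrange l I ⟩
  l * (800 * I)              ∎)
  where
  open ≤-Reasoning
  I = inertCount x
  K = x / 24
  1≤K : 1 ≤ K
  1≤K = m≥n⇒m/n>0 24≤x
  X≤x : K * 24 ≤ x
  X≤x = m/n*n≤m x 24
  rearrange : ∀ l I → 5 * (160 * (l * I)) ≡ l * (800 * I)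
  rearrange = solve-∀
  rearrange₂ : ∀ l I → 4 * ((4 * l) * (5 * (I + I))) ≡ 160 * (l * I)
  rearrange₂ = solve-∀
  fourfold : ∀ l′ → suc (suc l′) + suc (suc l′) + (2 * l′) ≡ 4 * suc l′
  fourfold = solve-∀
  12K≤ : K * 12 ≤ suc k * (5 * (inertCount (K * 24) + 1))
  12K≤ = 2^-cancel-≤ _ _ (≤-trans (inertCount-lower K 1≤K)
    (≤-trans (^-monoˡ-≤ (5 * (inertCount (K * 24) + 1)) (≤-trans X≤x (<⇒≤ hi)))
             (≤-reflexive (^-*-assoc 2 (suc k) (5 * (inertCount (K * 24) + 1))))))
  -- 160 = 4 * 4 * 5 * 2, from `x ≤ 4 * (K * 12)`, from `suc k ≤ 4 * l`, from the 5 in the exponent,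
  -- and from `I + 1 ≤ I + I`, which holds as 13 is inert.
  x≤ : x ≤ 160 * (l * I)
  x≤ = begin
    x                              ≡⟨ m≡m%n+[m/n]*n x 24 ⟩
    x % 24 + K * 24                ≤⟨ +-monoˡ-≤ (K * 24) (<⇒≤ (m%n<n x 24)) ⟩
    24 + K * 24                    ≤⟨ +-monoˡ-≤ (K * 24) (*-monoˡ-≤ 24 1≤K) ⟩
    K * 24 + K * 24                ≡⟨ double K ⟩
    4 * (K * 12)                   ≤⟨ *-monoʳ-≤ 4 12K≤ ⟩
    4 * (suc k * (5 * (inertCount (K * 24) + 1))) ≤⟨ *-monoʳ-≤ 4 (*-mono-≤
        (≤-trans 1+k≤2+2l (≤-trans (m≤m+n _ (2 * l′)) (≤-reflexive (fourfold l′))))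
        (*-monoʳ-≤ 5 (+-mono-≤ (inertCount-mono X≤x) (1≤inertCount 24≤x)))) ⟩
    4 * ((4 * l) * (5 * (I + I)))  ≡⟨ rearrange₂ l I ⟩
    160 * (l * I)                  ∎
    where
    double : ∀ K → K * 24 + K * 24 ≡ 4 * (K * 12)
    double = solve-∀

inert⇒3< : ∀ {p} → Inert p → 3 < p
inert⇒3< {0} (_ , ())
inert⇒3< {1} (_ , ())
inert⇒3< {2} (_ , ())
inert⇒3< {3} (_ , ())
inert⇒3< {suc (suc (suc (suc _)))} _ = s≤s (s≤s (s≤s (s≤s z≤n)))

positiveProportion : (∀ p → Inert p → GoodPrime p) →
  ∃[ c ] ∃[ N ] ((x : ℕ) → N ≤ x → ∃[ ps ] (Unique ps × All (λ p → p ≤ x × GoodPrime p) ps × primeCount x ≤ suc c * length ps))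
positiveProportion good = 799 , 24 , λ x 24≤x →
  filter inert? (upTo (suc x)) ,
  Unique.filter⁺ inert? (Unique.upTo⁺ (suc x)) ,
  All.tabulate (λ {p} p∈ → let p∈upTo , inert = ∈-filter⁻ inert? p∈ in s≤s⁻¹ (∈-upTo⁻ p∈upTo) , good p inert) ,
  subst (λ z → primeCount x ≤ 800 * z) (sym (length-filter-upTo inert? (λ { (pr , _) → ¬prime[0] pr }) x)) (inertCount-density x 24≤x)

-- Shanks's finite form of the pentagonal number theorem

tri : ℕ → ℕ
tri zero    = 0
tri (suc n) = tri n + suc n

-- i (3 i + 1) / 2
pent : ℤ → ℕ
pent (⁺ n)      = n * n + tri n
pent (-[1+ n ]) = suc n * suc n + tri n

ints : ℕ → List ℤ
ints zero    = ⁺ 0 ∷ []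
ints (suc n) = ⁺ suc n ∷ -[1+ n ] ∷ ints n

-- With signs, the identity says that the sum of (-1)^s (P n / P s) x^(s n + tri s) over s ≤ n
-- equals the sum of (-1)^i x^(pent i) over integers i with |i| ≤ n, where P n is the product of 1 -
-- x^j. Characteristic 2 removes the signs. Keeping `x` arbitrary serves both q and q³.
module Shanks {c ℓ} (R : CommutativeRing c ℓ)
  (char2 : ∀ u → CommutativeRing._≈_ R (CommutativeRing._+_ R u u) (CommutativeRing.0# R))
  (x : CommutativeRing.Carrier R) where

  open CommutativeRing R using (Carrier; _≈_) renaming (_+_ to _⊞_; _*_ to _⊠_; 0# to 𝟘; 1# to 𝟙)
  private module R = CommutativeRing R
  open import Relation.Binary.Reasoning.Setoid R.setoid

  private
    module + = CommutativeSemigroupProperties (CommutativeRing.+-commutativeMonoid R |> CommutativeMonoid.commutativeSemigroup)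
    module * = CommutativeSemigroupProperties (CommutativeRing.*-commutativeMonoid R |> CommutativeMonoid.commutativeSemigroup)

  pow : ℕ → Carrier
  pow zero    = 𝟙
  pow (suc n) = x ⊠ pow n

  pow-+ : ∀ m n → pow (m + n) ≈ pow m ⊠ pow n
  pow-+ zero    n = R.sym (R.*-identityˡ (pow n))
  pow-+ (suc m) n = R.trans (R.*-congˡ (pow-+ m n)) (R.sym (R.*-assoc x (pow m) (pow n)))

  -- P (s + k) / P s for P n = ∏_{j ≤ n} (1 + x^j)
  prods : ℕ → ℕ → Carrier
  prods s zero    = 𝟙
  prods s (suc k) = prods s k ⊠ (𝟙 ⊞ pow (suc (s + k)))

  prods-front : ∀ s k → prods s (suc k) ≈ (𝟙 ⊞ pow (suc s)) ⊠ prods (suc s) k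
  prods-front s zero rewrite +-identityʳ s = swap (𝟙 ⊞ pow (suc s))
    where
    swap : ∀ u → 𝟙 ⊠ u ≈ u ⊠ 𝟙
    swap u = R.trans (R.*-identityˡ u) (R.sym (R.*-identityʳ u))
  prods-front s (suc k) = begin
    prods s (suc k) ⊠ (𝟙 ⊞ pow (suc (s + suc k)))                             ≈⟨ R.*-congʳ (prods-front s k) ⟩
    (𝟙 ⊞ pow (suc s)) ⊠ prods (suc s) k ⊠ (𝟙 ⊞ pow (suc (s + suc k)))         ≈⟨ R.*-assoc _ _ _ ⟩
    (𝟙 ⊞ pow (suc s)) ⊠ (prods (suc s) k ⊠ (𝟙 ⊞ pow (suc (s + suc k))))       ≈⟨ R.*-congˡ (R.*-congˡ (R.reflexive (cong (λ z → 𝟙 ⊞ pow (suc z)) (+-suc s k)))) ⟩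
    (𝟙 ⊞ pow (suc s)) ⊠ prods (suc s) (suc k)                                 ∎

  -- Carrying `k` = n - s as a second index keeps subtraction out of the quotients `prods s k`.
  antidiagonal : (ℕ → ℕ → Carrier) → ℕ → Carrier
  antidiagonal f zero    = f 0 0
  antidiagonal f (suc n) = f 0 (suc n) ⊞ antidiagonal (λ s → f (suc s)) n

  antidiagonal-cong : ∀ {f g} n → (∀ s k → s + k ≡ n → f s k ≈ g s k) → antidiagonal f n ≈ antidiagonal g n
  antidiagonal-cong zero    h = h 0 0 refl
  antidiagonal-cong (suc n) h = R.+-cong (h 0 (suc n) refl) (antidiagonal-cong n λ s k e → h (suc s) k (cong suc e))

  antidiagonal-⊞ : ∀ f g n → antidiagonal (λ s k → f s k ⊞ g s k) n ≈ antidiagonal f n ⊞ antidiagonal g n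
  antidiagonal-⊞ f g zero    = R.refl
  antidiagonal-⊞ f g (suc n) = R.trans (R.+-congˡ (antidiagonal-⊞ (λ s → f (suc s)) (λ s → g (suc s)) n)) (+.interchange _ _ _ _)

  antidiagonal-last : ∀ f n → antidiagonal f (suc n) ≈ antidiagonal (λ s k → f s (suc k)) n ⊞ f (suc n) 0
  antidiagonal-last f zero    = R.refl
  antidiagonal-last f (suc n) = R.trans (R.+-congˡ (antidiagonal-last (λ s → f (suc s)) n)) (R.sym (R.+-assoc _ _ _))

  term : ℕ → ℕ → ℕ → Carrier
  term n s k = prods s k ⊠ pow (s * n + tri s)

  shanks : ℕ → Carrier
  shanks n = antidiagonal (term n) n

  -- Summed over s + k = n, these two families differ by the single term right n n 0.
  left right : ℕ → ℕ → ℕ → Carrier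
  left  n s k = (𝟙 ⊞ pow s) ⊠ term n s k
  right n s k = prods s k ⊠ pow (suc s * suc n + tri s)

  -- The new factor 1 + x^(n+1) splits the summand in two. The second half is `right`; in the first,
  -- x^s is rewritten as 1 + (1 + x^s), which yields `term n` and `left`.
  term-step : ∀ n s k → s + k ≡ n → term (suc n) s (suc k) ≈ term n s k ⊞ (left n s k ⊞ right n s k)
  term-step n s k refl = begin
    prods s k ⊠ (𝟙 ⊞ pow (suc n)) ⊠ pow (s * suc n + tri s)
      ≈⟨ R.*-congˡ (R.trans (R.reflexive (cong pow (exp₁ s n (tri s)))) (pow-+ s (s * n + tri s))) ⟩
    prods s k ⊠ (𝟙 ⊞ pow (suc n)) ⊠ (pow s ⊠ pow (s * n + tri s))
      ≈⟨ expand (prods s k) (pow (suc n)) (pow s) (pow (s * n + tri s)) ⟩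
    prods s k ⊠ (pow s ⊠ pow (s * n + tri s)) ⊞ prods s k ⊠ (pow (suc n) ⊠ (pow s ⊠ pow (s * n + tri s)))
      ≈⟨ R.+-cong (split (prods s k) (pow s) (pow (s * n + tri s)))
                (R.*-congˡ (R.sym (R.trans (R.reflexive (cong pow (exp₂ s n (tri s)))) (R.trans (pow-+ (suc n) _) (R.*-congˡ (pow-+ s _)))))) ⟩
    (term n s k ⊞ left n s k) ⊞ right n s k
      ≈⟨ R.+-assoc _ _ _ ⟩
    term n s k ⊞ (left n s k ⊞ right n s k) ∎
    where
    exp₁ : ∀ s n t → s * suc n + t ≡ s + (s * n + t)
    exp₁ = solve-∀
    exp₂ : ∀ s n t → suc s * suc n + t ≡ suc n + (s + (s * n + t))
    exp₂ = solve-∀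
    expand : ∀ r y s e → r ⊠ (𝟙 ⊞ y) ⊠ (s ⊠ e) ≈ r ⊠ (s ⊠ e) ⊞ r ⊠ (y ⊠ (s ⊠ e))
    expand r y s e = R.trans (R.trans (R.*-congʳ (R.distribˡ r 𝟙 y)) (R.distribʳ (s ⊠ e) (r ⊠ 𝟙) (r ⊠ y)))
                                (R.+-cong (R.*-congʳ (R.*-identityʳ r)) (R.*-assoc r y (s ⊠ e)))
    split : ∀ r s e → r ⊠ (s ⊠ e) ≈ r ⊠ e ⊞ (𝟙 ⊞ s) ⊠ (r ⊠ e)
    split r s e = R.sym (begin
      r ⊠ e ⊞ (𝟙 ⊞ s) ⊠ (r ⊠ e)               ≈⟨ R.+-congˡ (R.trans (R.distribʳ (r ⊠ e) 𝟙 s) (R.+-cong (R.*-identityˡ _) (*.x∙yz≈y∙xz s r e))) ⟩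
      r ⊠ e ⊞ (r ⊠ e ⊞ r ⊠ (s ⊠ e))           ≈⟨ R.+-assoc _ _ _ ⟨
      (r ⊠ e ⊞ r ⊠ e) ⊞ r ⊠ (s ⊠ e)           ≈⟨ R.+-congʳ (char2 (r ⊠ e)) ⟩
      𝟘 ⊞ r ⊠ (s ⊠ e)                         ≈⟨ R.+-identityˡ _ ⟩
      r ⊠ (s ⊠ e)                             ∎)

  -- The factor 1 + x^(s+1) is precisely the one by which `prods s (suc k)` exceeds
  -- `prods (suc s) k`.
  left-right : ∀ n s k → left n (suc s) k ≈ right n s (suc k)
  left-right n s k = begin
    (𝟙 ⊞ pow (suc s)) ⊠ (prods (suc s) k ⊠ pow (suc s * n + (tri s + suc s))) ≈⟨ R.sym (R.*-assoc _ _ _) ⟩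
    (𝟙 ⊞ pow (suc s)) ⊠ prods (suc s) k ⊠ pow (suc s * n + (tri s + suc s))   ≈⟨ R.*-cong (R.sym (prods-front s k)) (R.reflexive (cong pow (exps s n (tri s)))) ⟩
    right n s (suc k) ∎
    where
    exps : ∀ s n t → suc s * n + (t + suc s) ≡ suc s * suc n + t
    exps = solve-∀

  telescope : ∀ n → antidiagonal (λ s k → left n s k ⊞ right n s k) n ≈ pow (suc n * suc n + tri n)
  telescope n = R.trans (antidiagonal-⊞ (left n) (right n) n) (lemma n)
    where
    left₀ : ∀ k → left n 0 k ≈ 𝟘
    left₀ k = R.trans (R.*-congʳ (char2 𝟙)) (R.zeroˡ _)
    cancel : ∀ a d → (𝟘 ⊞ a) ⊞ (a ⊞ d) ≈ d
    cancel a d = begin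
      (𝟘 ⊞ a) ⊞ (a ⊞ d)   ≈⟨ R.+-congʳ (R.+-identityˡ a) ⟩
      a ⊞ (a ⊞ d)         ≈⟨ R.sym (R.+-assoc a a d) ⟩
      (a ⊞ a) ⊞ d         ≈⟨ R.+-congʳ (char2 a) ⟩
      𝟘 ⊞ d               ≈⟨ R.+-identityˡ d ⟩
      d                   ∎
    -- The length `m` of the sum is separated from the `n` in the exponents, so that the case
    -- distinction leaves the summands alone. The summand `left n 0` vanishes because of its factor
    -- 1 + 1.
    lemma : ∀ m → antidiagonal (left n) m ⊞ antidiagonal (right n) m ≈ pow (suc m * suc n + tri m)
    lemma zero    = R.trans (R.+-congʳ (left₀ 0)) (R.trans (R.+-identityˡ _) (R.*-identityˡ _))
    lemma (suc m) = begin
      (left n 0 (suc m) ⊞ antidiagonal (λ s → left n (suc s)) m) ⊞ antidiagonal (right n) (suc m)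
        ≈⟨ R.+-cong (R.+-cong (left₀ (suc m)) (antidiagonal-cong m λ s k _ → left-right n s k)) (antidiagonal-last (right n) m) ⟩
      (𝟘 ⊞ antidiagonal (λ s k → right n s (suc k)) m) ⊞ (antidiagonal (λ s k → right n s (suc k)) m ⊞ right n (suc m) 0)
        ≈⟨ cancel _ _ ⟩
      right n (suc m) 0
        ≈⟨ R.*-identityˡ _ ⟩
      pow (suc (suc m) * suc n + tri (suc m)) ∎

  powers : (ℤ → ℕ) → List ℤ → Carrier
  powers e []       = 𝟘
  powers e (i ∷ is) = pow (e i) ⊞ powers e is

  -- The step from `n` to `suc n` adds two powers: the telescoped remainder has exponent
  -- `pent (-[1+ n ])`, and the new summand with `s = suc n` and `k = 0` has exponent
  -- `pent (⁺ suc n)`.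
  shanks≈pentagonal : ∀ n → shanks n ≈ powers pent (ints n)
  shanks≈pentagonal zero    = R.trans (R.*-identityˡ _) (R.sym (R.+-identityʳ _))
  shanks≈pentagonal (suc n) = begin
    antidiagonal (term (suc n)) (suc n)
      ≈⟨ antidiagonal-last (term (suc n)) n ⟩
    antidiagonal (λ s k → term (suc n) s (suc k)) n ⊞ term (suc n) (suc n) 0
      ≈⟨ R.+-cong (R.trans (antidiagonal-cong n (term-step n)) (R.trans (antidiagonal-⊞ (term n) _ n) (R.+-cong (shanks≈pentagonal n) (telescope n)))) (R.*-identityˡ _) ⟩
    (powers pent (ints n) ⊞ pow (pent (-[1+ n ]))) ⊞ pow (pent (⁺ suc n))
      ≈⟨ R.trans (R.+-comm _ _) (R.+-congˡ (R.+-comm _ _)) ⟩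
    pow (pent (⁺ suc n)) ⊞ (pow (pent (-[1+ n ])) ⊞ powers pent (ints n)) ∎

i*i≡+∣i∣² : ∀ i → i ℤ.* i ≡ ⁺ (abs i * abs i)
i*i≡+∣i∣² (⁺ n)      = sym (ℤ.pos-* n n)
i*i≡+∣i∣² (-[1+ n ]) = refl

-- Power series over 𝔽₂

Series : Set
Series = ℕ → Bool

infix  4 _≋_ _≋[_]_
infixl 6 _⊕_
infixl 7 _⊛_

_≋_ : Series → Series → Set
a ≋ a′ = ∀ n → a n ≡ a′ n

_≋[_]_ : Series → ℕ → Series → Set
a ≋[ N ] a′ = ∀ n → n ≤ N → a n ≡ a′ n

tail : Series → Series
tail a n = a (suc n)

𝟎 : Series
𝟎 _ = false

mono : ℕ → Series
mono e n = e ≡ᵇ n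

_⊕_ : Series → Series → Series
(a ⊕ a′) n = a n xor a′ n

-- Read off from the decomposition a = a 0 + q (tail a).
_⊛_ : Series → Series → Series
(a ⊛ a′) zero    = a 0 ∧ a′ 0
(a ⊛ a′) (suc n) = (a 0 ∧ a′ (suc n)) xor (tail a ⊛ a′) n

module 𝔽₂ = CommutativeRing Bool.xor-∧-commutativeRing
module xor = CommutativeSemigroupProperties (𝔽₂.+-commutativeMonoid |> CommutativeMonoid.commutativeSemigroup)

⊛-cong[] : ∀ {a a′ c c′} N → a ≋[ N ] a′ → c ≋[ N ] c′ → a ⊛ c ≋[ N ] a′ ⊛ c′
⊛-cong[] N h k zero    _   = cong₂ _∧_ (h 0 z≤n) (k 0 z≤n)
⊛-cong[] (suc N) h k (suc n) (s≤s n≤N) = cong₂ _xor_ (cong₂ _∧_ (h 0 z≤n) (k (suc n) (s≤s n≤N)))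
  (⊛-cong[] N (λ m m≤N → h (suc m) (s≤s m≤N)) (λ m m≤N → k m (m≤n⇒m≤1+n m≤N)) n n≤N)

⊛-cong : ∀ {a a′ c c′} → a ≋ a′ → c ≋ c′ → a ⊛ c ≋ a′ ⊛ c′
⊛-cong h k n = ⊛-cong[] n (λ m _ → h m) (λ m _ → k m) n ≤-refl

⊛-distribʳ : ∀ c a a′ → (a ⊕ a′) ⊛ c ≋ a ⊛ c ⊕ a′ ⊛ c
⊛-distribʳ c a a′ zero    = 𝔽₂.distribʳ (c 0) (a 0) (a′ 0)
⊛-distribʳ c a a′ (suc n) = trans (cong₂ _xor_ (𝔽₂.distribʳ (c (suc n)) (a 0) (a′ 0)) (⊛-distribʳ c (tail a) (tail a′) n))
  (xor.interchange (a 0 ∧ c (suc n)) (a′ 0 ∧ c (suc n)) ((tail a ⊛ c) n) ((tail a′ ⊛ c) n))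

⊛-scale : ∀ u a c n → ((λ m → u ∧ a m) ⊛ c) n ≡ u ∧ (a ⊛ c) n
⊛-scale u a c zero    = 𝔽₂.*-assoc u (a 0) (c 0)
⊛-scale u a c (suc n) = trans (cong₂ _xor_ (𝔽₂.*-assoc u (a 0) (c (suc n))) (⊛-scale u (tail a) c n))
  (sym (𝔽₂.distribˡ u (a 0 ∧ c (suc n)) ((tail a ⊛ c) n)))

⊛-assoc : ∀ a c d → (a ⊛ c) ⊛ d ≋ a ⊛ (c ⊛ d)
⊛-assoc a c d zero    = 𝔽₂.*-assoc (a 0) (c 0) (d 0)
⊛-assoc a c d (suc n) = begin
  ((a 0 ∧ c 0) ∧ d (suc n)) xor (((λ m → a 0 ∧ tail c m) ⊕ tail a ⊛ c) ⊛ d) n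
    ≡⟨ cong₂ _xor_ (𝔽₂.*-assoc (a 0) (c 0) (d (suc n))) (⊛-distribʳ d (λ m → a 0 ∧ tail c m) (tail a ⊛ c) n) ⟩
  (a 0 ∧ (c 0 ∧ d (suc n))) xor ((((λ m → a 0 ∧ tail c m) ⊛ d) n) xor ((tail a ⊛ c) ⊛ d) n)
    ≡⟨ cong ((a 0 ∧ (c 0 ∧ d (suc n))) xor_) (cong₂ _xor_ (⊛-scale (a 0) (tail c) d n) (⊛-assoc (tail a) c d n)) ⟩
  (a 0 ∧ (c 0 ∧ d (suc n))) xor ((a 0 ∧ (tail c ⊛ d) n) xor (tail a ⊛ (c ⊛ d)) n)
    ≡⟨ sym (𝔽₂.+-assoc (a 0 ∧ (c 0 ∧ d (suc n))) (a 0 ∧ (tail c ⊛ d) n) ((tail a ⊛ (c ⊛ d)) n)) ⟩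
  ((a 0 ∧ (c 0 ∧ d (suc n))) xor (a 0 ∧ (tail c ⊛ d) n)) xor (tail a ⊛ (c ⊛ d)) n
    ≡⟨ cong (_xor (tail a ⊛ (c ⊛ d)) n) (sym (𝔽₂.distribˡ (a 0) (c 0 ∧ d (suc n)) ((tail c ⊛ d) n))) ⟩
  (a ⊛ (c ⊛ d)) (suc n) ∎
  where open ≡-Reasoning

⊛-last : ∀ a c n → (a ⊛ c) (suc n) ≡ (a ⊛ tail c) n xor (a (suc n) ∧ c 0)
⊛-last a c zero    = refl
⊛-last a c (suc n) = trans (cong ((a 0 ∧ c (suc (suc n))) xor_) (⊛-last (tail a) c n))
  (sym (𝔽₂.+-assoc (a 0 ∧ c (suc (suc n))) ((tail a ⊛ tail c) n) (a (suc (suc n)) ∧ c 0)))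

⊛-comm : ∀ a c → a ⊛ c ≋ c ⊛ a
⊛-comm a c zero    = 𝔽₂.*-comm (a 0) (c 0)
⊛-comm a c (suc n) = begin
  (a 0 ∧ c (suc n)) xor (tail a ⊛ c) n   ≡⟨ cong₂ _xor_ (𝔽₂.*-comm (a 0) (c (suc n))) (⊛-comm (tail a) c n) ⟩
  (c (suc n) ∧ a 0) xor (c ⊛ tail a) n   ≡⟨ 𝔽₂.+-comm (c (suc n) ∧ a 0) ((c ⊛ tail a) n) ⟩
  (c ⊛ tail a) n xor (c (suc n) ∧ a 0)   ≡⟨ sym (⊛-last c a n) ⟩
  (c ⊛ a) (suc n)                        ∎
  where open ≡-Reasoning

shift : ℕ → Series → Series
shift zero    a n       = a n
shift (suc e) a zero    = false
shift (suc e) a (suc n) = shift e a n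

𝟎-⊛ : ∀ a → 𝟎 ⊛ a ≋ 𝟎
𝟎-⊛ a zero    = refl
𝟎-⊛ a (suc n) = 𝟎-⊛ a n

mono-⊛ : ∀ e a → mono e ⊛ a ≋ shift e a
mono-⊛ zero    a zero    = refl
mono-⊛ zero    a (suc n) = trans (cong (a (suc n) xor_) (𝟎-⊛ a n)) (𝔽₂.+-identityʳ (a (suc n)))
mono-⊛ (suc e) a zero    = refl
mono-⊛ (suc e) a (suc n) = mono-⊛ e a n

shift-+ : ∀ e a n → shift e a (e + n) ≡ a n
shift-+ zero    a n = refl
shift-+ (suc e) a n = shift-+ e a n

shift-< : ∀ e a {n} → n < e → shift e a n ≡ false
shift-< (suc e) a {zero}  _         = refl
shift-< (suc e) a {suc n} (s≤s n<e) = shift-< e a n<e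

shift-mono : ∀ e e′ → shift e (mono e′) ≋ mono (e + e′)
shift-mono zero    e′ n       = refl
shift-mono (suc e) e′ zero    = refl
shift-mono (suc e) e′ (suc n) = shift-mono e e′ n

mono-⊛-mono : ∀ e e′ → mono e ⊛ mono e′ ≋ mono (e + e′)
mono-⊛-mono e e′ n = trans (mono-⊛ e (mono e′) n) (shift-mono e e′ n)

seriesRing : CommutativeRing 0ℓ 0ℓ
seriesRing = record
  { Carrier = Series ; _≈_ = _≋_ ; _+_ = _⊕_ ; _*_ = _⊛_ ; -_ = λ a → a ; 0# = 𝟎 ; 1# = mono 0
  ; isCommutativeRing = record
    { isRing = record
      { +-isAbelianGroup = record
        { isGroup = record
          { isMonoid = record
            { isSemigroup = record
              { isMagma = record
                { isEquivalence = record { refl = λ _ → refl ; sym = λ h n → sym (h n) ; trans = λ h k n → trans (h n) (k n) }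
                ; ∙-cong = λ h k n → cong₂ _xor_ (h n) (k n) }
              ; assoc = λ a c d n → 𝔽₂.+-assoc (a n) (c n) (d n) }
            ; identity = (λ _ _ → refl) , (λ a n → 𝔽₂.+-identityʳ (a n)) }
          ; inverse = (λ a n → Bool.xor-same (a n)) , (λ a n → Bool.xor-same (a n))
          ; ⁻¹-cong = λ h → h }
        ; comm = λ a c n → 𝔽₂.+-comm (a n) (c n) }
      ; *-cong = ⊛-cong
      ; *-assoc = ⊛-assoc
      ; *-identity = mono-⊛ 0 , (λ a n → trans (⊛-comm a (mono 0) n) (mono-⊛ 0 a n))
      ; distrib = (λ a c d n → trans (⊛-comm a (c ⊕ d) n) (trans (⊛-distribʳ a c d n) (cong₂ _xor_ (⊛-comm c a n) (⊛-comm d a n)))) , ⊛-distribʳ }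
    ; *-comm = ⊛-comm } }

module 𝕊 = CommutativeRing seriesRing

-- As the constant term of `a` is 1, each coefficient of `a ⊛ c` is the same coefficient of `c` plus
-- an expression in the lower ones, on which `c` and `c′` agree by induction.
⊛-cancelˡ : ∀ a {c c′} → a 0 ≡ true → a ⊛ c ≋ a ⊛ c′ → c ≋ c′
⊛-cancelˡ a {c} {c′} a₀ h n = go n n ≤-refl
  where
  last : ∀ c n → (a ⊛ c) (suc n) ≡ c (suc n) xor (tail a ⊛ c) n
  last c n = cong (λ u → (u ∧ c (suc n)) xor (tail a ⊛ c) n) a₀
  cancel : ∀ u v w → u xor w ≡ v xor w → u ≡ v
  cancel true  true  w     _ = refl
  cancel false false w     _ = refl
  cancel true  false true  ()
  cancel true  false false ()
  cancel false true  true  ()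
  cancel false true  false ()
  go : ∀ N → c ≋[ N ] c′
  go zero    zero z≤n = trans (sym (cong (_∧ c 0) a₀)) (trans (h 0) (cong (_∧ c′ 0) a₀))
  go (suc N) n n≤ with n ≟ suc N
  ... | no n≢ = go N n (s≤s⁻¹ (≤∧≢⇒< n≤ n≢))
  ... | yes refl = cancel (c (suc N)) (c′ (suc N)) ((tail a ⊛ c) N) (trans (sym (last c N)) (trans (h (suc N)) (trans (last c′ N)
      (cong (c′ (suc N) xor_) (sym (⊛-cong[] N (λ _ _ → refl) (go N) N ≤-refl))))))

-- The series a(q²).
expand₂ : Series → Series
expand₂ a zero          = a 0
expand₂ a (suc zero)    = false
expand₂ a (suc (suc n)) = expand₂ (tail a) n

-- The Frobenius map: the product of the two outermost coefficients occurs in both orders and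
-- cancels, and what is left is a coefficient of the square of the tail.
⊛-square : ∀ a → a ⊛ a ≋ expand₂ a
⊛-square a zero          = Bool.∧-idem (a 0)
⊛-square a (suc zero)    = trans (cong ((a 0 ∧ a 1) xor_) (𝔽₂.*-comm (a 1) (a 0))) (Bool.xor-same (a 0 ∧ a 1))
⊛-square a (suc (suc n)) = begin
  (a 0 ∧ a (2 + n)) xor (tail a ⊛ a) (suc n)                           ≡⟨ cong ((a 0 ∧ a (2 + n)) xor_) (⊛-last (tail a) a n) ⟩
  (a 0 ∧ a (2 + n)) xor ((tail a ⊛ tail a) n xor (a (2 + n) ∧ a 0))    ≡⟨ xor.x∙yz≈y∙xz (a 0 ∧ a (2 + n)) ((tail a ⊛ tail a) n) (a (2 + n) ∧ a 0) ⟩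
  (tail a ⊛ tail a) n xor ((a 0 ∧ a (2 + n)) xor (a (2 + n) ∧ a 0))    ≡⟨ cong₂ _xor_ (⊛-square (tail a) n) (trans (cong ((a 0 ∧ a (2 + n)) xor_) (𝔽₂.*-comm (a (2 + n)) (a 0))) (Bool.xor-same (a 0 ∧ a (2 + n)))) ⟩
  expand₂ (tail a) n xor false                                         ≡⟨ 𝔽₂.+-identityʳ _ ⟩
  expand₂ (tail a) n                                                   ∎
  where open ≡-Reasoning

-- Defined by recursion so that `expand₂` and `⊛` compute at `double n`.
double : ℕ → ℕ
double zero    = zero
double (suc n) = suc (suc (double n))

double≡2* : ∀ n → double n ≡ 2 * n
double≡2* zero    = refl
double≡2* (suc n) = trans (cong (suc ∘ suc) (double≡2* n)) (cong suc (sym (+-suc n (n + 0))))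

evenPart : Series → Series
evenPart a n = a (double n)

evenPart-⊛-square : ∀ a c → evenPart (a ⊛ (c ⊛ c)) ≋ evenPart a ⊛ c
evenPart-⊛-square a c n = begin
  (a ⊛ (c ⊛ c)) (double n)      ≡⟨ ⊛-comm a (c ⊛ c) (double n) ⟩
  ((c ⊛ c) ⊛ a) (double n)      ≡⟨ ⊛-cong (⊛-square c) (λ _ → refl) (double n) ⟩
  (expand₂ c ⊛ a) (double n)    ≡⟨ go c n ⟩
  (c ⊛ evenPart a) n            ≡⟨ ⊛-comm c (evenPart a) n ⟩
  (evenPart a ⊛ c) n            ∎
  where
  open ≡-Reasoning
  go : ∀ c n → (expand₂ c ⊛ a) (double n) ≡ (c ⊛ evenPart a) n
  go c zero    = refl
  go c (suc n) = cong ((c 0 ∧ a (double (suc n))) xor_) (go (tail c) n)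

-- Parities of sums over lists

⨁ : ∀ {A : Set} → (A → Bool) → List A → Bool
⨁ g []       = false
⨁ g (x ∷ xs) = g x xor ⨁ g xs

⨁-cong : ∀ {A : Set} {g h : A → Bool} xs → (∀ {x} → x ∈ xs → g x ≡ h x) → ⨁ g xs ≡ ⨁ h xs
⨁-cong []       e = refl
⨁-cong (x ∷ xs) e = cong₂ _xor_ (e (here refl)) (⨁-cong xs (e ∘ there))

⨁-false : ∀ {A : Set} {g : A → Bool} xs → (∀ {x} → x ∈ xs → g x ≡ false) → ⨁ g xs ≡ false
⨁-false []       e = refl
⨁-false (x ∷ xs) e = cong₂ _xor_ (e (here refl)) (⨁-false xs (e ∘ there))

⨁-∧ : ∀ {A : Set} u (g : A → Bool) xs → ⨁ (λ x → u ∧ g x) xs ≡ u ∧ ⨁ g xs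
⨁-∧ u g []       = sym (𝔽₂.zeroʳ u)
⨁-∧ u g (x ∷ xs) = trans (cong ((u ∧ g x) xor_) (⨁-∧ u g xs)) (sym (𝔽₂.distribˡ u (g x) (⨁ g xs)))

⨁-++ : ∀ {A : Set} (g : A → Bool) xs ys → ⨁ g (xs ++ ys) ≡ ⨁ g xs xor ⨁ g ys
⨁-++ g []       ys = refl
⨁-++ g (x ∷ xs) ys = trans (cong (g x xor_) (⨁-++ g xs ys)) (sym (𝔽₂.+-assoc (g x) (⨁ g xs) (⨁ g ys)))

⨁-map : ∀ {A B : Set} (g : B → Bool) (φ : A → B) xs → ⨁ g (map φ xs) ≡ ⨁ (g ∘ φ) xs
⨁-map g φ []       = refl
⨁-map g φ (x ∷ xs) = cong (g (φ x) xor_) (⨁-map g φ xs)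

⨁-× : ∀ {A B : Set} (g : A × B → Bool) xs ys → ⨁ g (cartesianProduct xs ys) ≡ ⨁ (λ x → ⨁ (λ y → g (x , y)) ys) xs
⨁-× g []       ys = refl
⨁-× g (x ∷ xs) ys = trans (⨁-++ g (map (x ,_) ys) _) (cong₂ _xor_ (⨁-map g (x ,_) ys) (⨁-× g xs ys))

odd : ℕ → Bool
odd zero    = false
odd (suc n) = not (odd n)

⨁≡odd : ∀ {A : Set} {P : A → Set} (P? : ∀ x → Dec (P x)) xs → ⨁ (does ∘ P?) xs ≡ odd (length (filter P? xs))
⨁≡odd P? []       = refl
⨁≡odd P? (x ∷ xs) with P? x
... | yes _ = cong not (⨁≡odd P? xs)
... | no _  = ⨁≡odd P? xs

-- This transports coefficients between theta series. The image of the first solution list and the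
-- second solution list are both free of repetitions and have the same elements, hence are
-- permutations of each other and have lengths of the same parity.
⨁-bijection : ∀ {A B : Set} {P : A → Set} {Q : B → Set} (P? : ∀ x → Dec (P x)) (Q? : ∀ y → Dec (Q y)) {xs ys}
  (φ : A → B) → (∀ {x x′} → φ x ≡ φ x′ → x ≡ x′) → Unique xs → Unique ys →
  (∀ {x} → x ∈ xs → P x → φ x ∈ ys × Q (φ x)) →
  (∀ {y} → y ∈ ys → Q y → ∃[ x ] (x ∈ xs × P x × φ x ≡ y)) →
  ⨁ (does ∘ P?) xs ≡ ⨁ (does ∘ Q?) ys
⨁-bijection P? Q? {xs} {ys} φ φ-inj uxs uys into onto = begin
  ⨁ (does ∘ P?) xs                  ≡⟨ ⨁≡odd P? xs ⟩
  odd (length (filter P? xs))         ≡⟨ cong odd (sym (length-map φ (filter P? xs))) ⟩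
  odd (length (map φ (filter P? xs))) ≡⟨ cong odd (↭-length (∼bag⇒↭ (unique∧set⇒bag (Unique.map⁺ φ-inj (Unique.filter⁺ P? uxs)) (Unique.filter⁺ Q? uys) same))) ⟩
  odd (length (filter Q? ys))         ≡⟨ sym (⨁≡odd Q? ys) ⟩
  ⨁ (does ∘ Q?) ys                  ∎
  where
  open ≡-Reasoning
  to : ∀ {y} → y ∈ map φ (filter P? xs) → y ∈ filter Q? ys
  to y∈ with ∈-map⁻ φ y∈
  ... | x , x∈ , refl = let x∈xs , Px = ∈-filter⁻ P? x∈ ; φx∈ , Qφx = into x∈xs Px in ∈-filter⁺ Q? φx∈ Qφx
  from : ∀ {y} → y ∈ filter Q? ys → y ∈ map φ (filter P? xs)
  from y∈ with ∈-filter⁻ Q? y∈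
  ... | y∈ys , Qy with onto y∈ys Qy
  ... | x , x∈xs , Px , refl = ∈-map⁺ φ (∈-filter⁺ P? x∈xs Px)
  same : ∀ {y} → y ∈ map φ (filter P? xs) ⇔ y ∈ filter Q? ys
  same = mk⇔ to from

-- Inert primes do not divide x² + 24 m² properly

⌊√_⌋ : ∀ n → ∃[ s ] (s * s ≤ n × n < suc s * suc s)
⌊√ zero ⌋ = 0 , z≤n , s≤s z≤n
⌊√ suc n ⌋ with ⌊√ n ⌋
... | s , lo , hi with suc n <? suc s * suc s
... | yes lt = s , m≤n⇒m≤1+n lo , lt
... | no ≮   = suc s , ≮⇒≥ ≮ , ≤-<-trans hi (*-mono-< (n<1+n (suc s)) (n<1+n (suc s)))

∣+m-+n∣≤ : ∀ {m n s} → m ≤ s → n ≤ s → abs (⁺ m ℤ.- ⁺ n) ≤ s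
∣+m-+n∣≤ {m} {n} m≤s n≤s rewrite ℤ.m-n≡m⊖n m n with ≤-total m n
... | inj₁ m≤n rewrite ℤ.∣⊖∣-≤ m≤n = ≤-trans (m∸n≤m n m) n≤s
... | inj₂ n≤m rewrite ℤ.⊖-≥ n≤m = ≤-trans (m∸n≤m m n) m≤s

+m-+n≡0⇒m≡n : ∀ m n → abs (⁺ m ℤ.- ⁺ n) ≡ 0 → m ≡ n
+m-+n≡0⇒m≡n m n e = ℤ.+-injective (ℤ.i-j≡0⇒i≡j (⁺ m) (⁺ n) (ℤ.∣i∣≡0⇒i≡0 e))

+m≡ : ∀ m p .{{_ : NonZero p}} → ⁺ m ≡ ⁺ (m % p) ℤ.+ ⁺ (m / p) ℤ.* ⁺ p
+m≡ m p = trans (cong ⁺_ (m≡m%n+[m/n]*n m p)) (trans (ℤ.pos-+ (m % p) (m / p * p)) (cong (ℤ._+_ (⁺ (m % p))) (ℤ.pos-* (m / p) p)))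

%≡%⇒ : ∀ {m n p} .{{_ : NonZero p}} → m % p ≡ n % p → ∃[ q ] ⁺ m ℤ.- ⁺ n ≡ q ℤ.* ⁺ p
%≡%⇒ {m} {n} {p} eq = ⁺ (m / p) ℤ.- ⁺ (n / p) , (begin
  ⁺ m ℤ.- ⁺ n     ≡⟨ cong₂ ℤ._-_ (+m≡ m p) (trans (+m≡ n p) (cong (λ r → ⁺ r ℤ.+ ⁺ (n / p) ℤ.* ⁺ p) (sym eq))) ⟩
  (⁺ (m % p) ℤ.+ ⁺ (m / p) ℤ.* ⁺ p) ℤ.- (⁺ (m % p) ℤ.+ ⁺ (n / p) ℤ.* ⁺ p) ≡⟨ cancel (⁺ (m % p)) (⁺ (m / p)) (⁺ (n / p)) (⁺ p) ⟩
  (⁺ (m / p) ℤ.- ⁺ (n / p)) ℤ.* ⁺ p ∎)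
  where
  open ≡-Reasoning
  cancel : ∀ r u v p → (r ℤ.+ u ℤ.* p) ℤ.- (r ℤ.+ v ℤ.* p) ≡ (u ℤ.- v) ℤ.* p
  cancel = ℤ.solve-∀

+form : ∀ u v → ⁺ (u * u + 6 * (v * v)) ≡ ⁺ u ℤ.* ⁺ u ℤ.+ ⁺ 6 ℤ.* (⁺ v ℤ.* ⁺ v)
+form u v = trans (ℤ.pos-+ (u * u) (6 * (v * v))) (cong₂ ℤ._+_ (ℤ.pos-* u u) (trans (ℤ.pos-* 6 (v * v)) (cong (ℤ._*_ (⁺ 6)) (ℤ.pos-* v v))))

-- By z² (A² + 6 B²) = (A z + B x) (A z - B x) + B² (x² + 6 z²), where `p` divides both summands on
-- the right and does not divide z.
linear⇒form : ∀ {p} (A B Q : ℤ) x z → Prime p → p ∣ x * x + 6 * (z * z) → ¬ p ∣ z →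
              A ℤ.* ⁺ z ℤ.+ B ℤ.* ⁺ x ≡ Q ℤ.* ⁺ p → p ∣ abs A * abs A + 6 * (abs B * abs B)
linear⇒form {p} A B Q x z pr (divides R eqR) p∤z linear
  with euclidsLemma (z * z) (abs A * abs A + 6 * (abs B * abs B)) pr
         (divides (abs U) (trans (cong abs quadratic) (ℤ.abs-* U (⁺ p))))
  where
  open ≡-Reasoning
  L = A ℤ.* ⁺ z ℤ.- B ℤ.* ⁺ x
  U = Q ℤ.* L ℤ.+ B ℤ.* B ℤ.* ⁺ R
  identity : ∀ x z A B → z ℤ.* z ℤ.* (A ℤ.* A ℤ.+ ⁺ 6 ℤ.* (B ℤ.* B)) ≡
    (A ℤ.* z ℤ.+ B ℤ.* x) ℤ.* (A ℤ.* z ℤ.- B ℤ.* x) ℤ.+ B ℤ.* B ℤ.* (x ℤ.* x ℤ.+ ⁺ 6 ℤ.* (z ℤ.* z))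
  identity = ℤ.solve-∀
  factor : ∀ Q L B R p → Q ℤ.* p ℤ.* L ℤ.+ B ℤ.* B ℤ.* (R ℤ.* p) ≡ (Q ℤ.* L ℤ.+ B ℤ.* B ℤ.* R) ℤ.* p
  factor = ℤ.solve-∀
  norm : ⁺ x ℤ.* ⁺ x ℤ.+ ⁺ 6 ℤ.* (⁺ z ℤ.* ⁺ z) ≡ ⁺ R ℤ.* ⁺ p
  norm = trans (sym (+form x z)) (trans (cong ⁺_ eqR) (ℤ.pos-* R p))
  form≡ : ⁺ (abs A * abs A + 6 * (abs B * abs B)) ≡ A ℤ.* A ℤ.+ ⁺ 6 ℤ.* (B ℤ.* B)
  form≡ = trans (ℤ.pos-+ (abs A * abs A) (6 * (abs B * abs B)))
    (cong₂ ℤ._+_ (sym (i*i≡+∣i∣² A)) (trans (ℤ.pos-* 6 (abs B * abs B)) (cong (ℤ._*_ (⁺ 6)) (sym (i*i≡+∣i∣² B)))))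
  quadratic : ⁺ (z * z * (abs A * abs A + 6 * (abs B * abs B))) ≡ U ℤ.* ⁺ p
  quadratic = begin
    ⁺ (z * z * (abs A * abs A + 6 * (abs B * abs B)))             ≡⟨ ℤ.pos-* (z * z) _ ⟩
    ⁺ (z * z) ℤ.* ⁺ (abs A * abs A + 6 * (abs B * abs B))         ≡⟨ cong₂ ℤ._*_ (ℤ.pos-* z z) form≡ ⟩
    ⁺ z ℤ.* ⁺ z ℤ.* (A ℤ.* A ℤ.+ ⁺ 6 ℤ.* (B ℤ.* B))               ≡⟨ identity (⁺ x) (⁺ z) A B ⟩
    (A ℤ.* ⁺ z ℤ.+ B ℤ.* ⁺ x) ℤ.* L ℤ.+ B ℤ.* B ℤ.* (⁺ x ℤ.* ⁺ x ℤ.+ ⁺ 6 ℤ.* (⁺ z ℤ.* ⁺ z)) ≡⟨ cong₂ (λ u v → u ℤ.* L ℤ.+ B ℤ.* B ℤ.* v) linear norm ⟩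
    Q ℤ.* ⁺ p ℤ.* L ℤ.+ B ℤ.* B ℤ.* (⁺ R ℤ.* ⁺ p)                 ≡⟨ factor Q L B (⁺ R) (⁺ p) ⟩
    U ℤ.* ⁺ p ∎
... | inj₂ d = d
... | inj₁ d with euclidsLemma z z pr d
... | inj₁ d′ = ⊥-elim (p∤z d′)
... | inj₂ d′ = ⊥-elim (p∤z d′)

pigeonhole-% : ∀ {p n} .{{_ : NonZero p}} (f : ℕ → ℕ) → p < n → ∃[ i ] ∃[ j ] (i < j × j < n × f i % p ≡ f j % p)
pigeonhole-% {p} f p<n with Fin.pigeonhole p<n (λ i → Fin.fromℕ< (m%n<n (f (Fin.toℕ i)) p))
... | i , j , i<j , eq = Fin.toℕ i , Fin.toℕ j , i<j , Fin.toℕ<n j ,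
      trans (sym (Fin.toℕ-fromℕ< _)) (trans (cong Fin.toℕ eq) (Fin.toℕ-fromℕ< _))

form-positive : ∀ m n → (m ≡ 0 → n ≡ 0 → ⊥) → 1 ≤ m * m + 6 * (n * n)
form-positive zero    zero    h = ⊥-elim (h refl refl)
form-positive zero    (suc n) h = s≤s z≤n
form-positive (suc m) n       h = s≤s z≤n

-- Thue's lemma, applied to A z + B x ≡ 0 (mod p).
thue : ∀ {p} x z → Prime p → p ∣ x * x + 6 * (z * z) → ¬ p ∣ z →
       ∃[ m ] ∃[ n ] (m * m ≤ p × n * n ≤ p × 1 ≤ m * m + 6 * (n * n) × p ∣ m * m + 6 * (n * n))
thue {p} x z pr h p∤z with ⌊√ p ⌋
-- A number `i` below the square of `suc s` encodes the pair of `i / suc s` and `i % suc s`, both at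
-- most `s`. There are more than `p` such pairs, so two of them give the same residue; their
-- difference is small and not zero.
... | s , s²≤p , p<S² with pigeonhole-% {{prime⇒nonZero pr}} (λ i → (i / suc s) * z + (i % suc s) * x) p<S²
... | i , j , i<j , j<S² , eq with %≡%⇒ {{prime⇒nonZero pr}} eq
... | Q , eqQ = abs A , abs B , square≤ A≤s , square≤ B≤s , form-positive (abs A) (abs B) nonzero ,
      linear⇒form A B Q x z pr h p∤z (trans (regroup (⁺ i₁) (⁺ j₁) (⁺ i₂) (⁺ j₂) (⁺ z) (⁺ x))
        (trans (cong₂ ℤ._-_ (sym (+linear i₁ i₂)) (sym (+linear j₁ j₂))) eqQ))
  where
  S  = suc s
  i₁ = i / S
  i₂ = i % S
  j₁ = j / S
  j₂ = j % S
  A  = ⁺ i₁ ℤ.- ⁺ j₁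
  B  = ⁺ i₂ ℤ.- ⁺ j₂
  A≤s : abs A ≤ s
  A≤s = ∣+m-+n∣≤ {i₁} {j₁} (s≤s⁻¹ (m<n*o⇒m/o<n (<-trans i<j j<S²))) (s≤s⁻¹ (m<n*o⇒m/o<n j<S²))
  B≤s : abs B ≤ s
  B≤s = ∣+m-+n∣≤ {i₂} {j₂} (s≤s⁻¹ (m%n<n i S)) (s≤s⁻¹ (m%n<n j S))
  square≤ : ∀ {m} → m ≤ s → m * m ≤ p
  square≤ m≤s = ≤-trans (*-mono-≤ m≤s m≤s) s²≤p
  nonzero : abs A ≡ 0 → abs B ≡ 0 → ⊥
  nonzero A≡0 B≡0 = <⇒≢ i<j (trans (m≡m%n+[m/n]*n i S) (trans
    (cong₂ (λ u v → u + v * S) (+m-+n≡0⇒m≡n i₂ j₂ B≡0) (+m-+n≡0⇒m≡n i₁ j₁ A≡0))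
    (sym (m≡m%n+[m/n]*n j S))))
  +linear : ∀ u v → ⁺ (u * z + v * x) ≡ ⁺ u ℤ.* ⁺ z ℤ.+ ⁺ v ℤ.* ⁺ x
  +linear u v = trans (ℤ.pos-+ (u * z) (v * x)) (cong₂ ℤ._+_ (ℤ.pos-* u z) (ℤ.pos-* v x))
  regroup : ∀ i₁ j₁ i₂ j₂ z x → (i₁ ℤ.- j₁) ℤ.* z ℤ.+ (i₂ ℤ.- j₂) ℤ.* x ≡ (i₁ ℤ.* z ℤ.+ i₂ ℤ.* x) ℤ.- (j₁ ℤ.* z ℤ.+ j₂ ℤ.* x)
  regroup = ℤ.solve-∀

-- The forms k p = a² + 6 b² with 1 ≤ k ≤ 7 are excluded modulo 24 k; there
-- a matters modulo 12 k and b modulo 2 k only.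
form-residues : ∀ {k} → k < 7 → ∀ {a} → a < 12 * suc k → ∀ {b} → b < 2 * suc k →
  let v = (a * a + 6 * (b * b)) % (24 * suc k) in χ⁻ (v / suc k) ≡ true → v / suc k * suc k ≢ v
form-residues = from-yes (allUpTo? (λ k → allUpTo? (λ a → allUpTo? (λ b →
  let v = (a * a + 6 * (b * b)) % (24 * suc k) in (χ⁻ (v / suc k) Bool.≟ true) →-dec ¬? (v / suc k * suc k ≟ v)) (2 * suc k)) (12 * suc k)) 7)

form-reduce : ∀ k a b → (a * a + 6 * (b * b)) % (24 * suc k) ≡
  (let a′ = a % (12 * suc k) ; b′ = b % (2 * suc k) in (a′ * a′ + 6 * (b′ * b′)) % (24 * suc k))
form-reduce k a b = trans
  (cong (_% M) (trans
    (cong₂ (λ a b → a * a + 6 * (b * b)) (m≡m%n+[m/n]*n a (12 * suc k)) (m≡m%n+[m/n]*n b (2 * suc k)))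
    (expand (suc k) a′ t b′ u)))
  ([m+kn]%n≡m%n (a′ * a′ + 6 * (b′ * b′)) (a′ * t + 6 * suc k * t * t + b′ * u + suc k * u * u) M)
  where
  M  = 24 * suc k
  a′ = a % (12 * suc k)
  t  = a / (12 * suc k)
  b′ = b % (2 * suc k)
  u  = b / (2 * suc k)
  expand : ∀ k a t b u → (a + t * (12 * k)) * (a + t * (12 * k)) + 6 * ((b + u * (2 * k)) * (b + u * (2 * k)))
           ≡ (a * a + 6 * (b * b)) + (a * t + 6 * k * t * t + b * u + k * u * u) * (24 * k)
  expand = solve-∀

quotient-χ⁻ : ∀ k {v r} → v ≡ r * suc k → χ⁻ r ≡ true → χ⁻ (v / suc k) ≡ true × v / suc k * suc k ≡ v
quotient-χ⁻ k {_} {r} refl χr = trans (cong χ⁻ (m*n/n≡m r (suc k))) χr , cong (_* suc k) (m*n/n≡m r (suc k))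

form-residues′ : ∀ k a b r → k < 7 → a < 12 * suc k → b < 2 * suc k → χ⁻ r ≡ true →
                 (a * a + 6 * (b * b)) % (24 * suc k) ≢ r * suc k
form-residues′ k a b r k<7 a< b< χr eq =
  form-residues {k} k<7 {a} a< {b} b< (proj₁ (quotient-χ⁻ k {r = r} eq χr)) (proj₂ (quotient-χ⁻ k {r = r} eq χr))

-- Taking residues modulo 24 (k + 1) keeps the class of `p` modulo 24 visible: the right-hand side
-- leaves the remainder `p % 24 * suc k`.
form-excluded : ∀ {k p a b} → k < 7 → χ⁻ (p % 24) ≡ true → a * a + 6 * (b * b) ≢ p * suc k
form-excluded {k} {p} {a} {b} k<7 χp eq = form-residues′ k (a % (12 * suc k)) (b % (2 * suc k)) (p % 24) k<7
  (m%n<n a (12 * suc k)) (m%n<n b (2 * suc k)) χp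
  (trans (sym (form-reduce k a b)) (trans (cong (_% (24 * suc k)) eq) (sym (m%n*o≡m*o%[n*o] p 24 (suc k)))))

prime∣²⇒∣ : ∀ {p} m → Prime p → p ∣ m * m → p ∣ m
prime∣²⇒∣ m pr d with euclidsLemma m m pr d
... | inj₁ d′ = d′
... | inj₂ d′ = d′

-- The size bounds from Thue's lemma make the form at most `7 * p`, so only the multiples from `p`
-- to `7 * p` have to be excluded by congruences.
form∤ : ∀ {p} → Inert p → ∀ m n → m * m ≤ p → n * n ≤ p → 1 ≤ m * m + 6 * (n * n) → ¬ p ∣ m * m + 6 * (n * n)
form∤ inert m n m²≤p n²≤p pos (divides zero    eq) = <⇒≢ pos (sym eq)
form∤ {p} (pr , χp) m n m²≤p n²≤p pos (divides (suc k) eq) with k <? 7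
... | yes k<7 = form-excluded {k} {p} {m} {n} k<7 χp (trans eq (*-comm (suc k) p))
... | no k≮7 = <⇒≱ big small
  where
  small : m * m + 6 * (n * n) ≤ 7 * p
  small = +-mono-≤ m²≤p (*-monoʳ-≤ 6 n²≤p)
  big : 7 * p < m * m + 6 * (n * n)
  big = ≤-trans (*-monoˡ-< p ⦃ prime⇒nonZero pr ⦄ (s≤s (≮⇒≥ k≮7))) (≤-reflexive (sym eq))

inert-∣ : ∀ {p} x z → Inert p → p ∣ x * x + 6 * (z * z) → p ∣ z
inert-∣ {p} x z inert h with p ∣? z
... | yes d = d
... | no p∤z = let m , n , m²≤p , n²≤p , pos , d = thue x z (proj₁ inert) h p∤z in ⊥-elim (form∤ inert m n m²≤p n²≤p pos d)

inert∤2 : ∀ {p} → Inert p → ¬ p ∣ 2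
inert∤2 inert p∣2 = <⇒≱ (inert⇒3< inert) (≤-trans (∣⇒≤ p∣2) (s≤s (s≤s z≤n)))

inert-∣² : ∀ {p} x m → Inert p → p ∣ x * x + 24 * (m * m) → (p ∣ x) × (p ∣ m)
inert-∣² {p} x m inert h = p∣x , p∣m
  where
  rearrange : ∀ m → 24 * (m * m) ≡ 6 * (2 * m * (2 * m))
  rearrange = solve-∀
  p∣2m : p ∣ 2 * m
  p∣2m = inert-∣ x (2 * m) inert (subst (λ z → p ∣ x * x + z) (rearrange m) h)
  p∣m : p ∣ m
  p∣m = [ (λ d → ⊥-elim (inert∤2 inert d)) , (λ d → d) ]′ (euclidsLemma 2 m (proj₁ inert) p∣2m)
  p∣x : p ∣ x
  p∣x = prime∣²⇒∣ x (proj₁ inert) (∣m+n∣m⇒∣n (subst (p ∣_) (+-comm (x * x) (24 * (m * m))) h) (∣n⇒∣m*n 24 (∣m⇒∣m*n m p∣m)))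

-- The series of b₃ modulo 2

regParts-∣ : ∀ {t m} n → t ∣ suc m → regParts t (suc m) n ≡ regParts t m n
regParts-∣ {t} {m} n d with t ∣? suc m
... | yes _ = refl
... | no ∤d  = ⊥-elim (∤d d)

copies : (ℕ → ℕ) → ℕ → ℕ → ℕ → ℕ
copies r M n k = if k * M ≤ᵇ n then r (n ∸ k * M) else 0

regParts-∤ : ∀ {t m} n → ¬ t ∣ suc m → regParts t (suc m) n ≡ sum (map (copies (regParts t m) (suc m) n) (upTo (suc n)))
regParts-∤ {t} {m} n ∤d with t ∣? suc m
... | yes d = ⊥-elim (∤d d)
... | no _  = refl

sumTo : ℕ → (ℕ → ℕ) → ℕ
sumTo zero    g = 0
sumTo (suc n) g = g 0 + sumTo n (g ∘ suc)

sum-map-applyUpTo : ∀ (g φ : ℕ → ℕ) n → sum (map g (applyUpTo φ n)) ≡ sumTo n (g ∘ φ)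
sum-map-applyUpTo g φ zero    = refl
sum-map-applyUpTo g φ (suc n) = cong (g (φ 0) +_) (sum-map-applyUpTo g (φ ∘ suc) n)

sumTo-zero : ∀ n {g} → (∀ k → g k ≡ 0) → sumTo n g ≡ 0
sumTo-zero zero    h = refl
sumTo-zero (suc n) h = cong₂ _+_ (h 0) (sumTo-zero n (h ∘ suc))

sumTo-cong : ∀ n {g h} → (∀ k → g k ≡ h k) → sumTo n g ≡ sumTo n h
sumTo-cong zero    e = refl
sumTo-cong (suc n) e = cong₂ _+_ (e 0) (sumTo-cong n (e ∘ suc))

sumTo-extend : ∀ {m n} g → m ≤ n → (∀ k → m ≤ k → g k ≡ 0) → sumTo n g ≡ sumTo m g
sumTo-extend {n = n} g z≤n       h = sumTo-zero n λ k → h k z≤n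
sumTo-extend         g (s≤s m≤n) h = cong (g 0 +_) (sumTo-extend (g ∘ suc) m≤n λ k m≤k → h (suc k) (s≤s m≤k))

≤ᵇ-true : ∀ {m n} → m ≤ n → (m ≤ᵇ n) ≡ true
≤ᵇ-true {m} {n} m≤n = dec-true (m ≤? n) m≤n

≤ᵇ-false : ∀ {m n} → n < m → (m ≤ᵇ n) ≡ false
≤ᵇ-false {m} {n} n<m = dec-false (m ≤? n) (<⇒≱ n<m)

copies-> : ∀ r M n k → n < k * M → copies r M n k ≡ 0
copies-> r M n k lt rewrite ≤ᵇ-false lt = refl

copies-suc : ∀ r M n k → copies r M (M + n) (suc k) ≡ copies r M n k
copies-suc r M n k with k * M ≤? n
... | yes le rewrite ≤ᵇ-true (+-monoʳ-≤ M le) | ≤ᵇ-true le | [m+n]∸[m+o]≡n∸o M n (k * M) = refl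
... | no ≰ rewrite ≤ᵇ-false (+-monoʳ-< M (≰⇒> ≰)) | ≤ᵇ-false (≰⇒> ≰) = refl

module _ {t m} (t∤ : ¬ t ∣ suc m) where

  private
    M = suc m
    r = regParts t m

  regParts-sumTo : ∀ n → regParts t M n ≡ sumTo (suc n) (copies r M n)
  regParts-sumTo n = trans (regParts-∤ n t∤) (sum-map-applyUpTo (copies r M n) (λ k → k) (suc n))

  regParts-< : ∀ n → n < M → regParts t M n ≡ r n
  regParts-< n n<M = trans (regParts-sumTo n) (trans (cong (r n +_)
    (sumTo-zero n λ k → copies-> r M n (suc k) (≤-trans n<M (m≤m+n M (k * M))))) (+-identityʳ (r n)))

  -- Either the part `M` does not occur, or one copy of it can be removed. For generating functions
  -- this is the division by 1 - q^M.
  regParts-+ : ∀ n → regParts t M (M + n) ≡ r (M + n) + regParts t M n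
  regParts-+ n = trans (regParts-sumTo (M + n)) (cong (r (M + n) +_) (begin
    sumTo (M + n) (copies r M (M + n) ∘ suc)  ≡⟨ sumTo-cong (M + n) (copies-suc r M n) ⟩
    sumTo (M + n) (copies r M n)              ≡⟨ sumTo-extend (copies r M n) (s≤s (m≤n+m n m)) (λ k n<k → copies-> r M n k (≤-trans n<k (m≤m*n k M))) ⟩
    sumTo (suc n) (copies r M n)              ≡⟨ sym (regParts-sumTo n) ⟩
    regParts t M n                            ∎))
    where open ≡-Reasoning

odd-+ : ∀ m n → odd (m + n) ≡ odd m xor odd n
odd-+ zero    n = refl
odd-+ (suc m) n = trans (cong not (odd-+ m n)) (Bool.not-distribˡ-xor (odd m) (odd n))

partsSeries : ℕ → Series
partsSeries m n = odd (regParts 3 m n)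

partsSeries-∤ : ∀ {m} → ¬ 3 ∣ suc m → partsSeries (suc m) ⊛ (mono 0 ⊕ mono (suc m)) ≋ partsSeries m
partsSeries-∤ {m} ∤d n = begin
  (a ⊛ (mono 0 ⊕ mono M)) n       ≡⟨ 𝕊.distribˡ a (mono 0) (mono M) n ⟩
  (a ⊛ mono 0) n xor (a ⊛ mono M) n ≡⟨ cong₂ _xor_ (𝕊.*-identityʳ a n) (trans (⊛-comm a (mono M) n) (mono-⊛ M a n)) ⟩
  a n xor shift M a n             ≡⟨ go (n <? M) ⟩
  partsSeries m n                 ∎
  where
  open ≡-Reasoning
  M = suc m
  a = partsSeries M
  go : Dec (n < M) → a n xor shift M a n ≡ partsSeries m n
  go (yes n<M) = trans (cong (a n xor_) (shift-< M a n<M)) (trans (Bool.xor-identityʳ (a n)) (cong odd (regParts-< ∤d n n<M)))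
  go (no n≮M) with m≤n⇒∃[o]m+o≡n (≮⇒≥ n≮M)
  ... | n′ , refl = trans (cong₂ _xor_ (trans (cong odd (regParts-+ ∤d n′)) (odd-+ (regParts 3 m (M + n′)) (regParts 3 M n′))) (shift-+ M a n′))
    (trans (Bool.xor-assoc (partsSeries m (M + n′)) (a n′) (a n′)) (trans (cong (partsSeries m (M + n′) xor_) (Bool.xor-same (a n′))) (Bool.xor-identityʳ _)))

regParts-stable : ∀ {t m n} → n ≤ m → regParts t m n ≡ b t n
regParts-stable {t} {zero}  z≤n = refl
regParts-stable {t} {suc m} {n} n≤m = go (n ≟ suc m) (t ∣? suc m)
  where
  n<M : n ≢ suc m → n < suc m
  n<M n≢ = ≤∧≢⇒< n≤m n≢
  go : Dec (n ≡ suc m) → Dec (t ∣ suc m) → regParts t (suc m) n ≡ b t n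
  go (yes refl) _       = refl
  go (no n≢)    (yes d) = trans (regParts-∣ n d) (regParts-stable (s≤s⁻¹ (n<M n≢)))
  go (no n≢)    (no ∤d)  = trans (regParts-< ∤d n (n<M n≢)) (regParts-stable (s≤s⁻¹ (n<M n≢)))

⊕-self : ∀ a → a ⊕ a ≋ 𝟎
⊕-self a n = Bool.xor-same (a n)

module Pentagonal (c : ℕ) where

  open Shanks seriesRing ⊕-self (mono c) public

  pow≋mono : ∀ n → pow n ≋ mono (n * c)
  pow≋mono zero    n = refl
  pow≋mono (suc m) n = trans (⊛-cong {mono c} (λ _ → refl) (pow≋mono m) n) (mono-⊛-mono c (m * c) n)

  powers≋⨁ : ∀ e is → powers e is ≋ λ n → ⨁ (λ i → mono (e i * c) n) is
  powers≋⨁ e []       n = refl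
  powers≋⨁ e (i ∷ is) n = cong₂ _xor_ (pow≋mono (e i) n) (powers≋⨁ e is n)

  antidiagonal-false : ∀ {g} n {N} → (∀ s k → g s k N ≡ false) → antidiagonal g n N ≡ false
  antidiagonal-false zero    h = h 0 0
  antidiagonal-false (suc n) h = cong₂ _xor_ (h 0 (suc n)) (antidiagonal-false n λ s k → h (suc s) k)

  module _ (1≤c : 1 ≤ c) where

    term-false : ∀ n s k {N} → N ≤ n → term n (suc s) k N ≡ false
    term-false n s k {N} N≤n = begin
      (prods (suc s) k ⊛ pow e) N            ≡⟨ ⊛-cong {prods (suc s) k} (λ _ → refl) (pow≋mono e) N ⟩
      (prods (suc s) k ⊛ mono (e * c)) N     ≡⟨ ⊛-comm (prods (suc s) k) (mono (e * c)) N ⟩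
      (mono (e * c) ⊛ prods (suc s) k) N     ≡⟨ mono-⊛ (e * c) (prods (suc s) k) N ⟩
      shift (e * c) (prods (suc s) k) N      ≡⟨ shift-< (e * c) (prods (suc s) k) N<ec ⟩
      false                                  ∎
      where
      open ≡-Reasoning
      e = suc s * n + tri (suc s)
      N<ec : N < e * c
      N<ec = ≤-trans (s≤s N≤n) (≤-trans (≤-trans (≤-reflexive (+-comm 1 n)) (+-mono-≤ (m≤m+n n (s * n)) (≤-trans (s≤s z≤n) (m≤n+m (suc s) (tri s)))))
        (m≤m*n e c ⦃ >-nonZero 1≤c ⦄))

    -- Modulo q^(n+1) only the summand with s = 0 survives, and that one is the product itself: all
    -- others are multiples of q to a power above `n`.
    shanks≋prods : ∀ n → shanks n ≋[ n ] prods 0 n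
    shanks≋prods zero    N _   = 𝕊.*-identityʳ (mono 0) N
    shanks≋prods (suc n) N N≤n = trans (cong₂ _xor_ (𝕊.*-identityʳ (prods 0 (suc n)) N)
      (antidiagonal-false n λ s k → term-false (suc n) s k N≤n)) (Bool.xor-identityʳ _)

    prods≋⨁ : ∀ n → prods 0 n ≋[ n ] λ N → ⨁ (λ i → mono (pent i * c) N) (ints n)
    prods≋⨁ n N N≤n = trans (sym (shanks≋prods n N N≤n)) (trans (shanks≈pentagonal n N) (powers≋⨁ pent (ints n) N))

n≤tri : ∀ n → n ≤ tri n
n≤tri zero    = z≤n
n≤tri (suc n) = m≤n+m (suc n) (tri n)

∣i∣≤pent : ∀ i → abs i ≤ pent i
∣i∣≤pent (⁺ n)      = ≤-trans (n≤tri n) (m≤n+m (tri n) (n * n))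
∣i∣≤pent (-[1+ n ]) = ≤-trans (m≤m*n (suc n) (suc n)) (m≤m+n _ (tri n))

mono-false : ∀ {e n} → e ≢ n → mono e n ≡ false
mono-false {e} {n} = dec-false (e ≟ n)

⨁-ints-stable : ∀ {e : ℤ → ℕ} → (∀ i → abs i ≤ e i) → ∀ {m n} → m ≤ n → ⨁ (λ i → mono (e i) m) (ints n) ≡ ⨁ (λ i → mono (e i) m) (ints m)
⨁-ints-stable h {m} {zero}  z≤n = refl
⨁-ints-stable {e} h {m} {suc n} m≤n with m ≟ suc n
... | yes refl = refl
... | no m≢ = trans (cong₂ _xor_ (large (⁺ suc n) ≤-refl) (cong₂ _xor_ (large (-[1+ n ]) ≤-refl) refl)) (⨁-ints-stable h m≤n′)
  where
  m≤n′ = s≤s⁻¹ (≤∧≢⇒< m≤n m≢)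
  large : ∀ i → suc n ≤ abs i → mono (e i) m ≡ false
  large i n<i = mono-false {e i} {m} λ eq → <⇒≱ (s≤s m≤n′) (≤-trans n<i (≤-trans (h i) (≤-reflexive eq)))

-- Truncating to ∣i∣ ≤ n loses nothing, as ∣i∣ ≤ pent i. The series ηq³ is η(q³).
η ηq³ B₃ : Series
η  n = ⨁ (λ i → mono (pent i) n) (ints n)
ηq³ n = ⨁ (λ i → mono (pent i * 3) n) (ints n)
B₃ n = odd (b 3 n)

module P₁ = Pentagonal 1
module P₃ = Pentagonal 3

-- Each step handles the part sizes 3 k + 1, 3 k + 2 and 3 k + 3. The factors of the first two
-- cancel against the generating function; 3 k + 3 is a forbidden part, so its factor remains and
-- extends the product in q³.
partsSeries-prods : ∀ k → partsSeries (k * 3) ⊛ P₁.prods 0 (k * 3) ≋ P₃.prods 0 k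
partsSeries-prods zero    n = trans (𝕊.*-identityʳ (partsSeries 0) n) (zero-parts n)
  where
  zero-parts : partsSeries 0 ≋ mono 0
  zero-parts zero    = refl
  zero-parts (suc n) = refl
partsSeries-prods (suc k) = begin
  partsSeries (3 + m) ⊛ (P ⊛ u₁ ⊛ u₂ ⊛ u₃)   ≈⟨ 𝕊.*-congʳ {P ⊛ u₁ ⊛ u₂ ⊛ u₃} (λ n → cong odd (regParts-∣ {3} {2 + m} n (divides (suc k) refl))) ⟩
  F₂ ⊛ (P ⊛ u₁ ⊛ u₂ ⊛ u₃)                    ≈⟨ 𝕊.*-congˡ {F₂} (𝕊.*-cong (𝕊.*-cong (𝕊.*-congˡ {P} (unit≋ 0)) (unit≋ 1)) (unit≋ 2)) ⟩
  F₂ ⊛ (P ⊛ v₁ ⊛ v₂ ⊛ v₃)                    ≈⟨ rearrange F₂ P v₁ v₂ v₃ ⟩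
  ((F₂ ⊛ v₂) ⊛ v₁) ⊛ P ⊛ v₃                  ≈⟨ 𝕊.*-congʳ {v₃} (𝕊.*-congʳ {P} (𝕊.trans (𝕊.*-congʳ {v₁} (partsSeries-∤ (∤3+ 2 (λ { (divides zero ()) ; (divides (suc _) ()) })))) (partsSeries-∤ (∤3+ 1 (λ { (divides zero ()) ; (divides (suc _) ()) }))))) ⟩
  (partsSeries m ⊛ P) ⊛ v₃                    ≈⟨ 𝕊.*-cong (partsSeries-prods k) (𝕊.refl {v₃}) ⟩
  P₃.prods 0 k ⊛ v₃                           ≈⟨ 𝕊.*-congˡ {P₃.prods 0 k} (𝕊.+-congˡ {mono 0} (𝕊.sym (P₃.pow≋mono (suc k)))) ⟩
  P₃.prods 0 (suc k) ∎
  where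
  open import Relation.Binary.Reasoning.Setoid 𝕊.setoid
  m = k * 3
  P = P₁.prods 0 m
  F₂ = partsSeries (2 + m)
  u₁ = mono 0 ⊕ P₁.pow (1 + m)
  u₂ = mono 0 ⊕ P₁.pow (2 + m)
  u₃ = mono 0 ⊕ P₁.pow (3 + m)
  v₁ = mono 0 ⊕ mono (1 + m)
  v₂ = mono 0 ⊕ mono (2 + m)
  v₃ = mono 0 ⊕ mono (3 + m)
  unit≋ : ∀ i → mono 0 ⊕ P₁.pow (suc i + m) ≋ mono 0 ⊕ mono (suc i + m)
  unit≋ i = 𝕊.+-congˡ {mono 0} λ n → trans (P₁.pow≋mono (suc i + m) n) (cong (λ e → mono e n) (*-identityʳ (suc i + m)))
  ∤3+ : ∀ i → ¬ 3 ∣ i → ¬ 3 ∣ i + m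
  ∤3+ i ∤d d = ∤d (∣m+n∣m⇒∣n (subst (3 ∣_) (+-comm i m) d) (n∣m*n k))
  rearrange : ∀ F P a c d → F ⊛ (P ⊛ a ⊛ c ⊛ d) ≋ ((F ⊛ c) ⊛ a) ⊛ P ⊛ d
  rearrange F P a c d = begin
    F ⊛ (P ⊛ a ⊛ c ⊛ d)     ≈⟨ 𝕊.sym (𝕊.*-assoc F (P ⊛ a ⊛ c) d) ⟩
    F ⊛ (P ⊛ a ⊛ c) ⊛ d     ≈⟨ 𝕊.*-congʳ {d} (begin
      F ⊛ (P ⊛ a ⊛ c)       ≈⟨ 𝕊.*-congˡ {F} (𝕊.*-comm (P ⊛ a) c) ⟩
      F ⊛ (c ⊛ (P ⊛ a))     ≈⟨ 𝕊.sym (𝕊.*-assoc F c (P ⊛ a)) ⟩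
      F ⊛ c ⊛ (P ⊛ a)       ≈⟨ 𝕊.*-congˡ {F ⊛ c} (𝕊.*-comm P a) ⟩
      F ⊛ c ⊛ (a ⊛ P)       ≈⟨ 𝕊.sym (𝕊.*-assoc (F ⊛ c) a P) ⟩
      F ⊛ c ⊛ a ⊛ P         ∎) ⟩
    F ⊛ c ⊛ a ⊛ P ⊛ d       ∎

B₃⊛η≋ηq³ : B₃ ⊛ η ≋ ηq³
B₃⊛η≋ηq³ n = begin
  (B₃ ⊛ η) n                                       ≡⟨ ⊛-cong[] n (λ m m≤n → cong odd (sym (regParts-stable {3} (≤-trans m≤n n≤3n)))) η≋prods n ≤-refl ⟩
  (partsSeries (n * 3) ⊛ P₁.prods 0 (n * 3)) n     ≡⟨ partsSeries-prods n n ⟩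
  P₃.prods 0 n n                                   ≡⟨ P₃.prods≋⨁ (s≤s z≤n) n n ≤-refl ⟩
  ηq³ n                                             ∎
  where
  open ≡-Reasoning
  n≤3n : n ≤ n * 3
  n≤3n = m≤m*n n 3
  η≋prods : η ≋[ n ] P₁.prods 0 (n * 3)
  η≋prods m m≤n = sym (trans (P₁.prods≋⨁ ≤-refl (n * 3) m (≤-trans m≤n n≤3n))
    (trans (⨁-cong (ints (n * 3)) λ {i} _ → cong (λ e → mono e m) (*-identityʳ (pent i))) (⨁-ints-stable ∣i∣≤pent (≤-trans m≤n n≤3n))))

-- The identity η³ = η(q³) θ

ints-≤ : ∀ n → All (λ i → abs i ≤ n) (ints n)
ints-≤ zero    = z≤n ∷ []
ints-≤ (suc n) = ≤-refl ∷ ≤-refl ∷ All.map m≤n⇒m≤1+n (ints-≤ n)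

∈-ints : ∀ {n} i → abs i ≤ n → i ∈ ints n
∈-ints {zero}  (⁺ zero) _ = here refl
∈-ints {suc n} i le with abs i ≟ suc n
∈-ints {suc n} (⁺ .(suc n)) le | yes refl = here refl
∈-ints {suc n} (-[1+ .n ])  le | yes refl = there (here refl)
... | no ≢ = there (there (∈-ints i (s≤s⁻¹ (≤∧≢⇒< le ≢))))

ints-unique : ∀ n → Unique (ints n)
ints-unique zero    = [] ∷ []
ints-unique (suc n) = ((λ ()) ∷ All.map (λ { le refl → <⇒≱ ≤-refl le }) (ints-≤ n))
                    ∷ (All.map (λ { le refl → <⇒≱ ≤-refl le }) (ints-≤ n) ∷ ints-unique n)

-- i (i + 1) / 2
triℤ : ℤ → ℕ
triℤ (⁺ n)      = tri n
triℤ (-[1+ n ]) = tri n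

-- The integers from -n to n - 1, symmetric about -1/2 like `triℤ`: adjacent entries j and -1 - j
-- have the same `triℤ`.
halfInts : ℕ → List ℤ
halfInts zero    = []
halfInts (suc n) = ⁺ n ∷ -[1+ n ] ∷ halfInts n

∈-halfInts : ∀ {n} i → triℤ i < n → i ∈ halfInts n
∈-halfInts {n} (⁺ i) lt = go n (≤-<-trans (n≤tri i) lt)
  where
  go : ∀ n → i < n → ⁺ i ∈ halfInts n
  go (suc n) i<n with i ≟ n
  ... | yes refl = here refl
  ... | no ≢     = there (there (go n (≤∧≢⇒< (s≤s⁻¹ i<n) ≢)))
∈-halfInts {n} (-[1+ i ]) lt = go n (≤-<-trans (n≤tri i) lt)
  where
  go : ∀ n → i < n → -[1+ i ] ∈ halfInts n
  go (suc n) i<n with i ≟ n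
  ... | yes refl = there (here refl)
  ... | no ≢     = there (there (go n (≤∧≢⇒< (s≤s⁻¹ i<n) ≢)))

halfInts-< : ∀ n → All (λ i → i ≢ ⁺ n × i ≢ -[1+ n ] × abs i ≤ n) (halfInts n)
halfInts-< zero    = []
halfInts-< (suc n) = ((λ { () }) , (λ ()) , n≤1+n n) ∷ ((λ ()) , (λ { () }) , ≤-refl)
  ∷ All.map (λ { (_ , _ , le) → (λ { refl → <⇒≱ ≤-refl le }) , (λ { refl → <⇒≱ (n<1+n (suc n)) (≤-trans le (n≤1+n n)) }) , m≤n⇒m≤1+n le }) (halfInts-< n)

halfInts-unique : ∀ n → Unique (halfInts n)
halfInts-unique zero    = []
halfInts-unique (suc n) = ((λ ()) ∷ All.map (λ (≢ , _) → ≢ ∘ sym) (halfInts-< n))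
                        ∷ (All.map (λ (_ , ≢ , _) → ≢ ∘ sym) (halfInts-< n) ∷ halfInts-unique n)

⨁-ints : ∀ g n → ⨁ g (ints n) ≡ g (⁺ 0) xor ⨁ (λ j → g (⁺ suc j) xor g (-[1+ j ])) (downFrom n)
⨁-ints g zero    = refl
⨁-ints g (suc n) = trans (cong (λ z → g (⁺ suc n) xor (g (-[1+ n ]) xor z)) (⨁-ints g n))
  (shuffle (g (⁺ suc n)) (g (-[1+ n ])) (g (⁺ 0)) _)
  where
  shuffle : ∀ a c d e → a xor (c xor (d xor e)) ≡ d xor ((a xor c) xor e)
  shuffle a c d e = trans (sym (𝔽₂.+-assoc a c (d xor e))) (xor.x∙yz≈y∙xz (a xor c) d e)

⨁-halfInts : ∀ g n → ⨁ g (halfInts n) ≡ ⨁ (λ j → g (⁺ j) xor g (-[1+ j ])) (downFrom n)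
⨁-halfInts g zero    = refl
⨁-halfInts g (suc n) = trans (cong (λ z → g (⁺ n) xor (g (-[1+ n ]) xor z)) (⨁-halfInts g n)) (sym (𝔽₂.+-assoc (g (⁺ n)) (g (-[1+ n ])) _))

⨁-downFrom-suc : ∀ g n → ⨁ g (downFrom (suc n)) ≡ g 0 xor ⨁ (g ∘ suc) (downFrom n)
⨁-downFrom-suc g zero    = refl
⨁-downFrom-suc g (suc n) = trans (cong (g (suc n) xor_) (⨁-downFrom-suc g n)) (xor.x∙yz≈y∙xz (g (suc n)) (g 0) _)

gen : ∀ {A : Set} → (A → Bool) → (A → ℕ) → List A → Series
gen w e xs n = ⨁ (λ x → w x ∧ mono (e x) n) xs

gen-⊛ : ∀ {A : Set} w (e : A → ℕ) xs a → gen w e xs ⊛ a ≋ λ n → ⨁ (λ x → w x ∧ shift (e x) a n) xs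
gen-⊛ w e []       a n = 𝟎-⊛ a n
gen-⊛ w e (x ∷ xs) a n = trans (⊛-distribʳ a (λ m → w x ∧ mono (e x) m) (gen w e xs) n)
  (cong₂ _xor_ (trans (⊛-scale (w x) (mono (e x)) a n) (cong (w x ∧_) (mono-⊛ (e x) a n))) (gen-⊛ w e xs a n))

shift-gen : ∀ {A : Set} d w (e : A → ℕ) xs → shift d (gen w e xs) ≋ gen w (λ x → d + e x) xs
shift-gen zero    w e xs n       = refl
shift-gen (suc d) w e xs zero    = sym (⨁-false xs λ {x} _ → Bool.∧-zeroʳ (w x))
shift-gen (suc d) w e xs (suc n) = shift-gen d w e xs n

gen-⊛-gen : ∀ {A B : Set} w (e : A → ℕ) xs w′ (e′ : B → ℕ) ys →
            gen w e xs ⊛ gen w′ e′ ys ≋ λ n → ⨁ (λ x → w x ∧ gen w′ (λ y → e x + e′ y) ys n) xs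
gen-⊛-gen w e xs w′ e′ ys n = trans (gen-⊛ w e xs (gen w′ e′ ys) n) (⨁-cong xs λ {x} _ → cong (w x ∧_) (shift-gen (e x) w′ e′ ys n))

expand₂-⊕ : ∀ a c → expand₂ (a ⊕ c) ≋ expand₂ a ⊕ expand₂ c
expand₂-⊕ a c zero          = refl
expand₂-⊕ a c (suc zero)    = refl
expand₂-⊕ a c (suc (suc n)) = expand₂-⊕ (tail a) (tail c) n

expand₂-𝟎 : expand₂ 𝟎 ≋ 𝟎
expand₂-𝟎 zero          = refl
expand₂-𝟎 (suc zero)    = refl
expand₂-𝟎 (suc (suc n)) = expand₂-𝟎 n

expand₂-mono : ∀ e → expand₂ (mono e) ≋ mono (e + e)
expand₂-mono zero    zero          = refl
expand₂-mono zero    (suc zero)    = refl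
expand₂-mono zero    (suc (suc n)) = expand₂-𝟎 n
expand₂-mono (suc e) zero          = refl
expand₂-mono (suc e) (suc zero)    rewrite +-suc e e = refl
expand₂-mono (suc e) (suc (suc n)) rewrite +-suc e e = expand₂-mono e n

expand₂-scale : ∀ u a → expand₂ (λ m → u ∧ a m) ≋ λ n → u ∧ expand₂ a n
expand₂-scale u a zero          = refl
expand₂-scale u a (suc zero)    = sym (Bool.∧-zeroʳ u)
expand₂-scale u a (suc (suc n)) = expand₂-scale u (tail a) n

expand₂-gen : ∀ {A : Set} w (e : A → ℕ) xs → expand₂ (gen w e xs) ≋ gen w (λ x → e x + e x) xs
expand₂-gen w e []       n = expand₂-𝟎 n
expand₂-gen w e (x ∷ xs) n = trans (expand₂-⊕ (λ m → w x ∧ mono (e x) m) (gen w e xs) n)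
  (cong₂ _xor_ (trans (expand₂-scale (w x) (mono (e x)) n) (cong (w x ∧_) (expand₂-mono (e x) n))) (expand₂-gen w e xs n))

true₁ : ∀ {A : Set} → A → Bool
true₁ _ = true

-- By Frobenius η² is η(q²), with exponents `pent t + pent t`, so the cube needs two summation
-- indices instead of three.
η-cube : ∀ n → (η ⊛ (η ⊛ η)) n ≡ ⨁ (λ (s , t) → mono (pent s + (pent t + pent t)) n) (cartesianProduct (ints n) (ints n))
η-cube n = begin
  (η ⊛ (η ⊛ η)) n                                               ≡⟨ ⊛-cong[] n η≋E η²≋E² n ≤-refl ⟩
  (E ⊛ gen true₁ (λ t → pent t + pent t) (ints n)) n            ≡⟨ gen-⊛-gen true₁ pent (ints n) true₁ (λ t → pent t + pent t) (ints n) n ⟩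
  ⨁ (λ s → ⨁ (λ t → mono (pent s + (pent t + pent t)) n) (ints n)) (ints n) ≡⟨ sym (⨁-× _ (ints n) (ints n)) ⟩
  ⨁ (λ (s , t) → mono (pent s + (pent t + pent t)) n) (cartesianProduct (ints n) (ints n)) ∎
  where
  open ≡-Reasoning
  E = gen true₁ pent (ints n)
  η≋E : η ≋[ n ] E
  η≋E m m≤n = sym (⨁-ints-stable ∣i∣≤pent m≤n)
  η²≋E² : η ⊛ η ≋[ n ] gen true₁ (λ t → pent t + pent t) (ints n)
  η²≋E² m m≤n = trans (⊛-cong[] n η≋E η≋E m m≤n) (trans (⊛-square E m) (expand₂-gen true₁ pent (ints n) m))

⁺tri : ∀ n → ⁺ tri n ℤ.* ⁺ 2 ≡ ⁺ n ℤ.* (⁺ n ℤ.+ ⁺ 1)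
⁺tri zero    = refl
⁺tri (suc n) = begin
  ⁺ (tri n + suc n) ℤ.* ⁺ 2                 ≡⟨ cong (ℤ._* ⁺ 2) (trans (ℤ.pos-+ (tri n) (suc n)) (cong (ℤ._+_ (⁺ tri n)) (ℤ.pos-+ 1 n))) ⟩
  (⁺ tri n ℤ.+ (⁺ 1 ℤ.+ ⁺ n)) ℤ.* ⁺ 2       ≡⟨ distribute (⁺ tri n) (⁺ n) ⟩
  ⁺ tri n ℤ.* ⁺ 2 ℤ.+ (⁺ 2 ℤ.+ ⁺ 2 ℤ.* ⁺ n) ≡⟨ cong (ℤ._+ (⁺ 2 ℤ.+ ⁺ 2 ℤ.* ⁺ n)) (⁺tri n) ⟩
  ⁺ n ℤ.* (⁺ n ℤ.+ ⁺ 1) ℤ.+ (⁺ 2 ℤ.+ ⁺ 2 ℤ.* ⁺ n) ≡⟨ factor (⁺ n) ⟩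
  (⁺ 1 ℤ.+ ⁺ n) ℤ.* (⁺ 1 ℤ.+ ⁺ n ℤ.+ ⁺ 1)   ≡⟨ cong (λ z → z ℤ.* (z ℤ.+ ⁺ 1)) (sym (ℤ.pos-+ 1 n)) ⟩
  ⁺ suc n ℤ.* (⁺ suc n ℤ.+ ⁺ 1)             ∎
  where
  open ≡-Reasoning
  distribute : ∀ t n → (t ℤ.+ (⁺ 1 ℤ.+ n)) ℤ.* ⁺ 2 ≡ t ℤ.* ⁺ 2 ℤ.+ (⁺ 2 ℤ.+ ⁺ 2 ℤ.* n)
  distribute = ℤ.solve-∀
  factor : ∀ n → n ℤ.* (n ℤ.+ ⁺ 1) ℤ.+ (⁺ 2 ℤ.+ ⁺ 2 ℤ.* n) ≡ (⁺ 1 ℤ.+ n) ℤ.* (⁺ 1 ℤ.+ n ℤ.+ ⁺ 1)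
  factor = ℤ.solve-∀

⁺triℤ : ∀ i → ⁺ triℤ i ℤ.* ⁺ 2 ≡ i ℤ.* (i ℤ.+ ⁺ 1)
⁺triℤ (⁺ n)      = ⁺tri n
⁺triℤ (-[1+ n ]) = trans (⁺tri n) (reflect (⁺ n))
  where
  reflect : ∀ n → n ℤ.* (n ℤ.+ ⁺ 1) ≡ ℤ.- (⁺ 1 ℤ.+ n) ℤ.* (ℤ.- (⁺ 1 ℤ.+ n) ℤ.+ ⁺ 1)
  reflect = ℤ.solve-∀

⁺pent : ∀ i → ⁺ pent i ℤ.* ⁺ 2 ≡ i ℤ.* (⁺ 3 ℤ.* i ℤ.+ ⁺ 1)
⁺pent (⁺ n) = begin
  ⁺ (n * n + tri n) ℤ.* ⁺ 2                       ≡⟨ cong (ℤ._* ⁺ 2) (trans (ℤ.pos-+ (n * n) (tri n)) (cong (ℤ._+ ⁺ tri n) (ℤ.pos-* n n))) ⟩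
  (⁺ n ℤ.* ⁺ n ℤ.+ ⁺ tri n) ℤ.* ⁺ 2               ≡⟨ ℤ.*-distribʳ-+ (⁺ 2) (⁺ n ℤ.* ⁺ n) (⁺ tri n) ⟩
  ⁺ n ℤ.* ⁺ n ℤ.* ⁺ 2 ℤ.+ ⁺ tri n ℤ.* ⁺ 2         ≡⟨ cong (ℤ._+_ (⁺ n ℤ.* ⁺ n ℤ.* ⁺ 2)) (⁺tri n) ⟩
  ⁺ n ℤ.* ⁺ n ℤ.* ⁺ 2 ℤ.+ ⁺ n ℤ.* (⁺ n ℤ.+ ⁺ 1)   ≡⟨ collect (⁺ n) ⟩
  ⁺ n ℤ.* (⁺ 3 ℤ.* ⁺ n ℤ.+ ⁺ 1)                   ∎
  where
  open ≡-Reasoning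
  collect : ∀ n → n ℤ.* n ℤ.* ⁺ 2 ℤ.+ n ℤ.* (n ℤ.+ ⁺ 1) ≡ n ℤ.* (⁺ 3 ℤ.* n ℤ.+ ⁺ 1)
  collect = ℤ.solve-∀
⁺pent (-[1+ n ]) = begin
  ⁺ (suc n * suc n + tri n) ℤ.* ⁺ 2               ≡⟨ cong (ℤ._* ⁺ 2) (trans (ℤ.pos-+ (suc n * suc n) (tri n)) (cong (ℤ._+ ⁺ tri n) (ℤ.pos-* (suc n) (suc n)))) ⟩
  (⁺ suc n ℤ.* ⁺ suc n ℤ.+ ⁺ tri n) ℤ.* ⁺ 2       ≡⟨ ℤ.*-distribʳ-+ (⁺ 2) (⁺ suc n ℤ.* ⁺ suc n) (⁺ tri n) ⟩
  ⁺ suc n ℤ.* ⁺ suc n ℤ.* ⁺ 2 ℤ.+ ⁺ tri n ℤ.* ⁺ 2 ≡⟨ cong₂ (λ u v → u ℤ.* u ℤ.* ⁺ 2 ℤ.+ v) (ℤ.pos-+ 1 n) (⁺tri n) ⟩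
  (⁺ 1 ℤ.+ ⁺ n) ℤ.* (⁺ 1 ℤ.+ ⁺ n) ℤ.* ⁺ 2 ℤ.+ ⁺ n ℤ.* (⁺ n ℤ.+ ⁺ 1) ≡⟨ collect (⁺ n) ⟩
  ℤ.- (⁺ 1 ℤ.+ ⁺ n) ℤ.* (⁺ 3 ℤ.* ℤ.- (⁺ 1 ℤ.+ ⁺ n) ℤ.+ ⁺ 1) ∎
  where
  open ≡-Reasoning
  collect : ∀ n → (⁺ 1 ℤ.+ n) ℤ.* (⁺ 1 ℤ.+ n) ℤ.* ⁺ 2 ℤ.+ n ℤ.* (n ℤ.+ ⁺ 1) ≡ ℤ.- (⁺ 1 ℤ.+ n) ℤ.* (⁺ 3 ℤ.* ℤ.- (⁺ 1 ℤ.+ n) ℤ.+ ⁺ 1)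
  collect = ℤ.solve-∀

-- x + y √-2 = (1 + √-2) (u + v √-2) for x = 6 s + 1, y = 6 t + 1 and the
-- index changes u = 2 w + 1, v = 2 m.
lattice : ∀ s t → abs (t ℤ.- s) * abs (t ℤ.- s) + triℤ (t ℤ.+ t ℤ.+ s) ≡ pent s + (pent t + pent t)
lattice s t = ℤ.+-injective (ℤ.*-cancelʳ-≡ _ _ (⁺ 2) (begin
  ⁺ (abs m * abs m + triℤ w) ℤ.* ⁺ 2                     ≡⟨ cong (ℤ._* ⁺ 2) (trans (ℤ.pos-+ (abs m * abs m) (triℤ w)) (cong (ℤ._+ ⁺ triℤ w) (sym (i*i≡+∣i∣² m)))) ⟩
  (m ℤ.* m ℤ.+ ⁺ triℤ w) ℤ.* ⁺ 2                         ≡⟨ ℤ.*-distribʳ-+ (⁺ 2) (m ℤ.* m) (⁺ triℤ w) ⟩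
  m ℤ.* m ℤ.* ⁺ 2 ℤ.+ ⁺ triℤ w ℤ.* ⁺ 2                   ≡⟨ cong (ℤ._+_ (m ℤ.* m ℤ.* ⁺ 2)) (⁺triℤ w) ⟩
  m ℤ.* m ℤ.* ⁺ 2 ℤ.+ w ℤ.* (w ℤ.+ ⁺ 1)                  ≡⟨ identity s t ⟩
  s ℤ.* (⁺ 3 ℤ.* s ℤ.+ ⁺ 1) ℤ.+ (t ℤ.* (⁺ 3 ℤ.* t ℤ.+ ⁺ 1) ℤ.+ t ℤ.* (⁺ 3 ℤ.* t ℤ.+ ⁺ 1)) ≡⟨ sym (cong₂ (λ u v → u ℤ.+ (v ℤ.+ v)) (⁺pent s) (⁺pent t)) ⟩
  ⁺ pent s ℤ.* ⁺ 2 ℤ.+ (⁺ pent t ℤ.* ⁺ 2 ℤ.+ ⁺ pent t ℤ.* ⁺ 2) ≡⟨ collect (⁺ pent s) (⁺ pent t) ⟩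
  (⁺ pent s ℤ.+ (⁺ pent t ℤ.+ ⁺ pent t)) ℤ.* ⁺ 2         ≡⟨ cong (ℤ._* ⁺ 2) (sym (trans (ℤ.pos-+ (pent s) (pent t + pent t)) (cong (ℤ._+_ (⁺ pent s)) (ℤ.pos-+ (pent t) (pent t))))) ⟩
  ⁺ (pent s + (pent t + pent t)) ℤ.* ⁺ 2                 ∎))
  where
  open ≡-Reasoning
  m = t ℤ.- s
  w = t ℤ.+ t ℤ.+ s
  identity : ∀ s t → (t ℤ.- s) ℤ.* (t ℤ.- s) ℤ.* ⁺ 2 ℤ.+ (t ℤ.+ t ℤ.+ s) ℤ.* (t ℤ.+ t ℤ.+ s ℤ.+ ⁺ 1) ≡
    s ℤ.* (⁺ 3 ℤ.* s ℤ.+ ⁺ 1) ℤ.+ (t ℤ.* (⁺ 3 ℤ.* t ℤ.+ ⁺ 1) ℤ.+ t ℤ.* (⁺ 3 ℤ.* t ℤ.+ ⁺ 1))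
  identity = ℤ.solve-∀
  collect : ∀ u v → u ℤ.* ⁺ 2 ℤ.+ (v ℤ.* ⁺ 2 ℤ.+ v ℤ.* ⁺ 2) ≡ (u ℤ.+ (v ℤ.+ v)) ℤ.* ⁺ 2
  collect = ℤ.solve-∀

div₃ : ℤ → Bool
div₃ z = does (3 ∣? abs z)

div₃-periodic : ∀ r q → div₃ (r ℤ.+ q ℤ.* ⁺ 3) ≡ div₃ r
div₃-periodic r q = does-⇔ (mk⇔ to from) (3 ∣? abs (r ℤ.+ q ℤ.* ⁺ 3)) (3 ∣? abs r)
  where
  cancel : ∀ r t → r ≡ (r ℤ.+ t) ℤ.- t
  cancel = ℤ.solve-∀
  from : 3 ∣ abs r → 3 ∣ abs (r ℤ.+ q ℤ.* ⁺ 3)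
  from d = Signed.∣⇒∣ᵤ (Signed.∣m∣n⇒∣m+n {m = r} (Signed.∣ᵤ⇒∣ {⁺ 3} d) (Signed.divides q refl))
  to : 3 ∣ abs (r ℤ.+ q ℤ.* ⁺ 3) → 3 ∣ abs r
  to d = subst (λ z → 3 ∣ abs z) (sym (cancel r (q ℤ.* ⁺ 3)))
           (Signed.∣⇒∣ᵤ (Signed.∣m∣n⇒∣m-n (Signed.∣ᵤ⇒∣ {⁺ 3} {r ℤ.+ q ℤ.* ⁺ 3} d) (Signed.divides q refl)))

mod₃ : ∀ z → ∃[ r ] ∃[ q ] (r < 3 × z ≡ ⁺ r ℤ.+ q ℤ.* ⁺ 3)
mod₃ z = z ℤ.%ℕ 3 , z ℤ./ℕ 3 , ℤ.n%ℕd<d z 3 , ℤ.a≡a%ℕn+[a/ℕn]*n z 3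

div₃-at : ∀ {z} r q → z ≡ r ℤ.+ q ℤ.* ⁺ 3 → div₃ z ≡ div₃ r
div₃-at r q refl = div₃-periodic r q

-- True unless `j` is 1 modulo 3, in other words exactly when 3 divides `tri j`.
weight : ℕ → Bool
weight j = not (div₃ (⁺ j ℤ.+ ⁺ 2))

-- The indices j and -1 - j share a triangular number. If m is 2 or j is 1 modulo 3, then 3 divides
-- both or neither of m + j and m - 1 - j, and the pair cancels; otherwise it divides exactly one of
-- them. Thus the coupled condition on m and w becomes a product of separate conditions.
fold-w : ∀ m j → div₃ (m ℤ.+ ⁺ j) xor div₃ (m ℤ.+ -[1+ j ]) ≡ not (div₃ (m ℤ.+ ⁺ 1)) ∧ weight j
fold-w m j with mod₃ m | mod₃ (⁺ j)
... | r , q , r<3 , refl | r′ , q′ , r′<3 , eq′ = trans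
    (cong₂ _xor_ (div₃-at (⁺ r ℤ.+ ⁺ r′) (q ℤ.+ q′) (trans (cong (ℤ._+_ m) eq′) (sum₁ (⁺ r) q (⁺ r′) q′)))
                 (div₃-at (⁺ r ℤ.- (⁺ 1 ℤ.+ ⁺ r′)) (q ℤ.- q′) (trans (cong (λ z → m ℤ.- (⁺ 1 ℤ.+ z)) eq′) (sum₂ (⁺ r) q (⁺ r′) q′))))
    (trans (table r r<3 r′ r′<3) (sym (cong₂ (λ u v → not u ∧ not v)
       (div₃-at (⁺ r ℤ.+ ⁺ 1) q (sum₃ (⁺ r) q (⁺ 1))) (div₃-at (⁺ r′ ℤ.+ ⁺ 2) q′ (trans (cong (ℤ._+ ⁺ 2) eq′) (sum₃ (⁺ r′) q′ (⁺ 2)))))))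
  where
  sum₁ : ∀ r q r′ q′ → (r ℤ.+ q ℤ.* ⁺ 3) ℤ.+ (r′ ℤ.+ q′ ℤ.* ⁺ 3) ≡ (r ℤ.+ r′) ℤ.+ (q ℤ.+ q′) ℤ.* ⁺ 3
  sum₁ = ℤ.solve-∀
  sum₂ : ∀ r q r′ q′ → (r ℤ.+ q ℤ.* ⁺ 3) ℤ.- (⁺ 1 ℤ.+ (r′ ℤ.+ q′ ℤ.* ⁺ 3)) ≡ (r ℤ.- (⁺ 1 ℤ.+ r′)) ℤ.+ (q ℤ.- q′) ℤ.* ⁺ 3
  sum₂ = ℤ.solve-∀
  sum₃ : ∀ r q u → (r ℤ.+ q ℤ.* ⁺ 3) ℤ.+ u ≡ (r ℤ.+ u) ℤ.+ q ℤ.* ⁺ 3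
  sum₃ = ℤ.solve-∀
  table : ∀ r → r < 3 → ∀ r′ → r′ < 3 → div₃ (⁺ r ℤ.+ ⁺ r′) xor div₃ (⁺ r ℤ.- (⁺ 1 ℤ.+ ⁺ r′)) ≡ not (div₃ (⁺ r ℤ.+ ⁺ 1)) ∧ not (div₃ (⁺ r′ ℤ.+ ⁺ 2))
  table 0 _ 0 _ = refl
  table 0 _ 1 _ = refl
  table 0 _ 2 _ = refl
  table 1 _ 0 _ = refl
  table 1 _ 1 _ = refl
  table 1 _ 2 _ = refl
  table 2 _ 0 _ = refl
  table 2 _ 1 _ = refl
  table 2 _ 2 _ = refl
  table (suc (suc (suc _))) (s≤s (s≤s (s≤s ()))) _ _
  table _ _ (suc (suc (suc _))) (s≤s (s≤s (s≤s ())))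

-- Origin of the weight of θ: if 3 ∤ z, then exactly one of z and -z is 2 modulo 3, and if 3 ∣ z,
-- then neither is.
fold-m : ∀ z → not (div₃ (z ℤ.+ ⁺ 1)) xor not (div₃ (ℤ.- z ℤ.+ ⁺ 1)) ≡ not (div₃ z)
fold-m z with mod₃ z
... | r , q , r<3 , refl = trans
    (cong₂ (λ u v → not u xor not v) (div₃-at (⁺ r ℤ.+ ⁺ 1) q (sum₁ (⁺ r) q)) (div₃-at (ℤ.- (⁺ r) ℤ.+ ⁺ 1) (ℤ.- q) (sum₂ (⁺ r) q)))
    (trans (table r r<3) (cong not (sym (div₃-at (⁺ r) q refl))))
  where
  sum₁ : ∀ r q → (r ℤ.+ q ℤ.* ⁺ 3) ℤ.+ ⁺ 1 ≡ (r ℤ.+ ⁺ 1) ℤ.+ q ℤ.* ⁺ 3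
  sum₁ = ℤ.solve-∀
  sum₂ : ∀ r q → ℤ.- (r ℤ.+ q ℤ.* ⁺ 3) ℤ.+ ⁺ 1 ≡ (ℤ.- r ℤ.+ ⁺ 1) ℤ.+ (ℤ.- q) ℤ.* ⁺ 3
  sum₂ = ℤ.solve-∀
  table : ∀ r → r < 3 → not (div₃ (⁺ r ℤ.+ ⁺ 1)) xor not (div₃ (ℤ.- (⁺ r) ℤ.+ ⁺ 1)) ≡ not (div₃ (⁺ r))
  table 0 _ = refl
  table 1 _ = refl
  table 2 _ = refl
  table (suc (suc (suc _))) (s≤s (s≤s (s≤s ())))

θ-weight : ℕ → Bool
θ-weight zero    = true
θ-weight (suc m) = not (does (3 ∣? suc m))

θ : Series
θ n = gen θ-weight (λ m → m * m) (downFrom (suc n)) n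

m≤m*m : ∀ m → m ≤ m * m
m≤m*m zero    = z≤n
m≤m*m (suc m) = m≤m*n (suc m) (suc m)

gen-downFrom-stable : ∀ w (e : ℕ → ℕ) → (∀ k → k ≤ e k) → ∀ {m n} → m ≤ n → gen w e (downFrom (suc n)) m ≡ gen w e (downFrom (suc m)) m
gen-downFrom-stable w e h {m} {zero}  z≤n = refl
gen-downFrom-stable w e h {m} {suc n} m≤n = go (m ≟ suc n)
  where
  go : Dec (m ≡ suc n) → gen w e (downFrom (suc (suc n))) m ≡ gen w e (downFrom (suc m)) m
  go (yes refl) = refl
  go (no m≢) = trans (cong (_xor gen w e (downFrom (suc n)) m) (trans (cong (w (suc n) ∧_) (mono-false {e (suc n)} λ eq → <⇒≱ (≤∧≢⇒< m≤n m≢) (≤-trans (h (suc n)) (≤-reflexive eq)))) (Bool.∧-zeroʳ (w (suc n)))))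
    (gen-downFrom-stable w e h (s≤s⁻¹ (≤∧≢⇒< m≤n m≢)))

tri*2 : ∀ n → tri n * 2 ≡ n * suc n
tri*2 zero    = refl
tri*2 (suc n) = trans (*-distribʳ-+ 2 (tri n) (suc n)) (trans (cong (_+ suc n * 2) (tri*2 n)) (factor n))
  where
  factor : ∀ n → n * suc n + suc n * 2 ≡ suc n * suc (suc n)
  factor = solve-∀

tri-3* : ∀ s → tri (s * 3) ≡ pent (⁺ s) * 3
tri-3* s = *-cancelʳ-≡ _ _ 2 (begin
  tri (s * 3) * 2              ≡⟨ tri*2 (s * 3) ⟩
  s * 3 * suc (s * 3)          ≡⟨ expand s ⟩
  s * s * 6 + s * suc s * 3    ≡⟨ cong (λ t → s * s * 6 + t * 3) (sym (tri*2 s)) ⟩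
  s * s * 6 + tri s * 2 * 3    ≡⟨ factor s (tri s) ⟩
  (s * s + tri s) * 3 * 2      ∎)
  where
  open ≡-Reasoning
  expand : ∀ s → s * 3 * suc (s * 3) ≡ s * s * 6 + s * suc s * 3
  expand = solve-∀
  factor : ∀ s t → s * s * 6 + t * 2 * 3 ≡ (s * s + t) * 3 * 2
  factor = solve-∀

tri-2+3* : ∀ s → tri (2 + s * 3) ≡ pent (-[1+ s ]) * 3
tri-2+3* s = *-cancelʳ-≡ _ _ 2 (begin
  tri (2 + s * 3) * 2                  ≡⟨ tri*2 (2 + s * 3) ⟩
  (2 + s * 3) * suc (2 + s * 3)        ≡⟨ expand s ⟩
  suc s * suc s * 6 + s * suc s * 3    ≡⟨ cong (λ t → suc s * suc s * 6 + t * 3) (sym (tri*2 s)) ⟩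
  suc s * suc s * 6 + tri s * 2 * 3    ≡⟨ factor (suc s) (tri s) ⟩
  (suc s * suc s + tri s) * 3 * 2      ∎)
  where
  open ≡-Reasoning
  expand : ∀ s → (2 + s * 3) * suc (2 + s * 3) ≡ suc s * suc s * 6 + s * suc s * 3
  expand = solve-∀
  factor : ∀ s t → s * s * 6 + t * 2 * 3 ≡ (s * s + t) * 3 * 2
  factor = solve-∀

-- 3 i for i ≥ 0 and -3 i - 1 for i < 0. These are the natural numbers whose triangular number is
-- divisible by 3, each occurring once.
pronicIndex : ℤ → ℕ
pronicIndex (⁺ s)      = s * 3
pronicIndex (-[1+ s ]) = 2 + s * 3

tri-pronicIndex : ∀ i → tri (pronicIndex i) ≡ pent i * 3
tri-pronicIndex (⁺ s)      = tri-3* s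
tri-pronicIndex (-[1+ s ]) = tri-2+3* s

pronicIndex-injective : ∀ {i j} → pronicIndex i ≡ pronicIndex j → i ≡ j
pronicIndex-injective {⁺ s}      {⁺ t}      eq = cong ⁺_ (*-cancelʳ-≡ s t 3 eq)
pronicIndex-injective { -[1+ s ]} { -[1+ t ]} eq = cong -[1+_] (*-cancelʳ-≡ s t 3 (+-cancelˡ-≡ 2 (s * 3) (t * 3) eq))
pronicIndex-injective {⁺ s}      { -[1+ t ]} eq with trans (sym (m*n%n≡0 s 3)) (trans (cong (_% 3) eq) ([m+kn]%n≡m%n 2 t 3))
... | ()
pronicIndex-injective { -[1+ s ]} {⁺ t}      eq with trans (sym (m*n%n≡0 t 3)) (trans (cong (_% 3) (sym eq)) ([m+kn]%n≡m%n 2 s 3))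
... | ()

pronicIndex-onto : ∀ j → ¬ 3 ∣ j + 2 → ∃[ i ] pronicIndex i ≡ j
pronicIndex-onto j ∤d = go (j % 3) (m%n<n j 3) (m≡m%n+[m/n]*n j 3)
  where
  go : ∀ r → r < 3 → j ≡ r + j / 3 * 3 → ∃[ i ] pronicIndex i ≡ j
  go 0 _ eq = ⁺ (j / 3) , sym eq
  go 1 _ eq = ⊥-elim (∤d (divides (suc (j / 3)) (trans (cong (_+ 2) eq) (shuffle (j / 3)))))
    where
    shuffle : ∀ q → 1 + q * 3 + 2 ≡ suc q * 3
    shuffle = solve-∀
  go 2 _ eq = -[1+ j / 3 ] , sym eq
  go (suc (suc (suc _))) (s≤s (s≤s (s≤s ()))) _

pronicIndex-weight : ∀ i → ¬ 3 ∣ pronicIndex i + 2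
pronicIndex-weight (⁺ s) d with ∣m+n∣m⇒∣n d (n∣m*n s)
... | divides zero ()
... | divides (suc _) ()
pronicIndex-weight (-[1+ s ]) d with ∣m+n∣m⇒∣n (subst (3 ∣_) (shuffle s) d) (n∣m*n (suc s))
  where
  shuffle : ∀ s → 2 + s * 3 + 2 ≡ suc s * 3 + 1
  shuffle = solve-∀
... | divides zero ()
... | divides (suc _) ()

-- This brings η(q³) into the form in which `fold-w` produces it, as a sum over triangular numbers
-- divisible by 3.
ηq³-tri : ∀ {k n} → k ≤ n → ηq³ k ≡ gen weight tri (downFrom (suc n)) k
ηq³-tri {k} {n} k≤n = ⨁-bijection (λ i → pent i * 3 ≟ k) (λ j → ¬? (3 ∣? (j + 2)) ×-dec (tri j ≟ k))
  pronicIndex pronicIndex-injective (ints-unique k) (Unique.downFrom⁺ (suc n)) into onto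
  where
  into : ∀ {i} → i ∈ ints k → pent i * 3 ≡ k → pronicIndex i ∈ downFrom (suc n) × (¬ 3 ∣ pronicIndex i + 2) × tri (pronicIndex i) ≡ k
  into {i} _ eq = ∈-downFrom⁺ (s≤s (≤-trans (n≤tri (pronicIndex i)) (≤-trans (≤-reflexive (trans (tri-pronicIndex i) eq)) k≤n)))
                , pronicIndex-weight i , trans (tri-pronicIndex i) eq
  onto : ∀ {j} → j ∈ downFrom (suc n) → (¬ 3 ∣ j + 2) × tri j ≡ k → ∃[ i ] (i ∈ ints k × pent i * 3 ≡ k × pronicIndex i ≡ j)
  onto {j} _ (∤d , eq) with pronicIndex-onto j ∤d
  ... | i , refl = let eq′ = trans (sym (tri-pronicIndex i)) eq in
        i , ∈-ints i (≤-trans (∣i∣≤pent i) (≤-trans (m≤m*n (pent i) 3) (≤-reflexive eq′))) , eq′ , refl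

-- The substitution `φ` has determinant 3 up to sign and maps onto the sublattice 3 ∣ m + w. Pairing
-- w with -1 - w and then m with -m turns this condition into independent weights on the two
-- indices, and the double sum factors.
η-cube≋ : η ⊛ (η ⊛ η) ≋ θ ⊛ ηq³
η-cube≋ n = begin
  (η ⊛ (η ⊛ η)) n
    ≡⟨ η-cube n ⟩
  ⨁ (λ (s , t) → mono (pent s + (pent t + pent t)) n) (cartesianProduct (ints n) (ints n))
    ≡⟨ ⨁-bijection (λ (s , t) → pent s + (pent t + pent t) ≟ n) Q? φ φ-injective
         (Unique.cartesianProduct⁺ (ints-unique n) (ints-unique n)) (Unique.cartesianProduct⁺ (ints-unique n) (halfInts-unique (suc n))) into onto ⟩
  ⨁ (does ∘ Q?) (cartesianProduct (ints n) (halfInts (suc n)))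
    ≡⟨ ⨁-× (does ∘ Q?) (ints n) (halfInts (suc n)) ⟩
  ⨁ (λ m → ⨁ (λ w → does (Q? (m , w))) (halfInts (suc n))) (ints n)
    ≡⟨ ⨁-cong (ints n) (λ {m} _ → inner m) ⟩
  ⨁ (λ m → not (div₃ (m ℤ.+ ⁺ 1)) ∧ G (abs m * abs m)) (ints n)
    ≡⟨ ⨁-ints _ n ⟩
  -- The index m = 0 has no partner and keeps its weight 1, whence `θ-weight zero` is `true`
  -- although 3 ∣ 0.
  G 0 xor ⨁ (λ j → (not (div₃ (⁺ suc j ℤ.+ ⁺ 1)) ∧ G (suc j * suc j)) xor (not (div₃ (-[1+ j ] ℤ.+ ⁺ 1)) ∧ G (suc j * suc j))) (downFrom n)
    ≡⟨ cong (G 0 xor_) (⨁-cong (downFrom n) λ {j} _ → trans (sym (𝔽₂.distribʳ (G (suc j * suc j)) (not (div₃ (⁺ suc j ℤ.+ ⁺ 1))) (not (div₃ (-[1+ j ] ℤ.+ ⁺ 1))))) (cong (_∧ G (suc j * suc j)) (fold-m (⁺ suc j)))) ⟩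
  G 0 xor ⨁ (λ j → θ-weight (suc j) ∧ G (suc j * suc j)) (downFrom n)
    ≡⟨ sym (⨁-downFrom-suc (λ m → θ-weight m ∧ G (m * m)) n) ⟩
  ⨁ (λ m → θ-weight m ∧ G (m * m)) (downFrom (suc n))
    ≡⟨ sym (gen-⊛-gen θ-weight (λ m → m * m) (downFrom (suc n)) weight tri (downFrom (suc n)) n) ⟩
  (gen θ-weight (λ m → m * m) (downFrom (suc n)) ⊛ gen weight tri (downFrom (suc n))) n
    ≡⟨ ⊛-cong[] n (λ m m≤n → gen-downFrom-stable θ-weight (λ m → m * m) m≤m*m m≤n) (λ k k≤n → sym (ηq³-tri k≤n)) n ≤-refl ⟩
  (θ ⊛ ηq³) n ∎
  where
  open ≡-Reasoning
  Q : ℤ × ℤ → Set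
  Q (m , w) = abs m * abs m + triℤ w ≡ n × 3 ∣ abs (m ℤ.+ w)
  Q? : ∀ z → Dec (Q z)
  Q? (m , w) = (abs m * abs m + triℤ w ≟ n) ×-dec (3 ∣? abs (m ℤ.+ w))
  φ : ℤ × ℤ → ℤ × ℤ
  φ (s , t) = t ℤ.- s , t ℤ.+ t ℤ.+ s
  recover-t : ∀ s t → (t ℤ.- s) ℤ.+ (t ℤ.+ t ℤ.+ s) ≡ t ℤ.* ⁺ 3
  recover-t = ℤ.solve-∀
  recover-s : ∀ s t → s ≡ t ℤ.- (t ℤ.- s)
  recover-s = ℤ.solve-∀
  φ-injective : ∀ {x y} → φ x ≡ φ y → x ≡ y
  φ-injective {s , t} {s′ , t′} eq with ℤ.*-cancelʳ-≡ t t′ (⁺ 3) (trans (sym (recover-t s t)) (trans (cong (λ (m , w) → m ℤ.+ w) eq) (recover-t s′ t′)))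
  ... | refl = cong (_, t) (trans (recover-s s t) (trans (cong (λ z → t ℤ.- proj₁ z) eq) (sym (recover-s s′ t))))
  into : ∀ {x} → x ∈ cartesianProduct (ints n) (ints n) → pent (proj₁ x) + (pent (proj₂ x) + pent (proj₂ x)) ≡ n →
         φ x ∈ cartesianProduct (ints n) (halfInts (suc n)) × Q (φ x)
  into {s , t} _ eq = ∈-cartesianProduct⁺ (∈-ints _ (≤-trans (m≤m*m _) (≤-trans (m≤m+n _ _) (≤-reflexive eq′))))
                                          (∈-halfInts _ (s≤s (≤-trans (m≤n+m _ _) (≤-reflexive eq′))))
                    , eq′ , divides (abs t) (trans (cong abs (recover-t s t)) (ℤ.abs-* t (⁺ 3)))
    where
    eq′ = trans (lattice s t) eq
  onto : ∀ {y} → y ∈ cartesianProduct (ints n) (halfInts (suc n)) → Q y →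
         ∃[ x ] (x ∈ cartesianProduct (ints n) (ints n) × pent (proj₁ x) + (pent (proj₂ x) + pent (proj₂ x)) ≡ n × φ x ≡ y)
  onto {m , w} _ (eq , 3∣) with Signed.∣ᵤ⇒∣ {⁺ 3} {m ℤ.+ w} 3∣
  ... | Signed.divides t m+w≡ = (t ℤ.- m , t)
      , ∈-cartesianProduct⁺ (∈-ints (t ℤ.- m) (≤-trans (∣i∣≤pent (t ℤ.- m)) (≤-trans (m≤m+n _ _) (≤-reflexive eq′))))
                            (∈-ints t (≤-trans (∣i∣≤pent t) (≤-trans (m≤m+n _ _) (≤-trans (m≤n+m _ (pent (t ℤ.- m))) (≤-reflexive eq′)))))
      , eq′ , φ≡
    where
    w≡ : ∀ m t → t ℤ.+ t ℤ.+ (t ℤ.- m) ≡ t ℤ.* ⁺ 3 ℤ.- m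
    w≡ = ℤ.solve-∀
    cancel : ∀ m w → (m ℤ.+ w) ℤ.- m ≡ w
    cancel = ℤ.solve-∀
    φ≡ : φ (t ℤ.- m , t) ≡ (m , w)
    φ≡ = cong₂ _,_ (sym (recover-s m t)) (trans (w≡ m t) (trans (cong (ℤ._- m) (sym m+w≡)) (cancel m w)))
    eq′ : pent (t ℤ.- m) + (pent t + pent t) ≡ n
    eq′ = trans (sym (lattice (t ℤ.- m) t)) (trans (cong (λ (m , w) → abs m * abs m + triℤ w) φ≡) eq)
  G : ℕ → Bool
  G k = ⨁ (λ j → weight j ∧ mono (k + tri j) n) (downFrom (suc n))
  rearrange : ∀ u c e → u ∧ (c ∧ e) ≡ c ∧ (e ∧ u)
  rearrange u c e = trans (𝔽₂.*-comm u (c ∧ e)) (𝔽₂.*-assoc c e u)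
  inner : ∀ m → ⨁ (λ w → does (Q? (m , w))) (halfInts (suc n)) ≡ not (div₃ (m ℤ.+ ⁺ 1)) ∧ G (abs m * abs m)
  inner m = trans (⨁-halfInts (λ w → does (Q? (m , w))) (suc n))
    (trans (⨁-cong (downFrom (suc n)) λ {j} _ → let u = mono (abs m * abs m + tri j) n in
              trans (sym (𝔽₂.distribˡ u (div₃ (m ℤ.+ ⁺ j)) (div₃ (m ℤ.+ -[1+ j ]))))
              (trans (cong (u ∧_) (fold-w m j)) (rearrange u (not (div₃ (m ℤ.+ ⁺ 1))) (weight j))))
           (⨁-∧ (not (div₃ (m ℤ.+ ⁺ 1))) _ (downFrom (suc n))))

-- The even part of the series of b₃

θ-weight-* : ∀ k m → 1 ≤ k → (3 ∣ k * m → 3 ∣ m) → θ-weight (k * m) ≡ θ-weight m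
θ-weight-* k       zero    _ _  = cong θ-weight (*-zeroʳ k)
θ-weight-* (suc k) (suc m) _ h = cong not (does-⇔ (mk⇔ h (∣n⇒∣m*n (suc k))) (3 ∣? (suc k * suc m)) (3 ∣? suc m))

expand₂-cong[] : ∀ {a c} N → a ≋[ N ] c → expand₂ a ≋[ N ] expand₂ c
expand₂-cong[] N       h zero          _                 = h 0 z≤n
expand₂-cong[] N       h (suc zero)    _                 = refl
expand₂-cong[] (suc N) h (suc (suc n)) (s≤s n≤N) = expand₂-cong[] N (λ m m≤N → h (suc m) (s≤s m≤N)) n (≤-trans (n≤1+n n) n≤N)

3∣2*⇒3∣ : ∀ m → 3 ∣ 2 * m → 3 ∣ m
3∣2*⇒3∣ m d with euclidsLemma 2 m (from-yes (prime? 3)) d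
... | inj₁ (divides zero ())
... | inj₁ (divides (suc _) ())
... | inj₂ d′ = d′

-- θ² is θ(q²), with exponents 2 m². A square equal to 2 n is the square of an even number 2 m, and
-- then 2 m² = n; doubling does not affect divisibility by 3.
evenPart-θ : evenPart θ ≋ θ ⊛ θ
evenPart-θ n = sym (begin
  (θ ⊛ θ) n                                                       ≡⟨ ⊛-square θ n ⟩
  expand₂ θ n                                                     ≡⟨ expand₂-cong[] n (λ m m≤n → sym (gen-downFrom-stable θ-weight (λ m → m * m) m≤m*m m≤n)) n ≤-refl ⟩
  expand₂ (gen θ-weight (λ m → m * m) (downFrom (suc n))) n       ≡⟨ expand₂-gen θ-weight (λ m → m * m) (downFrom (suc n)) n ⟩
  gen θ-weight (λ m → m * m + m * m) (downFrom (suc n)) n         ≡⟨ ⨁-bijection (λ m → T? (θ-weight m) ×-dec (m * m + m * m ≟ n)) (λ m → T? (θ-weight m) ×-dec (m * m ≟ double n))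
                                                                       (2 *_) (*-cancelˡ-≡ _ _ 2) (Unique.downFrom⁺ (suc n)) (Unique.downFrom⁺ (suc (double n))) into onto ⟩
  θ (double n)                                                    ∎)
  where
  open ≡-Reasoning
  square : ∀ m → 2 * m * (2 * m) ≡ 2 * (m * m + m * m)
  square = solve-∀
  scaled : ∀ m → m * m + m * m ≡ n → 2 * m * (2 * m) ≡ double n
  scaled m eq = trans (square m) (trans (cong (2 *_) eq) (sym (double≡2* n)))
  into : ∀ {m} → m ∈ downFrom (suc n) → T (θ-weight m) × m * m + m * m ≡ n → 2 * m ∈ downFrom (suc (double n)) × T (θ-weight (2 * m)) × 2 * m * (2 * m) ≡ double n
  into {m} _ (tw , eq) = ∈-downFrom⁺ (s≤s (≤-trans (m≤m*m (2 * m)) (≤-reflexive (scaled m eq))))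
    , subst T (sym (θ-weight-* 2 m (s≤s z≤n) (3∣2*⇒3∣ m))) tw , scaled m eq
  onto : ∀ {y} → y ∈ downFrom (suc (double n)) → T (θ-weight y) × y * y ≡ double n →
         ∃[ m ] (m ∈ downFrom (suc n) × (T (θ-weight m) × m * m + m * m ≡ n) × 2 * m ≡ y)
  onto {y} _ (tw , eq) with 2∣y
    where
    2∣y : 2 ∣ y
    2∣y with euclidsLemma y y prime[2] (subst (2 ∣_) (sym (trans eq (double≡2* n))) (m∣m*n n))
    ... | inj₁ d = d
    ... | inj₂ d = d
  ... | divides m refl = m , ∈-downFrom⁺ (s≤s (≤-trans (m≤m*m m) (≤-trans (m≤m+n _ _) (≤-reflexive eq′))))
      , (subst T (trans (cong θ-weight (*-comm m 2)) (θ-weight-* 2 m (s≤s z≤n) (3∣2*⇒3∣ m))) tw , eq′) , *-comm 2 m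
    where
    square′ : ∀ m → 2 * (m * m + m * m) ≡ m * 2 * (m * 2)
    square′ = solve-∀
    eq′ : m * m + m * m ≡ n
    eq′ = *-cancelˡ-≡ (m * m + m * m) n 2 (trans (square′ m) (trans eq (double≡2* n)))

evenPart-B₃ : evenPart B₃ ≋ θ ⊛ η
evenPart-B₃ = ⊛-cancelˡ θ refl (begin
  θ ⊛ evenPart B₃          ≈⟨ 𝕊.*-comm θ (evenPart B₃) ⟩
  evenPart B₃ ⊛ θ          ≈⟨ 𝕊.sym (evenPart-⊛-square B₃ θ) ⟩
  evenPart (B₃ ⊛ (θ ⊛ θ))  ≈⟨ (λ n → B₃θ² (double n)) ⟩
  evenPart (θ ⊛ (η ⊛ η))   ≈⟨ evenPart-⊛-square θ η ⟩
  evenPart θ ⊛ η           ≈⟨ 𝕊.*-congʳ {η} evenPart-θ ⟩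
  (θ ⊛ θ) ⊛ η              ≈⟨ 𝕊.*-assoc θ θ η ⟩
  θ ⊛ (θ ⊛ η)              ∎)
  where
  open import Relation.Binary.Reasoning.Setoid 𝕊.setoid
  η²≋θB₃ : η ⊛ η ≋ θ ⊛ B₃
  η²≋θB₃ = ⊛-cancelˡ η refl (begin
    η ⊛ (η ⊛ η)    ≈⟨ η-cube≋ ⟩
    θ ⊛ ηq³         ≈⟨ 𝕊.*-congˡ {θ} (𝕊.sym B₃⊛η≋ηq³) ⟩
    θ ⊛ (B₃ ⊛ η)   ≈⟨ 𝕊.sym (𝕊.*-assoc θ B₃ η) ⟩
    (θ ⊛ B₃) ⊛ η   ≈⟨ 𝕊.*-comm (θ ⊛ B₃) η ⟩
    η ⊛ (θ ⊛ B₃)   ∎)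
  B₃θ² : B₃ ⊛ (θ ⊛ θ) ≋ θ ⊛ (η ⊛ η)
  B₃θ² = begin
    B₃ ⊛ (θ ⊛ θ)   ≈⟨ 𝕊.*-comm B₃ (θ ⊛ θ) ⟩
    (θ ⊛ θ) ⊛ B₃   ≈⟨ 𝕊.*-assoc θ θ B₃ ⟩
    θ ⊛ (θ ⊛ B₃)   ≈⟨ 𝕊.*-congˡ {θ} (𝕊.sym η²≋θB₃) ⟩
    θ ⊛ (η ⊛ η)    ∎

-- The coefficients of η and θ in terms of squares

squareIndex : ℤ → ℕ
squareIndex (⁺ s)      = 1 + s * 6
squareIndex (-[1+ s ]) = 5 + s * 6

squareIndex² : ∀ i → squareIndex i * squareIndex i ≡ 24 * pent i + 1
squareIndex² (⁺ s) = trans (expand s) (trans (cong (λ t → 24 * (s * s) + 12 * t + 1) (sym (tri*2 s))) (factor s (tri s)))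
  where
  expand : ∀ s → (1 + s * 6) * (1 + s * 6) ≡ 24 * (s * s) + 12 * (s * suc s) + 1
  expand = solve-∀
  factor : ∀ s t → 24 * (s * s) + 12 * (t * 2) + 1 ≡ 24 * (s * s + t) + 1
  factor = solve-∀
squareIndex² (-[1+ s ]) = trans (expand s) (trans (cong (λ t → 24 * (suc s * suc s) + 12 * t + 1) (sym (tri*2 s))) (factor (suc s) (tri s)))
  where
  expand : ∀ s → (5 + s * 6) * (5 + s * 6) ≡ 24 * (suc s * suc s) + 12 * (s * suc s) + 1
  expand = solve-∀
  factor : ∀ s t → 24 * (s * s) + 12 * (t * 2) + 1 ≡ 24 * (s * s + t) + 1
  factor = solve-∀

squareIndex-injective : ∀ {i j} → squareIndex i ≡ squareIndex j → i ≡ j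
squareIndex-injective {⁺ s}       {⁺ t}       eq = cong ⁺_ (*-cancelʳ-≡ s t 6 (+-cancelˡ-≡ 1 (s * 6) (t * 6) eq))
squareIndex-injective { -[1+ s ]} { -[1+ t ]} eq = cong -[1+_] (*-cancelʳ-≡ s t 6 (+-cancelˡ-≡ 5 (s * 6) (t * 6) eq))
squareIndex-injective {⁺ s}       { -[1+ t ]} eq with trans (sym ([m+kn]%n≡m%n 1 s 6)) (trans (cong (_% 6) eq) ([m+kn]%n≡m%n 5 t 6))
... | ()
squareIndex-injective { -[1+ s ]} {⁺ t}       eq with trans (sym ([m+kn]%n≡m%n 5 s 6)) (trans (cong (_% 6) eq) ([m+kn]%n≡m%n 1 t 6))
... | ()

squareIndex-onto : ∀ x n → x * x ≡ 24 * n + 1 → ∃[ i ] squareIndex i ≡ x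
squareIndex-onto x n eq = go (x % 6) (m%n<n x 6) (m≡m%n+[m/n]*n x 6) square%6
  where
  square%6 : (x % 6 * (x % 6)) % 6 ≡ 1
  square%6 = trans (sym (%-distribˡ-* x x 6)) (trans (cong (_% 6) (trans eq (shuffle n))) ([m+kn]%n≡m%n 1 (4 * n) 6))
    where
    shuffle : ∀ n → 24 * n + 1 ≡ 1 + 4 * n * 6
    shuffle = solve-∀
  go : ∀ r → r < 6 → x ≡ r + x / 6 * 6 → (r * r) % 6 ≡ 1 → ∃[ i ] squareIndex i ≡ x
  go 0 _ _ ()
  go 1 _ eq _ = ⁺ (x / 6) , sym eq
  go 2 _ _ ()
  go 3 _ _ ()
  go 4 _ _ ()
  go 5 _ eq _ = -[1+ x / 6 ] , sym eq
  go (suc (suc (suc (suc (suc (suc _)))))) (s≤s (s≤s (s≤s (s≤s (s≤s (s≤s ()))))))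

squares : ℕ → Bool
squares N = ⨁ (λ x → mono (x * x) N) (downFrom (suc N))

-- From 24 (pent i) + 1 = (6 i + 1)²: a root of 24 n + 1 is 1 or 5 modulo 6, hence |6 i + 1| for a
-- unique integer i. `N` is given up to an equation so that multiples by p² can be inserted
-- directly.
η-squares : ∀ n {N} → N ≡ 24 * n + 1 → η n ≡ squares N
η-squares n {N} N≡ = ⨁-bijection (λ i → pent i ≟ n) (λ x → x * x ≟ N) squareIndex squareIndex-injective
  (ints-unique n) (Unique.downFrom⁺ (suc N)) into onto
  where
  into : ∀ {i} → i ∈ ints n → pent i ≡ n → squareIndex i ∈ downFrom (suc N) × squareIndex i * squareIndex i ≡ N
  into {i} _ eq = ∈-downFrom⁺ (s≤s (≤-trans (m≤m*m (squareIndex i)) (≤-reflexive eq′))) , eq′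
    where
    eq′ : squareIndex i * squareIndex i ≡ N
    eq′ = trans (squareIndex² i) (trans (cong (λ k → 24 * k + 1) eq) (sym N≡))
  onto : ∀ {x} → x ∈ downFrom (suc N) → x * x ≡ N → ∃[ i ] (i ∈ ints n × pent i ≡ n × squareIndex i ≡ x)
  onto {x} _ eq = go (squareIndex-onto x n (trans eq N≡)) eq
    where
    go : ∀ {x} → ∃[ i ] squareIndex i ≡ x → x * x ≡ N → ∃[ i ] (i ∈ ints n × pent i ≡ n × squareIndex i ≡ x)
    go (i , refl) eq = i , ∈-ints i (≤-trans (∣i∣≤pent i) (≤-reflexive eq′)) , eq′ , refl
      where
      eq′ : pent i ≡ n
      eq′ = *-cancelˡ-≡ (pent i) n 24 (+-cancelʳ-≡ 1 (24 * pent i) (24 * n) (trans (sym (squareIndex² i)) (trans eq N≡)))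

⨁-true : ∀ {A : Set} (g : A → Bool) xs → ⨁ g xs ≡ true → ∃[ x ] g x ≡ true
⨁-true g (x ∷ xs) h = go (g x) refl
  where
  go : ∀ v → g x ≡ v → ∃[ y ] g y ≡ true
  go true  e = x , e
  go false e = ⨁-true g xs (trans (sym (cong (_xor ⨁ g xs) e)) h)

mono-true : ∀ {e n} → mono e n ≡ true → e ≡ n
mono-true {e} {n} h = ≡ᵇ⇒≡ e n (subst T (sym h) _)

squares-true : ∀ N → squares N ≡ true → ∃[ x ] x * x ≡ N
squares-true N h with ⨁-true _ (downFrom (suc N)) h
... | x , e = x , mono-true {x * x} e

∧-true : ∀ u {v} → u ∧ v ≡ true → u ≡ true × v ≡ true
∧-true true e = refl , e

θ-true : ∀ n → θ n ≡ true → ∃[ m ] m * m ≡ n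
θ-true n h with ⨁-true _ (downFrom (suc n)) h
... | m , e = m , mono-true {m * m} (proj₂ (∧-true (θ-weight m) e))

⊛-⨁ : ∀ a c n → (a ⊛ c) n ≡ ⨁ (λ j → a j ∧ c (n ∸ j)) (downFrom (suc n))
⊛-⨁ a c zero    = sym (Bool.xor-identityʳ _)
⊛-⨁ a c (suc n) = begin
  (a ⊛ c) (suc n)                                                     ≡⟨ ⊛-last a c n ⟩
  (a ⊛ tail c) n xor (a (suc n) ∧ c 0)                                ≡⟨ 𝔽₂.+-comm ((a ⊛ tail c) n) (a (suc n) ∧ c 0) ⟩
  (a (suc n) ∧ c 0) xor (a ⊛ tail c) n                                ≡⟨ cong₂ _xor_ (cong (λ k → a (suc n) ∧ c k) (sym (n∸n≡0 n))) (⊛-⨁ a (tail c) n) ⟩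
  (a (suc n) ∧ c (n ∸ n)) xor ⨁ (λ j → a j ∧ c (suc (n ∸ j))) (downFrom (suc n))
    ≡⟨ cong ((a (suc n) ∧ c (n ∸ n)) xor_) (⨁-cong (downFrom (suc n)) λ {j} j∈ → cong (λ k → a j ∧ c k) (sym (+-∸-assoc 1 (s≤s⁻¹ (∈-downFrom⁻ j∈))))) ⟩
  ⨁ (λ j → a j ∧ c (suc n ∸ j)) (downFrom (suc (suc n)))            ∎
  where open ≡-Reasoning

-- The coefficients of θ η at p n + α

¬true⇒false : ∀ {v} → ¬ v ≡ true → v ≡ false
¬true⇒false {true}  h = ⊥-elim (h refl)
¬true⇒false {false} _ = refl

-- A square divisible by the prime `p` is the square of a multiple of `p`, so the solutions for p² j
-- are `p` times those for `j`. Used with the weight of θ and with the constant weight for η.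
gen-squares-dilate : ∀ {p} w j → Prime p → (∀ m → w (p * m) ≡ w m) →
  gen w (λ m → m * m) (downFrom (suc (p * p * j))) (p * p * j) ≡ gen w (λ m → m * m) (downFrom (suc j)) j
gen-squares-dilate {p} w j pr w-p = sym (⨁-bijection (λ m → T? (w m) ×-dec (m * m ≟ j)) (λ m → T? (w m) ×-dec (m * m ≟ p * p * j))
  (p *_) (*-cancelˡ-≡ _ _ p) (Unique.downFrom⁺ (suc j)) (Unique.downFrom⁺ (suc (p * p * j))) into onto)
  where
  instance
    nz : NonZero p
    nz = prime⇒nonZero pr
    nz² : NonZero (p * p)
    nz² = m*n≢0 p p
  into : ∀ {m} → m ∈ downFrom (suc j) → T (w m) × m * m ≡ j → p * m ∈ downFrom (suc (p * p * j)) × T (w (p * m)) × p * m * (p * m) ≡ p * p * j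
  into {m} _ (tw , eq) = ∈-downFrom⁺ (s≤s (≤-trans (m≤m*m (p * m)) (≤-reflexive eq′))) , subst T (sym (w-p m)) tw , eq′
    where
    eq′ : p * m * (p * m) ≡ p * p * j
    eq′ = trans (*-interchange p m p m) (cong (p * p *_) eq)
  onto : ∀ {y} → y ∈ downFrom (suc (p * p * j)) → T (w y) × y * y ≡ p * p * j → ∃[ m ] (m ∈ downFrom (suc j) × (T (w m) × m * m ≡ j) × p * m ≡ y)
  onto {y} _ (tw , eq) = go (prime∣²⇒∣ y pr (subst (p ∣_) (sym eq) (∣m⇒∣m*n j (m∣m*n p)))) tw eq
    where
    go : ∀ {y} → p ∣ y → T (w y) → y * y ≡ p * p * j → ∃[ m ] (m ∈ downFrom (suc j) × (T (w m) × m * m ≡ j) × p * m ≡ y)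
    go (divides m refl) tw eq = m , ∈-downFrom⁺ (s≤s (≤-trans (m≤m*m m) (≤-reflexive eq′)))
      , (subst T (trans (cong w (*-comm m p)) (w-p m)) tw , eq′) , *-comm p m
      where
      eq′ : m * m ≡ j
      eq′ = *-cancelˡ-≡ (m * m) j (p * p) (trans (*-interchange p p m m)
              (trans (cong₂ _*_ (*-comm p m) (*-comm p m)) eq))

square%24 : ∀ {r} → r < 24 → χ⁻ r ≡ true → (r * r) % 24 ≡ 1
square%24 = from-yes (allUpTo? (λ r → (χ⁻ r Bool.≟ true) →-dec ((r * r) % 24 ≟ 1)) 24)

[24n+1]%24 : ∀ n → (24 * n + 1) % 24 ≡ 1
[24n+1]%24 n = trans (cong (_% 24) (trans (+-comm (24 * n) 1) (cong (1 +_) (*-comm 24 n)))) ([m+kn]%n≡m%n 1 n 24)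

-- Write 24 α + 1 = c p². Then α < p² forces c < 24, while p² and 24 α + 1 are both 1 modulo 24, so
-- c is 1 modulo 24 as well.
residue-α : ∀ p {α} → χ⁻ (p % 24) ≡ true → α < p * p → p * p ∣ 24 * α + 1 → 24 * α + 1 ≡ p * p
residue-α p {α} χp α< (divides c eq) = trans eq (trans (cong (_* (p * p)) c≡1) (*-identityˡ (p * p)))
  where
  c<24 : c < 24
  c<24 = ≰⇒> λ 24≤c → <⇒≱ (begin-strict
    24 * α + 1     <⟨ +-monoʳ-< (24 * α) {1} {24} (s≤s (s≤s z≤n)) ⟩
    24 * α + 24    ≡⟨ trans (+-comm (24 * α) 24) (sym (*-suc 24 α)) ⟩
    24 * suc α     ≤⟨ *-monoʳ-≤ 24 α< ⟩
    24 * (p * p)   ∎) (≤-trans (*-monoˡ-≤ (p * p) 24≤c) (≤-reflexive (sym eq)))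
    where open ≤-Reasoning
  p²%24 : (p * p) % 24 ≡ 1
  p²%24 = trans (%-distribˡ-* p p 24) (square%24 (m%n<n p 24) χp)
  c≡1 : c ≡ 1
  c≡1 = begin
    c                                  ≡⟨ m<n⇒m%n≡m c<24 ⟨
    c % 24                             ≡⟨ m%n%n≡m%n c 24 ⟨
    c % 24 % 24                        ≡⟨ cong (_% 24) (*-identityʳ (c % 24)) ⟨
    (c % 24 * 1) % 24                  ≡⟨ cong (λ r → (c % 24 * r) % 24) p²%24 ⟨
    (c % 24 * ((p * p) % 24)) % 24     ≡⟨ %-distribˡ-* c (p * p) 24 ⟨
    (c * (p * p)) % 24                 ≡⟨ cong (_% 24) eq ⟨
    (24 * α + 1) % 24                  ≡⟨ [24n+1]%24 α ⟩
    1                                  ∎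
    where open ≡-Reasoning

inert∤24 : ∀ {p} → Inert p → ¬ p ∣ 24
inert∤24 {p} inert d = [ ∤2 , [ ∤2 , [ ∤2 , ∤3 ]′ ∘ split 3 ]′ ∘ split 6 ]′ (split 12 d)
  where
  split : ∀ k → p ∣ 2 * k → p ∣ 2 ⊎ p ∣ k
  split k = euclidsLemma 2 k (proj₁ inert)
  ∤2 : ¬ p ∣ 2
  ∤2 = inert∤2 inert
  ∤3 : ¬ p ∣ 3
  ∤3 d = <⇒≱ (inert⇒3< inert) (∣⇒≤ d)

*-cancel-≤-remainder : ∀ q {j k r} → r < q → q * j ≤ q * k + r → j ≤ k
*-cancel-≤-remainder q {j} {k} {r} r<q le = ≮⇒≥ λ k<j → <⇒≱ (begin-strict
  q * k + r     <⟨ +-monoʳ-< (q * k) r<q ⟩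
  q * k + q     ≡⟨ trans (+-comm (q * k) q) (sym (*-suc q k)) ⟩
  q * suc k     ≤⟨ *-monoʳ-≤ q k<j ⟩
  q * j         ∎) le
  where open ≤-Reasoning

module _ {p α} (inert : Inert p) (24α+1≡p² : 24 * α + 1 ≡ p * p) where

  private
    pr : Prime p
    pr = proj₁ inert

    instance
      nz : NonZero p
      nz = prime⇒nonZero pr
      nz² : NonZero (p * p)
      nz² = m*n≢0 p p

  -- Nonzero coefficients yield x² = 24 i + 1 and m² = j, so that x² + 24 m² = 24 (p n + α) + 1 = p
  -- (24 n + p). This is divisible by the inert `p`, and hence so are both roots.
  hit : ∀ n i j → i + j ≡ p * n + α → η i ≡ true → θ j ≡ true →
        ∃[ x ] ∃[ m ] ((p * x) * (p * x) + 24 * ((p * m) * (p * m)) ≡ p * (24 * n + p) × (p * m) * (p * m) ≡ j)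
  hit n i j i+j≡ ηi θj = go (squares-true (24 * i + 1) (trans (sym (η-squares i refl)) ηi)) (θ-true j θj)
    where
    norm : ∀ {x m} → x * x ≡ 24 * i + 1 → m * m ≡ j → x * x + 24 * (m * m) ≡ p * (24 * n + p)
    norm {x} {m} ex em = begin
      x * x + 24 * (m * m)         ≡⟨ cong₂ (λ u v → u + 24 * v) ex em ⟩
      24 * i + 1 + 24 * j          ≡⟨ collect i j ⟩
      24 * (i + j) + 1             ≡⟨ cong (λ k → 24 * k + 1) i+j≡ ⟩
      24 * (p * n + α) + 1         ≡⟨ expand p n α ⟩
      p * (24 * n) + (24 * α + 1)  ≡⟨ cong (p * (24 * n) +_) 24α+1≡p² ⟩
      p * (24 * n) + p * p         ≡⟨ *-distribˡ-+ p (24 * n) p ⟨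
      p * (24 * n + p)             ∎
      where
      open ≡-Reasoning
      collect : ∀ i j → 24 * i + 1 + 24 * j ≡ 24 * (i + j) + 1
      collect = solve-∀
      expand : ∀ p n α → 24 * (p * n + α) + 1 ≡ p * (24 * n) + (24 * α + 1)
      expand = solve-∀
    Result = ∃[ x ] ∃[ m ] ((p * x) * (p * x) + 24 * ((p * m) * (p * m)) ≡ p * (24 * n + p) × (p * m) * (p * m) ≡ j)
    conclude : ∀ {x m} → p ∣ x → p ∣ m → x * x + 24 * (m * m) ≡ p * (24 * n + p) → m * m ≡ j → Result
    conclude (divides x refl) (divides m refl) e₁ e₂ = x , m
      , trans (cong₂ (λ x m → x * x + 24 * (m * m)) (*-comm p x) (*-comm p m)) e₁ , trans (cong (λ m → m * m) (*-comm p m)) e₂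
    go : ∃[ x ] x * x ≡ 24 * i + 1 → ∃[ m ] m * m ≡ j → Result
    go (x , ex) (m , em) = let e = norm {x} {m} ex em ; p∣x , p∣m = inert-∣² x m inert (subst (p ∣_) (sym e) (m∣m*n (24 * n + p))) in conclude p∣x p∣m e em

  -- The left-hand side is divisible by p², so `p` divides 24 n + p.
  hit⇒p∣n : ∀ {n} x m → (p * x) * (p * x) + 24 * ((p * m) * (p * m)) ≡ p * (24 * n + p) → p ∣ n
  hit⇒p∣n {n} x m eq = [ (λ d → ⊥-elim (inert∤24 inert d)) , (λ d → d) ]′ (euclidsLemma 24 n pr
    (∣m+n∣m⇒∣n (subst (p ∣_) (+-comm (24 * n) p) (divides (x * x + 24 * (m * m)) eq′)) ∣-refl))
    where
    factor : ∀ p x m → (p * x) * (p * x) + 24 * ((p * m) * (p * m)) ≡ p * ((x * x + 24 * (m * m)) * p)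
    factor = solve-∀
    eq′ : 24 * n + p ≡ (x * x + 24 * (m * m)) * p
    eq′ = *-cancelˡ-≡ (24 * n + p) _ p (trans (sym eq) (factor p x m))

  coefficient-∤ : ∀ {n} → ¬ p ∣ n → (θ ⊛ η) (p * n + α) ≡ false
  coefficient-∤ {n} p∤n = trans (⊛-⨁ θ η N) (⨁-false (downFrom (suc N)) λ {j} j∈ → ¬true⇒false λ h →
      no-hit j (s≤s⁻¹ (∈-downFrom⁻ j∈)) (∧-true (θ j) h))
    where
    N = p * n + α
    no-hit : ∀ j → j ≤ N → θ j ≡ true × η (N ∸ j) ≡ true → ⊥
    no-hit j j≤N (θj , ηi) = let x , m , eq , _ = hit n (N ∸ j) j (m∸n+n≡m j≤N) ηi θj in p∤n (hit⇒p∣n x m eq)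

  θ-dilate : ∀ j → θ (p * p * j) ≡ θ j
  θ-dilate j = gen-squares-dilate θ-weight j pr λ m → θ-weight-* p m (1≤prime pr) λ d →
    [ (λ 3∣p → ⊥-elim (<⇒≢ (inert⇒3< inert) (prime∣prime⇒≡ prime[3] pr 3∣p))) , (λ d → d) ]′ (euclidsLemma p m prime[3] d)

  -- Completing the square turns the shift by α into a dilation: 24 (p² i + α) + 1 = p² (24 i + 1).
  η-dilate : ∀ i → η (p * p * i + α) ≡ η i
  η-dilate i = trans (η-squares (p * p * i + α) N≡) (trans (gen-squares-dilate true₁ (24 * i + 1) pr (λ _ → refl)) (sym (η-squares i refl)))
    where
    expand : ∀ q i α → 24 * (q * i + α) + 1 ≡ q * (24 * i) + (24 * α + 1)
    expand = solve-∀
    factor : ∀ q i → q * (24 * i) + q ≡ q * (24 * i + 1)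
    factor = solve-∀
    N≡ : p * p * (24 * i + 1) ≡ 24 * (p * p * i + α) + 1
    N≡ = sym (trans (expand (p * p) i α) (trans (cong (p * p * (24 * i) +_) 24α+1≡p²) (factor (p * p) i)))

  -- By `hit`, a nonzero summand of the longer convolution sits at an index p² m², and α < p²
  -- ensures m² ≤ k. At an index p² j with j ≤ k the two dilations identify the summand with the one
  -- at `j` in the shorter convolution.
  coefficient-∣ : ∀ k → α < p * p → (θ ⊛ η) (p * (k * p) + α) ≡ (θ ⊛ η) k
  coefficient-∣ k α<p² = begin
    (θ ⊛ η) N                                                ≡⟨ ⊛-⨁ θ η N ⟩
    ⨁ (λ j → θ j ∧ η (N ∸ j)) (downFrom (suc N))            ≡⟨ ⨁-bijection (λ j → T? (θ j ∧ η (k ∸ j))) (λ j → T? (θ j ∧ η (N ∸ j))) (p * p *_) (*-cancelˡ-≡ _ _ (p * p))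
                                                                  (Unique.downFrom⁺ (suc k)) (Unique.downFrom⁺ (suc N)) into onto ⟨
    ⨁ (λ j → θ j ∧ η (k ∸ j)) (downFrom (suc k))            ≡⟨ ⊛-⨁ θ η k ⟨
    (θ ⊛ η) k                                                ∎
    where
    open ≡-Reasoning
    N = p * (k * p) + α
    N≡ : N ≡ p * p * k + α
    N≡ = cong (_+ α) (rearrange p k)
      where
      rearrange : ∀ p k → p * (k * p) ≡ p * p * k
      rearrange = solve-∀
    summand : ∀ {j} → j ≤ k → θ (p * p * j) ∧ η (N ∸ p * p * j) ≡ θ j ∧ η (k ∸ j)
    summand {j} j≤k = cong₂ _∧_ (θ-dilate j) (trans (cong η (begin
      N ∸ p * p * j                    ≡⟨ cong (_∸ p * p * j) N≡ ⟩
      p * p * k + α ∸ p * p * j        ≡⟨ +-∸-comm α (*-monoʳ-≤ (p * p) j≤k) ⟩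
      p * p * k ∸ p * p * j + α        ≡⟨ cong (_+ α) (*-distribˡ-∸ (p * p) k j) ⟨
      p * p * (k ∸ j) + α              ∎)) (η-dilate (k ∸ j)))
    into : ∀ {j} → j ∈ downFrom (suc k) → T (θ j ∧ η (k ∸ j)) → p * p * j ∈ downFrom (suc N) × T (θ (p * p * j) ∧ η (N ∸ p * p * j))
    into {j} j∈ t = ∈-downFrom⁺ (s≤s (≤-trans (*-monoʳ-≤ (p * p) j≤k) (≤-trans (m≤m+n (p * p * k) α) (≤-reflexive (sym N≡)))))
                  , subst T (sym (summand j≤k)) t
      where
      j≤k = s≤s⁻¹ (∈-downFrom⁻ j∈)
    onto : ∀ {y} → y ∈ downFrom (suc N) → T (θ y ∧ η (N ∸ y)) → ∃[ j ] (j ∈ downFrom (suc k) × T (θ j ∧ η (k ∸ j)) × p * p * j ≡ y)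
    onto {y} y∈ t = go (hit (k * p) (N ∸ y) y (m∸n+n≡m y≤N) (proj₂ both) (proj₁ both))
      where
      y≤N = s≤s⁻¹ (∈-downFrom⁻ y∈)
      T⇒≡ : ∀ {v} → T v → v ≡ true
      T⇒≡ {true} _ = refl
      both = ∧-true (θ y) (T⇒≡ t)
      go : ∃[ x ] ∃[ m ] ((p * x) * (p * x) + 24 * ((p * m) * (p * m)) ≡ p * (24 * (k * p) + p) × (p * m) * (p * m) ≡ y) →
           ∃[ j ] (j ∈ downFrom (suc k) × T (θ j ∧ η (k ∸ j)) × p * p * j ≡ y)
      go (_ , m , _ , eq) = m * m , ∈-downFrom⁺ (s≤s j≤k) , subst T (trans (cong (λ z → θ z ∧ η (N ∸ z)) (sym eq′)) (summand j≤k)) t , eq′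
        where
        eq′ : p * p * (m * m) ≡ y
        eq′ = trans (*-interchange p p m m) eq
        j≤k : m * m ≤ k
        j≤k = *-cancel-≤-remainder (p * p) α<p² (≤-trans (≤-reflexive eq′) (≤-trans y≤N (≤-reflexive N≡)))

odd⇒%2 : ∀ m n → odd m ≡ odd n → m % 2 ≡ n % 2
odd⇒%2 m n eq = trans (%2≡ m) (trans (cong (λ v → if v then 1 else 0) eq) (sym (%2≡ n)))
  where
  %2≡ : ∀ m → m % 2 ≡ (if odd m then 1 else 0)
  %2≡ zero          = refl
  %2≡ (suc zero)    = refl
  %2≡ (suc (suc m)) = trans (trans (cong (_% 2) (+-comm 2 m)) ([m+n]%n≡m%n m 2))
    (trans (%2≡ m) (cong (λ v → if v then 1 else 0) (sym (Bool.not-involutive (odd m)))))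

odd-b₃ : ∀ n → odd (b 3 (2 * n)) ≡ (θ ⊛ η) n
odd-b₃ n = trans (cong (λ k → odd (b 3 k)) (sym (double≡2* n))) (evenPart-B₃ n)

inert⇒good : ∀ p → Inert p → GoodPrime p
inert⇒good p inert@(pr , χp) = pr , inert⇒3< inert , congruence
  where
  congruence : (α : ℕ) → 0 < α → α < p * p → p * p ∣ 24 * α + 1 → (n : ℕ) → b 3 (2 * (p * n + α)) % 2 ≡ rhsCoeff p n % 2
  congruence α _ α<p² p²∣ n with p ∣? n
  ... | yes (divides k refl) = odd⇒%2 (b 3 (2 * (p * (k * p) + α))) (b 3 (2 * k)) (trans (odd-b₃ (p * (k * p) + α)) (trans (coefficient-∣ inert (residue-α p χp α<p² p²∣) k α<p²) (sym (odd-b₃ k))))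
  ... | no p∤n = odd⇒%2 (b 3 (2 * (p * n + α))) 0 (trans (odd-b₃ (p * n + α)) (coefficient-∤ inert (residue-α p χp α<p² p²∣) p∤n))

theorem1p1 : ∃[ c ] ∃[ N ] ((x : ℕ) → N ≤ x →
    ∃[ ps ] (Unique ps × All (λ p → p ≤ x × GoodPrime p) ps
    × primeCount x ≤ suc c * length ps))
theorem1p1 = positiveProportion inert⇒good
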